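{- Let $m,n,p,q\ge3$ be odd and $k\ge 3$. Suppose $\mathcal{F}_i$, $\mathcal{G}_i$, $\mathcal{H}_i$, $\mathcal{K}_i$ ($1\le i\le k$) are families of pairwise almost orthogonal symmetric chain decompositions of $Q_m$, $Q_n$, $Q_p$, $Q_q$ respectively, and two of these four families are good. Then there exist $k$ pairwise almost orthogonal symmetric chain decompositions $\mathcal{D}_1,\dots,\mathcal{D}_k$ of $Q_{m+n+p+q}=Q_m\times Q_n\times Q_p\times Q_q$ such that for each $i$ every chain of $\mathcal{D}_i$ is contained in a cuboid $A\times B\times C\times D$ with $A\in\mathcal{F}_i$, $B\in\mathcal{G}_i$, $C\in\mathcal{H}_i$, $D\in\mathcal{K}_i$.
   Context: $Q_n$ denotes the Boolean lattice of subsets of $[n]=\{1,\dots,n\}$ under inclusion; products of hypercubes (product order) are identified with the hypercube of the summed dimension. A symmetric chain in $Q_n$ consists of exactly one subset of each size $j,\dots,n-j$ for some $j$; a symmetric chain decomposition (SCD) is a partition into symmetric chains. Two SCDs $\mathcal{F},\mathcal{G}$ of $Q_n$ are almost orthogonal if for all chains $A\in\mathcal{F}$, $B\in\mathcal{G}$, $|A\cap B|\le1$, except when $A$ and $B$ both contain $\varnothing$ and $[n]$, in which case $|A\cap B|=2$. For $n$ odd, a collection $\{\mathcal{F}^j\}$ of pairwise almost orthogonal SCDs of $Q_n$ is good if the graph whose vertex set is the union of all $2$-element chains of all $\mathcal{F}^j$ and whose edges are these $2$-element chains admits an orientation in which every vertex has out-degree at most $1$. -}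

module Defs where

open import Data.Nat using (ℕ; zero; suc; _+_; _≤_; _%_)
open import Data.Bool using (Bool; true; false)
import Data.Bool as Bool
open import Data.Fin using (Fin; toℕ)
open import Data.Fin.Subset public using (Subset; _⊆_; ∣_∣; ⊥; ⊤)
open import Data.Vec using (Vec)
import Data.Vec.Properties as VecP
open import Data.List using (List; []; _∷_; length; lookup; filter)
open import Data.List.Membership.Propositional using (_∈_)
open import Data.List.Relation.Unary.Linked using (Linked)
open import Data.List.Relation.Unary.Any using (any?)
open import Data.Product using (Σ; ∃; _×_; _,_)
open import Data.Maybe using (Maybe; just; nothing)
open import Relation.Binary.PropositionalEquality using (_≡_; _≢_)
open import Relation.Nullary using (¬_)
open import Relation.Binary.Definitions using (DecidableEquality)

Odd : ℕ → Set
Odd n = n % 2 ≡ 1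

_≟S_ : ∀ {n} → DecidableEquality (Subset n)
_≟S_ = VecP.≡-dec Bool._≟_

-- A chain is given as a list of subsets listed in increasing order.
Chain : ℕ → Set
Chain n = List (Subset n)

-- A symmetric chain in Q_n: subsets x_0 ⊆ x_1 ⊆ ... ⊆ x_ℓ with |x_i| = j + i
-- for some j with 2j ≤ n, and ℓ + 1 + 2j = n + 1, i.e. exactly one subset of
-- each size j, ..., n - j, totally ordered by inclusion.
IsSymChain : (n : ℕ) → Chain n → Set
IsSymChain n c =
  Σ ℕ λ j →
    (j + j ≤ n)
    × (length c + j + j ≡ suc n)
    × (∀ (i : Fin (length c)) → ∣ lookup c i ∣ ≡ j + toℕ i)
    × Linked _⊆_ c

IsSCD : (n : ℕ) → List (Chain n) → Set
IsSCD n F =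
  (∀ (i : Fin (length F)) → IsSymChain n (lookup F i))
  × (∀ (x : Subset n) → Σ (Fin (length F)) λ i → x ∈ lookup F i)
  × (∀ (x : Subset n) (i i' : Fin (length F)) →
       x ∈ lookup F i → x ∈ lookup F i' → i ≡ i')

-- |A ∩ B| for chains A, B (chains have no repeated elements)
common : ∀ {n} → Chain n → Chain n → ℕ
common A B = length (filter (λ x → any? (x ≟S_) B) A)

AlmostOrthogonal : (n : ℕ) → List (Chain n) → List (Chain n) → Set
AlmostOrthogonal n F G =
  ∀ A B → A ∈ F → B ∈ G →
    ((⊥ ∈ A × ⊤ ∈ A × ⊥ ∈ B × ⊤ ∈ B) → common A B ≡ 2)
    × (¬ (⊥ ∈ A × ⊤ ∈ A × ⊥ ∈ B × ⊤ ∈ B) → common A B ≤ 1)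

IsPAOFamily : (n k : ℕ) → (Fin k → List (Chain n)) → Set
IsPAOFamily n k F =
  (∀ i → IsSCD n (F i)) × (∀ i i' → i ≢ i' → AlmostOrthogonal n (F i) (F i'))

tail2 : ∀ {n} → Bool → Chain n → Maybe (Subset n)
tail2 true  (x ∷ y ∷ []) = just x
tail2 false (x ∷ y ∷ []) = just y
tail2 _     _            = nothing

-- Edges of the graph: pairs (i, position of a chain in F i); only those of
-- length 2 are actual edges.  An orientation assigns to each an endpoint as
-- tail; out-degree ≤ 1 means distinct edges have distinct tails.
EdgeIx : ∀ {n k} → (Fin k → List (Chain n)) → Set
EdgeIx {k = k} F = Σ (Fin k) λ i → Fin (length (F i))

edge : ∀ {n k} (F : Fin k → List (Chain n)) → EdgeIx F → Chain n
edge F (i , c) = lookup (F i) c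

Good : (n k : ℕ) → (Fin k → List (Chain n)) → Set
Good n k F =
  Σ (EdgeIx F → Bool) λ orient →
    ∀ (e e' : EdgeIx F) (t : Subset n) →
      tail2 (orient e) (edge F e) ≡ just t →
      tail2 (orient e') (edge F e') ≡ just t →
      e ≡ e'

{-# OPTIONS --safe #-}

-- Every product of four chains A × B × C × D, one from each i-th decomposition, is partitioned into
-- symmetric chains, and D_i collects the results.  Two points of a chain can also lie on a chain of
-- D_j (j ≠ i) only if in each coordinate they are equal or are ∅ and the whole set; such a pair is a
-- jump, and a coordinate can jump only if its factor is full, that is, contains ∅ and the whole set.
-- So it suffices to avoid jumps.  This is possible except in two situations.  If one factor is full
-- and the other three have two points, jumps are confined to points at which the factor from a good
-- family is at the tail of its edge; by goodness such points differ for different i.  If all four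
-- factors are full, the chain through both extreme corners jumps, as it should, and the remaining
-- jumps change the last two coordinates at a point whose second coordinate b is neither ∅ nor
-- everything; a conflict would give two full chains of almost orthogonal decompositions sharing b.
-- Inside a product of two full chains jumps are dodged by cutting off a few explicit
-- paths such that what remains is a smaller rectangle without jumps.
module Submission where

open import Defs
import Algebra.Solver.CommutativeMonoid
open import Data.Bool as Bool using (true; false; _∧_; _∨_; not)
open import Data.Bool.Properties using (T?; T-∨)
open import Data.Empty using (⊥-elim) renaming (⊥ to Empty)
open import Data.Fin as Fin using (Fin; toℕ)
open import Data.Fin.Patterns using (0F; 1F; 2F; 3F; 4F; 5F; 6F; 7F; 8F)
import Data.Fin.Properties as FinP
open import Data.Fin.Subset using (inside; outside)
open import Data.Fin.Subset.Properties using (⊆-refl; ∣⊥∣≡0; ∣⊤∣≡n; ∣p∣≡n⇒p≡⊤; drop-∷-⊆)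
open import Data.List
  using (List; []; _∷_; _++_; [_]; map; concat; _∷ʳ_; cartesianProduct; length; allFin; lookup; filter)
open import Data.List.Membership.Propositional using (_∈_)
open import Data.List.Membership.Propositional.Properties
  using (∈-++⁺ʳ; ∈-filter⁺; ∈-filter⁻; ∈-concat⁺′; ∈-concat⁻′; ∈-lookup; ∈-map⁺; ∈-map⁻;
         ∈-cartesianProduct⁺; ∈-cartesianProduct⁻)
open import Data.List.Properties
  using (++-assoc; ++-identityʳ; map-++; concat-++; cartesianProductWith-distribʳ-++; map-∘; length-++;
         map-id; concat-map)
open import Data.List.Relation.Binary.Permutation.Propositional
  using (_↭_; ↭-refl; ↭-sym; ↭-trans; ↭-reflexive; prep; refl; module PermutationReasoning; ↭⇒↭ₛ)
open import Data.List.Relation.Binary.Permutation.Propositional.Properties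
  using (++⁺; ++⁺ˡ; ++⁺ʳ; shifts; ++-comm; ++-commutativeMonoid; map⁺; ∈-resp-↭)
open import Data.List.Relation.Binary.Permutation.Setoid.Properties using (Unique-resp-↭)
open import Data.List.Relation.Unary.All as All using (All; []; _∷_)
import Data.List.Relation.Unary.All.Properties as AllP
open import Data.List.Relation.Unary.AllPairs as AllPairs using (AllPairs; []; _∷_; allPairs?)
import Data.List.Relation.Unary.AllPairs.Properties as APP
open import Data.List.Relation.Unary.Any using (here; there; any?; index)
open import Data.List.Relation.Unary.Any.Properties using (lookup-index)
open import Data.List.Relation.Unary.Linked using (Linked; []; [-]; _∷_)
open import Data.List.Relation.Unary.Unique.Propositional using (Unique)
import Data.List.Relation.Unary.Unique.Propositional.Properties as UniqueP
open import Data.Maybe using (Maybe; just; nothing; from-just)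
open import Data.Nat using (ℕ; suc; zero; _+_; _*_; _≤_; _<_; s≤s; z≤n; _≟_; _/_; _%_; _≡ᵇ_; _<ᵇ_)
open import Data.Nat.DivMod using (_mod_; m*n%n≡0)
open import Data.Nat.Properties
  using (+-cancelʳ-≤; +-monoʳ-≤; m≤n+m; module ≤-Reasoning; +-assoc; +-comm; +-suc; ≤-trans; n≤1+n; 1+n≰n;
         ≤-reflexive; +-identityʳ; ≡⇒≡ᵇ; +-cancelˡ-≡; 1+n≢0; ≤-refl; <-trans; ≤-<-trans; <-irrefl;
         suc-injective; <⇒≱)
open import Data.Nat.Solver using (module +-*-Solver)
open import Data.Product using (Σ; ∃; _×_; _,_; proj₁; proj₂; swap; assocˡ; assocʳ)
open import Data.Product.Properties using (≡-dec)
open import Data.Sum as Sum using (_⊎_; inj₁; inj₂; [_,_]′)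
open import Data.Unit using () renaming (⊤ to Unit; tt to unit)
open import Data.Vec as Vec using (_∷_; [])
open import Data.Vec.Properties using (++-injective)
open import Function using (_∘_)
open import Function.Bundles using (Equivalence)
open import Level using (Lift; lift)
open import Relation.Binary.Definitions using (DecidableEquality; Decidable)
open import Relation.Binary.PropositionalEquality
  using (_≡_; refl; sym; trans; cong; cong₂; subst; subst₂; module ≡-Reasoning; _≢_; setoid)
open import Relation.Nullary using (¬_; Dec; yes; no; _×-dec_; _⊎-dec_; contradiction)
open import Relation.Nullary.Decidable as Dec using (from-yes)

-- A jump is a conjunction over the coordinates, so its absence `Sep` is a disjunction: one
-- coordinate suffices to keep two points apart. Two jump-free chains multiply into hooks, so a
-- subproduct that is already solved can be multiplied by any jump-free factor; the work lies with
-- the full factors. The zigzag gathers the jump of a product of two of them at the ends of a single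
-- chain; it can thus be applied to its own output, and it closes up once one side has its ends
-- apart. The obstacle is a side with two points, too short for a zigzag. A full chain times such a
-- pair leaves a line whose only jump stops short of its last point (`Hooked`); this line has to be
-- woven with a further full chain of at least four points. Oddness makes every chain even in size:
-- a thin chain has at least two points, a full one four or at least six. Two good families suffice
-- because, whichever coordinate jumps, one of them is among the other three. The jumps tolerated in
-- the i-th decomposition form a relation `Exception i`; for different indices, two such relations
-- agree on a pair of distinct points only at the extreme corners.

-- Sep x y holds for pairs that are not jumps.  Without eta equality, and with ⊗ defined by
-- copatterns, the factors of a product can be inferred by unification.
record Space : Set₁ where
  no-eta-equality
  field
    Pt         : Set
    rank       : Pt → ℕ
    Below      : Pt → Pt → Set
    Below-refl : ∀ {x} → Below x x
    Sep        : Pt → Pt → Set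

open Space

infixl 6 _⊗_

_⊗_ : Space → Space → Space
(X ⊗ Y) .Pt                  = Pt X × Pt Y
(X ⊗ Y) .rank (x , y)        = rank X x + rank Y y
(X ⊗ Y) .Below (x , y) (z , w) = Below X x z × Below Y y w
(X ⊗ Y) .Below-refl          = Below-refl X , Below-refl Y
(X ⊗ Y) .Sep (x , y) (z , w) = Sep X x z ⊎ Sep Y y w

-- Saturated walks and symmetric chains

record Step (X : Space) (x y : Pt X) : Set where
  constructor step
  field
    below : Below X x y
    up    : rank X y ≡ suc (rank X x)

-- A wrapper around `Sep`, which computes to a sum on products: from `Apart X x y` the space and the
-- points can be inferred. It is asserted along a list, for the earlier point against the later one.
data Apart (X : Space) (x y : Pt X) : Set where
  apart : Sep X x y → Apart X x y

Free : (X : Space) → List (Pt X) → Set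
Free X = AllPairs (Apart X)

-- The list of a walk omits its starting point, so that walks concatenate.
infixr 5 _∷_ _⁀_

data Walk (X : Space) (x : Pt X) : List (Pt X) → Pt X → Set where
  []  : Walk X x [] x
  _∷_ : ∀ {y P z} → Step X x y → Walk X y P z → Walk X x (y ∷ P) z

_⁀_ : ∀ {X x y z P Q} → Walk X x P y → Walk X y Q z → Walk X x (P ++ Q) z
[]      ⁀ v = v
(s ∷ w) ⁀ v = s ∷ (w ⁀ v)

-- The rank sum of the two ends encodes symmetry: in dimension N the ends have sizes j and N - j.
data Chainₙ (X : Space) (N : ℕ) : List (Pt X) → Set where
  chain : ∀ {x P y} → Walk X x P y → rank X x + rank X y ≡ N → Chainₙ X N (x ∷ P)

unsnoc : ∀ {X x y P z} → Walk X x (y ∷ P) z →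
         Σ (List (Pt X)) λ P′ → Σ (Pt X) λ z′ →
           (y ∷ P ≡ P′ ∷ʳ z) × Walk X x P′ z′ × Step X z′ z
unsnoc {x = x} (s ∷ [])      = [] , x , refl , [] , s
unsnoc {y = y} (s ∷ t ∷ w) with unsnoc (t ∷ w)
... | P′ , z′ , eq , w′ , t′ = y ∷ P′ , z′ , cong (y ∷_) eq , s ∷ w′ , t′

last-All : ∀ {X x P y} {R : Pt X → Set} → Walk X x P y → All R (x ∷ P) → R y
last-All []      (r ∷ _)  = r
last-All (s ∷ w) (_ ∷ rs) = last-All w rs

module _ {A : Set} {R : A → A → Set} where

  AP-++ˡ : ∀ xs {ys} → AllPairs R (xs ++ ys) → AllPairs R xs
  AP-++ˡ []       _        = []
  AP-++ˡ (x ∷ xs) (r ∷ rs) = AllP.++⁻ˡ xs r ∷ AP-++ˡ xs rs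

  AP-++ʳ : ∀ xs {ys} → AllPairs R (xs ++ ys) → AllPairs R ys
  AP-++ʳ []       rs       = rs
  AP-++ʳ (x ∷ xs) (_ ∷ rs) = AP-++ʳ xs rs

  AP-cross : ∀ xs {ys} → AllPairs R (xs ++ ys) → All (λ x → All (R x) ys) xs
  AP-cross []       _        = []
  AP-cross (x ∷ xs) (r ∷ rs) = AllP.++⁻ʳ xs r ∷ AP-cross xs rs

-- Rectangles as lists of points

module _ {A B : Set} where

  row : List A → B → List (A × B)
  row P b = map (_, b) P

  col : A → List B → List (A × B)
  col a Q = map (a ,_) Q

  rect : List A → List B → List (A × B)
  rect = cartesianProduct

  rect-[] : ∀ P → rect P [] ≡ []
  rect-[] []      = refl
  rect-[] (p ∷ P) = rect-[] P

  rect-∷ʳ : ∀ P b Q → rect P (b ∷ Q) ↭ row P b ++ rect P Q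
  rect-∷ʳ []      b Q = ↭-refl
  rect-∷ʳ (p ∷ P) b Q = prep (p , b) (↭-trans (++⁺ˡ (col p Q) (rect-∷ʳ P b Q)) (shifts (col p Q) (row P b)))

  rect-++ˡ : ∀ P P′ Q → rect (P ++ P′) Q ≡ rect P Q ++ rect P′ Q
  rect-++ˡ P P′ Q = cartesianProductWith-distribʳ-++ _,_ P P′ Q

  rect-snocˡ : ∀ P a Q → rect (P ∷ʳ a) Q ≡ rect P Q ++ col a Q
  rect-snocˡ P a Q = trans (rect-++ˡ P [ a ] Q) (cong (rect P Q ++_) (++-identityʳ _))

  rect-++ʳ : ∀ P Q Q′ → rect P (Q ++ Q′) ↭ rect P Q ++ rect P Q′
  rect-++ʳ P []      Q′ = ↭-reflexive (cong (_++ rect P Q′) (sym (rect-[] P)))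
  rect-++ʳ P (q ∷ Q) Q′ = begin
    rect P (q ∷ Q ++ Q′)                 ↭⟨ rect-∷ʳ P q (Q ++ Q′) ⟩
    row P q ++ rect P (Q ++ Q′)          ↭⟨ ++⁺ˡ (row P q) (rect-++ʳ P Q Q′) ⟩
    row P q ++ rect P Q ++ rect P Q′     ≡⟨ sym (++-assoc (row P q) _ _) ⟩
    (row P q ++ rect P Q) ++ rect P Q′   ↭⟨ ++⁺ʳ (rect P Q′) (↭-sym (rect-∷ʳ P q Q)) ⟩
    rect P (q ∷ Q) ++ rect P Q′          ∎
    where open PermutationReasoning

  rect-congˡ : ∀ {P P′} Q → P ↭ P′ → rect P Q ↭ rect P′ Q
  rect-congˡ Q refl                   = ↭-refl
  rect-congˡ Q (prep x p)             = ++⁺ˡ _ (rect-congˡ Q p)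
  rect-congˡ Q (_↭_.swap x y p)       =
    ↭-trans (shifts (col x Q) (col y Q)) (++⁺ˡ (col y Q) (++⁺ˡ (col x Q) (rect-congˡ Q p)))
  rect-congˡ Q (_↭_.trans p q)        = ↭-trans (rect-congˡ Q p) (rect-congˡ Q q)

  rect-congʳ : ∀ P {Q Q′} → Q ↭ Q′ → rect P Q ↭ rect P Q′
  rect-congʳ []      p = ↭-refl
  rect-congʳ (x ∷ P) p = ++⁺ (map⁺ (x ,_) p) (rect-congʳ P p)

-- Rows and columns inside a product

module _ {X Y : Space} where

  row-walk : ∀ {x P z} b → Walk X x P z → Walk (X ⊗ Y) (x , b) (row P b) (z , b)
  row-walk b []               = []
  row-walk b (step l r ∷ w) = step (l , Below-refl Y) (cong (_+ rank Y b) r) ∷ row-walk b w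

  col-walk : ∀ {y Q z} a → Walk Y y Q z → Walk (X ⊗ Y) (a , y) (col a Q) (a , z)
  col-walk a []               = []
  col-walk a (step l r ∷ w) =
    step (Below-refl X , l) (trans (cong (rank X a +_) r) (+-suc (rank X a) _)) ∷ col-walk a w

  right : ∀ {x z b} → Step X x z → Step (X ⊗ Y) (x , b) (z , b)
  right {b = b} (step l r) = step (l , Below-refl Y) (cong (_+ rank Y b) r)

  above : ∀ {a y z} → Step Y y z → Step (X ⊗ Y) (a , y) (a , z)
  above {a} (step l r) = step (Below-refl X , l) (trans (cong (rank X a +_) r) (+-suc (rank X a) _))

  apart₁ : ∀ {x x′ y y′} → Apart X x x′ → Apart (X ⊗ Y) (x , y) (x′ , y′)
  apart₁ (apart s) = apart (inj₁ s)

  apart₂ : ∀ {x x′ y y′} → Apart Y y y′ → Apart (X ⊗ Y) (x , y) (x′ , y′)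
  apart₂ (apart s) = apart (inj₂ s)

  row-free : ∀ {P} b → Free X P → Free (X ⊗ Y) (row P b)
  row-free b = APP.map⁺ ∘ AllPairs.map apart₁

  row-free′ : ∀ P {b} → Apart Y b b → Free (X ⊗ Y) (row P b)
  row-free′ []      i = []
  row-free′ (p ∷ P) i = AllP.map⁺ (All.universal (λ _ → apart₂ i) P) ∷ row-free′ P i

  col-free : ∀ {Q} a → Free Y Q → Free (X ⊗ Y) (col a Q)
  col-free a = APP.map⁺ ∘ AllPairs.map apart₂

  -- The subscript names the coordinate that keeps the two pieces apart.
  row-col₂ : ∀ P {a b Q} → All (Apart Y b) Q → All (λ u → All (Apart (X ⊗ Y) u) (col a Q)) (row P b)
  row-col₂ P h = AllP.map⁺ (All.universal (λ _ → AllP.map⁺ (All.map apart₂ h)) P)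

  col-row₁ : ∀ {P a b} Q → All (Apart X a) P → All (λ u → All (Apart (X ⊗ Y) u) (row P b)) (col a Q)
  col-row₁ Q h = AllP.map⁺ (All.universal (λ _ → AllP.map⁺ (All.map apart₁ h)) Q)

  col-row₂ : ∀ P {a b Q} → All (λ q → Apart Y q b) Q → All (λ u → All (Apart (X ⊗ Y) u) (row P b)) (col a Q)
  col-row₂ P h = AllP.map⁺ (All.map (λ i → AllP.map⁺ (All.universal (λ _ → apart₂ i) P)) h)

  row-row₂ : ∀ P P′ {b b′} → Apart Y b b′ → All (λ u → All (Apart (X ⊗ Y) u) (row P′ b′)) (row P b)
  row-row₂ P P′ i = AllP.map⁺ (All.universal (λ _ → AllP.map⁺ (All.universal (λ _ → apart₂ i) P′)) P)

  col-col₁ : ∀ {a a′} Q Q′ → Apart X a a′ → All (λ u → All (Apart (X ⊗ Y) u) (col a′ Q′)) (col a Q)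
  col-col₁ Q Q′ i = AllP.map⁺ (All.universal (λ _ → AllP.map⁺ (All.universal (λ _ → apart₁ i) Q′)) Q)

-- A partition, stated as a permutation: the chains are disjoint and without repetition as soon as
-- the points of `S` are distinct.
record Decomp {A : Set} (Ψ : List A → Set) (S : List A) : Set where
  constructor decomp
  field
    chains : List (List A)
    good   : All Ψ chains
    covers : concat chains ↭ S

module _ {A : Set} {Ψ : List A → Set} where

  none : Decomp Ψ []
  none = decomp [] [] ↭-refl

  single : ∀ {P} → Ψ P → Decomp Ψ P
  single {P} ψ = decomp [ P ] (ψ ∷ []) (↭-reflexive (++-identityʳ P))

  infixr 5 _⊎ᵈ_

  _⊎ᵈ_ : ∀ {S T} → Decomp Ψ S → Decomp Ψ T → Decomp Ψ (S ++ T)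
  decomp C ψ c ⊎ᵈ decomp D φ d =
    decomp (C ++ D) (AllP.++⁺ ψ φ) (↭-trans (↭-reflexive (sym (concat-++ C D))) (++⁺ c d))

  recover : ∀ {S T} → S ↭ T → Decomp Ψ S → Decomp Ψ T
  recover p (decomp C ψ c) = decomp C ψ (↭-trans c p)

relax : ∀ {A : Set} {Ψ Φ : List A → Set} {S} → (∀ {P} → Ψ P → Φ P) → Decomp Ψ S → Decomp Φ S
relax f (decomp C ψ c) = decomp C (All.map f ψ) c

refineˡ : ∀ {A B : Set} {Ψ : List A → Set} {Φ : List (A × B) → Set} {S} Q → Decomp Ψ S →
          (∀ {P} → Ψ P → Decomp Φ (rect P Q)) → Decomp Φ (rect S Q)
refineˡ {Ψ = Ψ} {Φ} Q (decomp C ψ c) f = recover (rect-congˡ Q c) (go C ψ)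
  where
  go : ∀ C → All Ψ C → Decomp Φ (rect (concat C) Q)
  go []      []       = none
  go (P ∷ C) (ψ ∷ ψs) = recover (↭-reflexive (sym (rect-++ˡ P (concat C) Q))) (f ψ ⊎ᵈ go C ψs)

JumpFree : (X : Space) → ℕ → List (Pt X) → Set
JumpFree X N P = Chainₙ X N P × Free X P

Tame : (X : Space) → ℕ → List (Pt X) → Set
Tame X N = Decomp (JumpFree X N)

-- `seps` goes forward only, so a map may also make more pairs separate; this is how tolerated jumps
-- are introduced later.
record Hom (X Y : Space) : Set where
  field
    to    : Pt X → Pt Y
    ranks : ∀ x → rank Y (to x) ≡ rank X x
    mono  : ∀ {x y} → Below X x y → Below Y (to x) (to y)
    seps  : ∀ {x y} → Sep X x y → Sep Y (to x) (to y)

open Hom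

module _ {X Y : Space} (h : Hom X Y) where

  map-walk : ∀ {x P y} → Walk X x P y → Walk Y (to h x) (map (to h) P) (to h y)
  map-walk []                                = []
  map-walk {x} (_∷_ {y} (step l r) w) =
    step (mono h l) (trans (ranks h y) (trans r (cong suc (sym (ranks h x))))) ∷ map-walk w

  map-chain : ∀ {N P} → Chainₙ X N P → Chainₙ Y N (map (to h) P)
  map-chain (chain {x} {P} {y} w e) =
    chain (map-walk w) (trans (cong₂ _+_ (ranks h x) (ranks h y)) e)

  map-free : ∀ {P} → Free X P → Free Y (map (to h) P)
  map-free = APP.map⁺ ∘ AllPairs.map λ { (apart s) → apart (seps h s) }

map-decomp : ∀ {A B : Set} {Ψ : List A → Set} {Φ : List B → Set} (f : A → B) →
             (∀ {P} → Ψ P → Φ (map f P)) → ∀ {S} → Decomp Ψ S → Decomp Φ (map f S)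
map-decomp f k (decomp C ψ c) =
  decomp (map (map f) C) (AllP.map⁺ (All.map k ψ)) (↭-trans (↭-reflexive (concat-map C)) (map⁺ f c))

map-tame : ∀ {X Y N S} (h : Hom X Y) → Tame X N S → Tame Y N (map (to h) S)
map-tame h = map-decomp (to h) λ (c , f) → map-chain h c , map-free h f

rect-swap : ∀ {A B : Set} (P : List A) (Q : List B) → map swap (rect P Q) ↭ rect Q P
rect-swap []      Q = ↭-reflexive (sym (rect-[] Q))
rect-swap (p ∷ P) Q = begin
  map swap (col p Q ++ rect P Q)          ≡⟨ map-++ swap (col p Q) _ ⟩
  map swap (col p Q) ++ map swap (rect P Q) ↭⟨ ++⁺ (↭-reflexive (col-swap Q)) (rect-swap P Q) ⟩
  row Q p ++ rect Q P                     ↭⟨ ↭-sym (rect-∷ʳ Q p P) ⟩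
  rect Q (p ∷ P)                          ∎
  where
  open PermutationReasoning
  col-swap : ∀ Q → map swap (col p Q) ≡ row Q p
  col-swap []      = refl
  col-swap (q ∷ Q) = cong (_ ∷_) (col-swap Q)

rect-assoc : ∀ {A B C : Set} (P : List A) (Q : List B) (R : List C) →
             map assocʳ (rect (rect P Q) R) ≡ rect P (rect Q R)
rect-assoc []      Q R = refl
rect-assoc (p ∷ P) Q R = begin
  map assocʳ (rect (col p Q ++ rect P Q) R)
    ≡⟨ cong (map assocʳ) (rect-++ˡ (col p Q) (rect P Q) R) ⟩
  map assocʳ (rect (col p Q) R ++ rect (rect P Q) R)
    ≡⟨ map-++ assocʳ (rect (col p Q) R) _ ⟩
  map assocʳ (rect (col p Q) R) ++ map assocʳ (rect (rect P Q) R)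
    ≡⟨ cong₂ _++_ (col-assoc Q) (rect-assoc P Q R) ⟩
  col p (rect Q R) ++ rect P (rect Q R) ∎
  where
  open ≡-Reasoning
  col-assoc : ∀ Q → map assocʳ (rect (col p Q) R) ≡ col p (rect Q R)
  col-assoc []      = refl
  col-assoc (q ∷ Q) = begin
    map assocʳ (col (p , q) R ++ rect (col p Q) R)   ≡⟨ map-++ assocʳ (col (p , q) R) _ ⟩
    map assocʳ (col (p , q) R) ++ map assocʳ (rect (col p Q) R)
      ≡⟨ cong₂ _++_ (trans (sym (map-∘ R)) (map-∘ R)) (col-assoc Q) ⟩
    col p (col q R) ++ col p (rect Q R)              ≡⟨ sym (map-++ (p ,_) (col q R) _) ⟩
    col p (rect (q ∷ Q) R)                           ∎

open Step

module Bag {A : Set} = Algebra.Solver.CommutativeMonoid (++-commutativeMonoid {A = A})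

open +-*-Solver using (solve; _:+_; _:=_; con)

-- Jump-free lines and rims

record Line (X : Space) : Set where
  constructor line
  field
    {first last} : Pt X
    {rest}       : List (Pt X)
    walk         : Walk X first rest last
    free         : Free X (first ∷ rest)

  points : List (Pt X)
  points = first ∷ rest

  total : ℕ
  total = rank X first + rank X last

-- The only possible jump in a rim is from end to end.
record Rim (X : Space) : Set where
  field
    {first second penult last} : Pt X
    {middle}                   : List (Pt X)
    enter : Step X first second
    walk  : Walk X second middle penult
    leave : Step X penult last
    low   : All (Apart X first) (second ∷ middle)
    inner : Free X (second ∷ middle)
    high  : All (λ x → Apart X x last) (second ∷ middle)

  points : List (Pt X)
  points = first ∷ second ∷ middle ∷ʳ last

  total : ℕ
  total = rank X first + rank X last

  full-walk : Walk X first (second ∷ middle ∷ʳ last) last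
  full-walk = enter ∷ walk ⁀ leave ∷ []

  init-free : Free X (first ∷ second ∷ middle)
  init-free = low ∷ inner

  tail-free : Free X (second ∷ middle ∷ʳ last)
  tail-free = APP.++⁺ inner ([] ∷ []) (All.map (_∷ []) high)

  penult-last : Apart X penult last
  penult-last = last-All walk high

  first-penult : Apart X first penult
  first-penult = last-All walk low

  close : Apart X first last → Line X
  close i = line full-walk (AllP.++⁺ low (i ∷ []) ∷ tail-free)

open Line using (free)

line-chain : ∀ {X} (ℓ : Line X) {N} → Line.total ℓ ≡ N → JumpFree X N (Line.points ℓ)
line-chain ℓ e = chain (Line.walk ℓ) e , free ℓ

toRim : ∀ {X} (ℓ : Line X) → 3 ≤ length (Line.points ℓ) →
        Σ (Rim X) λ R → Rim.points R ≡ Line.points ℓ × Rim.total R ≡ Line.total ℓ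
                      × Apart X (Rim.first R) (Rim.last R)
toRim (line [] _) (s≤s ())
toRim (line (_ ∷ []) _) (s≤s (s≤s ()))
toRim {X} (line {x} {z} (_∷_ {y = y} s (t ∷ w)) (a ∷ as)) _ with unsnoc (t ∷ w)
... | P′ , z′ , eq , w′ , t′ =
  record
    { enter = s ; walk = w′ ; leave = t′
    ; low   = proj₁ (AllP.∷ʳ⁻ a′)
    ; inner = AP-++ˡ (y ∷ P′) as′
    ; high  = All.map (λ { (i ∷ []) → i }) (AP-cross (y ∷ P′) as′) }
  , cong (λ P → x ∷ y ∷ P) (sym eq) , refl , proj₂ (AllP.∷ʳ⁻ {xs = y ∷ P′} a′)
  where
  a′ : All (Apart X x) ((y ∷ P′) ∷ʳ z)
  a′ = subst (λ P → All (Apart X x) (y ∷ P)) eq a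
  as′ : Free X ((y ∷ P′) ∷ʳ z)
  as′ = subst (λ P → Free X (y ∷ P)) eq as

-- Symmetries of products

rect-assocˡ : ∀ {A B C : Set} (P : List A) (Q : List B) (R : List C) →
              map assocˡ (rect P (rect Q R)) ≡ rect (rect P Q) R
rect-assocˡ P Q R =
  trans (cong (map assocˡ) (sym (rect-assoc P Q R))) (trans (sym (map-∘ _)) (map-id _))

module _ {X Y : Space} where

  swapʰ : Hom (X ⊗ Y) (Y ⊗ X)
  swapʰ .to                 = swap
  swapʰ .ranks (x , y)      = +-comm (rank Y y) (rank X x)
  swapʰ .mono               = swap
  swapʰ .seps               = Sum.swap

  assocʰ : ∀ {Z} → Hom (X ⊗ Y ⊗ Z) (X ⊗ (Y ⊗ Z))
  assocʰ .to                     = assocʳ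
  assocʰ {Z} .ranks ((x , y) , z) = sym (+-assoc (rank X x) (rank Y y) (rank Z z))
  assocʰ .mono                   = assocʳ
  assocʰ .seps                   = Sum.assocʳ

  unassocʰ : ∀ {Z} → Hom (X ⊗ (Y ⊗ Z)) (X ⊗ Y ⊗ Z)
  unassocʰ .to                     = assocˡ
  unassocʰ {Z} .ranks (x , y , z)  = +-assoc (rank X x) (rank Y y) (rank Z z)
  unassocʰ .mono                   = assocˡ
  unassocʰ .seps                   = Sum.assocˡ

  mapˡʰ : ∀ {X′} → Hom X X′ → Hom (X ⊗ Y) (X′ ⊗ Y)
  mapˡʰ h .to (x , y)       = to h x , y
  mapˡʰ h .ranks (x , y)    = cong (_+ rank Y y) (ranks h x)
  mapˡʰ h .mono (l , m)     = mono h l , m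
  mapˡʰ h .seps             = Sum.map₁ (seps h)

  swap-tame : ∀ {N P Q} → Tame (X ⊗ Y) N (rect P Q) → Tame (Y ⊗ X) N (rect Q P)
  swap-tame {P = P} {Q} = recover (rect-swap P Q) ∘ map-tame swapʰ

  assoc-tame : ∀ {Z N P Q R} → Tame (X ⊗ Y ⊗ Z) N (rect (rect P Q) R) →
               Tame (X ⊗ (Y ⊗ Z)) N (rect P (rect Q R))
  assoc-tame {P = P} {Q} {R} = recover (↭-reflexive (rect-assoc P Q R)) ∘ map-tame assocʰ

  unassoc-tame : ∀ {Z N P Q R} → Tame (X ⊗ (Y ⊗ Z)) N (rect P (rect Q R)) →
                 Tame (X ⊗ Y ⊗ Z) N (rect (rect P Q) R)
  unassoc-tame {P = P} {Q} {R} = recover (↭-reflexive (rect-assocˡ P Q R)) ∘ map-tame unassocʰ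

retotal : ∀ {X N N′ S} → N ≡ N′ → Tame X N S → Tame X N′ S
retotal refl d = d

+-exch : ∀ a b c d → (a + b) + (c + d) ≡ (a + c) + (b + d)
+-exch = solve 4 (λ a b c d → (a :+ b) :+ (c :+ d) := (a :+ c) :+ (b :+ d)) refl

-- Products of two chains: hooks and zigzags

module _ {X Y : Space} where

  peel-covers : ∀ {x : Pt X} {P P′ x′} (q : Pt Y) Q → x ∷ P ≡ P′ ∷ʳ x′ →
                (row (x ∷ P) q ++ col x′ Q) ++ rect P′ Q ↭ rect (x ∷ P) (q ∷ Q)
  peel-covers {x} {P} {P′} {x′} q Q eq = begin
    (row (x ∷ P) q ++ col x′ Q) ++ rect P′ Q   ↭⟨ prove 3 ((v₀ ⊕ v₁) ⊕ v₂) (v₀ ⊕ (v₂ ⊕ v₁)) (row (x ∷ P) q ∷ col x′ Q ∷ rect P′ Q ∷ []) ⟩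
    row (x ∷ P) q ++ (rect P′ Q ++ col x′ Q)   ≡⟨ cong (row (x ∷ P) q ++_) (sym (rect-snocˡ P′ x′ Q)) ⟩
    row (x ∷ P) q ++ rect (P′ ∷ʳ x′) Q         ≡⟨ cong (λ P → row (x ∷ _) q ++ rect P Q) (sym eq) ⟩
    row (x ∷ P) q ++ rect (x ∷ P) Q            ↭⟨ ↭-sym (rect-∷ʳ (x ∷ P) q Q) ⟩
    rect (x ∷ P) (q ∷ Q)                       ∎
    where
    open PermutationReasoning
    open Bag
    v₀ v₁ v₂ : Expr 3
    v₀ = var 0F
    v₁ = var 1F
    v₂ = var 2F

  hook-total : ∀ {x x′ q q′ N} → (rank X x + rank X x′) + (rank Y q + rank Y q′) ≡ N →
               (rank X x + rank Y q) + (rank X x′ + rank Y q′) ≡ N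
  hook-total {x} {x′} {q} {q′} = trans (+-exch (rank X x) (rank Y q) (rank X x′) (rank Y q′))

  shrink-total : ∀ {x x′ x″ q₀ q₁ q′ N} → Step X x″ x′ → Step Y q₀ q₁ →
                 (rank X x + rank X x′) + (rank Y q₀ + rank Y q′) ≡ N →
                 (rank X x + rank X x″) + (rank Y q₁ + rank Y q′) ≡ N
  shrink-total {x} {x′} {x″} {q₀} {q₁} {q′} (step _ u) (step _ v) e =
    trans (trans (cong (λ r → (rank X x + rank X x″) + (r + rank Y q′)) v)
                 (trans (solve 4 (λ a b c d → (a :+ b) :+ (con 1 :+ c :+ d) := (a :+ (con 1 :+ b)) :+ (c :+ d)) refl
                           (rank X x) (rank X x″) (rank Y q₀) (rank Y q′))
                        (cong (λ r → (rank X x + r) + (rank Y q₀ + rank Y q′)) (sym u)))) e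

  -- Freeness of the row is asked for in the product: a row may be free because of its height
  -- (`row-free′`) and not because of X. Row and column are kept apart by the second coordinate.
  hook : ∀ {x P x′ q Q q′ N} → Walk X x P x′ → Walk Y q Q q′ →
         Free (X ⊗ Y) (row (x ∷ P) q) → Free Y (q ∷ Q) →
         (rank X x + rank X x′) + (rank Y q + rank Y q′) ≡ N →
         JumpFree (X ⊗ Y) N (row (x ∷ P) q ++ col x′ Q)
  hook {x} {P} {x′} {q} {Q} w v f (g ∷ gs) e =
    chain (row-walk q w ⁀ col-walk x′ v) (hook-total e)
    , APP.++⁺ f (col-free x′ gs) (row-col₂ (x ∷ P) g)

  -- The classical nested hooks: bottom row followed by last column. What remains has lost the top
  -- of one side and the bottom of the other, so its rank sum is the same and the recursion
  -- continues.
  hooks : ∀ {x P x′ q Q q′ N} → Walk X x P x′ → Walk Y q Q q′ → Free X (x ∷ P) → Free Y (q ∷ Q) →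
          (rank X x + rank X x′) + (rank Y q + rank Y q′) ≡ N → Tame (X ⊗ Y) N (rect (x ∷ P) (q ∷ Q))
  hooks {x} {P} w [] f g e =
    recover (↭-trans (↭-reflexive (sym (trans (cong (row (x ∷ P) _ ++_) (rect-[] P)) (++-identityʳ _))))
                     (↭-sym (rect-∷ʳ (x ∷ P) _ [])))
            (single (chain (row-walk _ w) (hook-total e) , row-free _ f))
  hooks {x} {q = q} [] v@(_ ∷ _) f g e =
    recover (↭-reflexive (sym (++-identityʳ _))) (single (chain (col-walk x v) (hook-total e) , col-free x g))
  hooks {x} (s ∷ w) (t ∷ v) f g e with unsnoc (s ∷ w)
  ... | P′ , x″ , eq , w′ , s′ =
    recover (peel-covers _ _ (cong (x ∷_) eq))
      (single (hook (s ∷ w) (t ∷ v) (row-free _ f) g e)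
       ⊎ᵈ hooks w′ v (AP-++ˡ (x ∷ P′) (subst (λ P → Free X (x ∷ P)) eq f)) (AllPairs.tail g)
                (shrink-total s′ t e))

  _⊠_ : (ℓ : Line X) (m : Line Y) → Tame (X ⊗ Y) (Line.total ℓ + Line.total m) (rect (Line.points ℓ) (Line.points m))
  ℓ ⊠ m = hooks (Line.walk ℓ) (Line.walk m) (free ℓ) (free m) refl

  infixl 7 _⊠_ _⊛_

  -- Each jump-free chain of a solved product is cut against the line into hooks. This is how
  -- factors that cause no trouble are multiplied in at the end.
  _⊛_ : ∀ {N S} → Tame X N S → (ℓ : Line Y) → Tame (X ⊗ Y) (N + Line.total ℓ) (rect S (Line.points ℓ))
  d ⊛ ℓ = refineˡ (Line.points ℓ) d λ { (chain w refl , f) → hooks w (Line.walk ℓ) f (free ℓ) refl }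

-- For sides 0 … m and 0 … n the zigzag is (0,0), (0,1), (1 … m-1, 1), (m-1, 2 … n), (m,n) and the
-- border is (1 … m, 0), (m, 1 … n-1), which leaves the rectangle (0 … m-2) × (2 … n).
module _ {X Y : Space} (A : Rim X) (B : Rim Y) where
  private
    module A = Rim A
    module B = Rim B

  -- The early turn into row 1 and the late stay in column m-1 make this a rim again: (0,0) differs
  -- from (0,1) in height and from the other inner points by a first coordinate strictly between the
  -- ends; symmetrically, (m,n) is separated from row 1 by height and from column m-1 by the first
  -- coordinate.
  zigzag : Rim (X ⊗ Y)
  zigzag .Rim.first  = A.first , B.first
  zigzag .Rim.second = A.first , B.second
  zigzag .Rim.penult = A.penult , B.last
  zigzag .Rim.last   = A.last , B.last
  zigzag .Rim.middle = row (A.second ∷ A.middle) B.second ++ col A.penult (B.middle ∷ʳ B.last)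
  zigzag .Rim.enter  = above B.enter
  zigzag .Rim.walk   =
    right A.enter ∷ row-walk B.second A.walk ⁀ col-walk A.penult (B.walk ⁀ B.leave ∷ [])
  zigzag .Rim.leave  = right A.leave
  zigzag .Rim.low    =
    apart₂ (All.head B.low)
    ∷ AllP.++⁺ (AllP.map⁺ (All.map apart₁ A.low)) (AllP.map⁺ (All.universal (λ _ → apart₁ A.first-penult) _))
  zigzag .Rim.inner  =
    AllP.++⁺ (AllP.map⁺ (All.map apart₁ A.low)) (AllP.map⁺ (All.universal (λ _ → apart₁ A.first-penult) _))
    ∷ APP.++⁺ (row-free B.second A.inner) (col-free A.penult (AllPairs.tail B.tail-free))
              (row-col₂ _ (AllPairs.head B.tail-free))
  zigzag .Rim.high   =
    apart₂ (All.head B.high)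
    ∷ AllP.++⁺ (AllP.map⁺ (All.universal (λ _ → apart₂ (All.head B.high)) (A.second ∷ A.middle)))
               (AllP.map⁺ (All.universal (λ _ → apart₁ A.penult-last) _))

  zigzag-total : Rim.total zigzag ≡ A.total + B.total
  zigzag-total = +-exch (rank X A.first) (rank Y B.first) (rank X A.last) (rank Y B.last)

  border : Line (X ⊗ Y)
  border = line
    (row-walk B.first (A.walk ⁀ A.leave ∷ []) ⁀ (above B.enter ∷ col-walk A.last B.walk))
    (APP.++⁺ (row-free B.first A.tail-free) (col-free A.last B.inner) (row-col₂ (A.second ∷ A.middle ∷ʳ A.last) B.low))

  border-total : Line.total border ≡ A.total + B.total
  border-total rewrite up A.enter | up B.leave =
    solve 4 (λ a b c d → (con 1 :+ a :+ b) :+ (c :+ d) := (a :+ c) :+ (b :+ (con 1 :+ d))) refl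
      (rank X A.first) (rank Y B.first) (rank X A.last) (rank Y B.penult)

module _ {X : Space} (A : Rim X) where
  private module A = Rim A

  dropLast² : Σ (Line X) λ ℓ → A.first ∷ A.second ∷ A.middle ≡ Line.points ℓ ∷ʳ A.penult
                             × A.total ≡ 2 + Line.total ℓ
  dropLast² with unsnoc (A.enter ∷ A.walk)
  ... | P′ , x″ , eq , w′ , s′ =
    line w′ (AP-++ˡ (A.first ∷ P′) (subst (λ P → Free X (A.first ∷ P)) eq A.init-free))
    , cong (A.first ∷_) eq
    , trans (cong (rank X A.first +_) (trans (up A.leave) (cong suc (up s′))))
            (solve 2 (λ a b → a :+ (con 2 :+ b) := con 2 :+ (a :+ b)) refl (rank X A.first) (rank X x″))

  dropFirst² : Σ (Line X) λ ℓ → A.middle ∷ʳ A.last ≡ Line.points ℓ × Line.total ℓ ≡ 2 + A.total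
  dropFirst² with A.middle | A.walk | A.tail-free
  ... | []    | []    | f = line [] (AllPairs.tail f) , refl
                            , cong (_+ rank X A.last) (trans (up A.leave) (cong suc (up A.enter)))
  ... | y ∷ M | s ∷ w | f = line (w ⁀ A.leave ∷ []) (AllPairs.tail f) , refl
                            , cong (_+ rank X A.last) (trans (up s) (cong suc (up A.enter)))

  inits : Line X
  inits = proj₁ dropLast²

  tails : Line X
  tails = proj₁ dropFirst²

module _ {X Y : Space} (A : Rim X) (B : Rim Y) where
  private
    module A = Rim A
    module B = Rim B

  corner-total : Line.total (inits A) + Line.total (tails B) ≡ A.total + B.total
  corner-total rewrite proj₂ (proj₂ (dropLast² A)) | proj₂ (proj₂ (dropFirst² B)) =
    solve 2 (λ a b → a :+ (con 2 :+ b) := (con 2 :+ a) :+ b) refl (Line.total (inits A)) B.total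

  private
    B₂ = B.middle ∷ʳ B.last
    box = rect (Line.points (inits A)) (Line.points (tails B))

  rect-split : ∀ {Z : Set} (Q : List Z) →
    rect A.points Q ≡ (rect (Line.points (inits A)) Q ++ col A.penult Q) ++ col A.last Q
  rect-split Q = begin
    rect A.points Q
      ≡⟨ rect-snocˡ (A.first ∷ A.second ∷ A.middle) A.last Q ⟩
    rect (A.first ∷ A.second ∷ A.middle) Q ++ col A.last Q
      ≡⟨ cong (λ P → rect P Q ++ col A.last Q) (proj₁ (proj₂ (dropLast² A))) ⟩
    rect (Line.points (inits A) ∷ʳ A.penult) Q ++ col A.last Q
      ≡⟨ cong (_++ col A.last Q) (rect-snocˡ (Line.points (inits A)) A.penult Q) ⟩
    (rect (Line.points (inits A)) Q ++ col A.penult Q) ++ col A.last Q ∎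
    where open ≡-Reasoning

  zigzag-covers : Rim.points (zigzag A B) ++ (Line.points (border A B) ++ box) ↭ rect A.points B.points
  zigzag-covers = begin
    Rim.points (zigzag A B) ++ (Line.points (border A B) ++ box)
      ≡⟨ cong (λ P → a₀b₀ ++ a₀b₁ ++ P ++ (Line.points (border A B) ++ box)) (++-assoc r₁ c _) ⟩
    (a₀b₀ ++ a₀b₁ ++ (r₁ ++ (c ++ aₙbₙ))) ++ ((r₀ ++ (aₙb₁ ++ cₙ)) ++ box)
      ↭⟨ prove 9
           ((v 0F ⊕ v 1F ⊕ (v 2F ⊕ (v 3F ⊕ v 4F))) ⊕ ((v 5F ⊕ (v 6F ⊕ v 7F)) ⊕ v 8F))
           ((v 0F ⊕ v 5F) ⊕ (v 1F ⊕ (v 2F ⊕ v 6F)) ⊕ (v 8F ⊕ v 3F) ⊕ (v 7F ⊕ v 4F))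
           (a₀b₀ ∷ a₀b₁ ∷ r₁ ∷ c ∷ aₙbₙ ∷ r₀ ∷ aₙb₁ ∷ cₙ ∷ box ∷ []) ⟩
    (a₀b₀ ++ r₀) ++ ((a₀b₁ ++ (r₁ ++ aₙb₁)) ++ ((box ++ c) ++ (cₙ ++ aₙbₙ)))
      ≡⟨ sym (cong₂ (λ P Q → (a₀b₀ ++ r₀) ++ ((a₀b₁ ++ P) ++ ((box ++ c) ++ Q)))
                    (map-++ (_, B.second) (A.second ∷ A.middle) [ A.last ])
                    (map-++ (A.last ,_) B.middle [ B.last ])) ⟩
    row A.points B.first ++ (row A.points B.second ++ ((box ++ c) ++ col A.last B₂))
      ≡⟨ cong (λ P → row A.points B.first ++ (row A.points B.second ++ ((P ++ c) ++ col A.last B₂)))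
              (cong (rect (Line.points (inits A))) (sym (proj₁ (proj₂ (dropFirst² B))))) ⟩
    row A.points B.first ++ (row A.points B.second ++
      ((rect (Line.points (inits A)) B₂ ++ c) ++ col A.last B₂))
      ≡⟨ cong (λ P → row A.points B.first ++ (row A.points B.second ++ P)) (sym (rect-split B₂)) ⟩
    row A.points B.first ++ (row A.points B.second ++ rect A.points B₂)
      ↭⟨ ++⁺ˡ (row A.points B.first) (↭-sym (rect-∷ʳ A.points B.second B₂)) ⟩
    row A.points B.first ++ rect A.points (B.second ∷ B₂)
      ↭⟨ ↭-sym (rect-∷ʳ A.points B.first (B.second ∷ B₂)) ⟩
    rect A.points B.points ∎
    where
    open PermutationReasoning
    open Bag {Pt X × Pt Y}
    v : ∀ {n} → Fin n → Expr n
    v = var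
    a₀b₀ = [ A.first , B.first ]
    a₀b₁ = [ A.first , B.second ]
    aₙb₁ = [ A.last , B.second ]
    aₙbₙ = [ A.last , B.last ]
    r₀ = row (A.second ∷ A.middle ∷ʳ A.last) B.first
    r₁ = row (A.second ∷ A.middle) B.second
    c  = col A.penult B₂
    cₙ = col A.last B.middle

  -- Only the zigzag can jump, from corner to corner, and one side with its ends apart already
  -- prevents this.
  zigzag-tame : Apart X A.first A.last ⊎ Apart Y B.first B.last →
                Tame (X ⊗ Y) (A.total + B.total) (rect A.points B.points)
  zigzag-tame i = recover zigzag-covers
    (single (line-chain (Rim.close (zigzag A B) ([ apart₁ , apart₂ ]′ i)) (zigzag-total A B))
     ⊎ᵈ single (line-chain (border A B) (border-total A B))
     ⊎ᵈ retotal corner-total (inits A ⊠ tails B))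

-- Weaving a full chain with a hooked line

uncons : ∀ {X x y Q z} M → Walk X x (M ++ y ∷ Q) z →
         Σ (Pt X) λ h → Σ (List (Pt X)) λ t → (M ++ y ∷ Q ≡ h ∷ t) × Step X x h × Walk X h t z
uncons []      (s ∷ w) = _ , _ , refl , s , w
uncons (h ∷ M) (s ∷ w) = h , M ++ _ , refl , s , w

-- A rim with at least four points, read from its upper end: `x` is the last point of `e₁ ∷ M`,
-- possibly `e₁` itself. The pair `e₀`, `z` is the one left unconstrained.
record LongRim (X : Space) : Set where
  field
    {e₀ e₁ x y z} : Pt X
    {M}           : List (Pt X)
    enter     : Step X e₀ e₁
    walk      : Walk X e₁ M x
    next      : Step X x y
    leave     : Step X y z
    init-free : Free X (e₀ ∷ e₁ ∷ M ∷ʳ y)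
    tail-free : Free X (e₁ ∷ M ++ y ∷ z ∷ [])

  points : List (Pt X)
  points = e₀ ∷ e₁ ∷ M ++ y ∷ z ∷ []

  total : ℕ
  total = rank X e₀ + rank X z

-- The only possible jump in a hooked line is from the first point p₀ to the last but one v.
record Hooked (Y : Space) : Set where
  field
    {p₀ p₁ p₂ u v w} : Pt Y
    {U}              : List (Pt Y)
    enter     : Step Y p₀ p₁
    next      : Step Y p₁ p₂
    walk      : Walk Y p₂ U u
    turn      : Step Y u v
    leave     : Step Y v w
    init-free : Free Y (p₀ ∷ p₁ ∷ p₂ ∷ U)
    tail-free : Free Y (p₁ ∷ p₂ ∷ U ++ v ∷ w ∷ [])
    ends      : Apart Y p₀ w

  points : List (Pt Y)
  points = p₀ ∷ p₁ ∷ p₂ ∷ U ++ v ∷ w ∷ []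

  total : ℕ
  total = rank Y p₀ + rank Y w

module _ {X Y : Space} (E : LongRim X) (P : Hooked Y) where
  private
    module E = LongRim E
    module P = Hooked P
    open E using (e₀; e₁; x; y; z; M)
    open P using (p₀; p₁; p₂; u; v; w; U)

    Q = U ++ v ∷ w ∷ []
    R = M ++ y ∷ z ∷ []

    -- For sides 0 … n and 0 … M, where only 0 and M-1 jump in the second one:
    --   L = (0, 0 … 2), (1 … n-2, 2), (n-2, 3 … M), (n-1, M), (n, M)
    --   V = (1, 0), (1 … n-1, 1), (n-1, 2 … M-1), (n, M-1)
    --   T = (2 … n, 0), (n, 1 … M-2)
    -- and the rectangle (0 … n-3) × (3 … M) is left over.
    L V T : List (Pt X × Pt Y)
    L = col e₀ (p₀ ∷ p₁ ∷ p₂ ∷ []) ++ (row (e₁ ∷ M) p₂ ++ (col x Q ++ row (y ∷ z ∷ []) w))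
    V = row [ e₁ ] p₀ ++ (row (e₁ ∷ M ∷ʳ y) p₁ ++ (col y (p₂ ∷ U ∷ʳ v) ++ row [ z ] v))
    T = row R p₀ ++ col z (p₁ ∷ p₂ ∷ U)

    N = E.total + P.total

    -- `eR` yields point 2 of the first side, where T begins; `eQ` yields point 3 of the second
    -- side, where the leftover rectangle begins; `eM` yields the points 1 to n-3 and thus its right
    -- edge.
    eR = uncons M (E.walk ⁀ E.next ∷ E.leave ∷ [])
    eQ = uncons U (P.walk ⁀ P.turn ∷ P.leave ∷ [])
    eM = unsnoc (E.enter ∷ E.walk)

    M′ = proj₁ eM

    x-yz : All (Apart X x) (y ∷ z ∷ [])
    x-yz = last-All E.walk (AP-cross (e₁ ∷ M) E.tail-free)

    y-z : Apart X y z
    y-z with AP-++ʳ (e₁ ∷ M) E.tail-free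
    ... | (i ∷ []) ∷ _ = i

    e₁-z : Apart X e₁ z
    e₁-z with AllP.++⁻ʳ M (AllPairs.head E.tail-free)
    ... | _ ∷ i ∷ [] = i

    e₀-eM : All (Apart X e₀) (e₁ ∷ M)
    e₀-eM = AllP.++⁻ˡ (e₁ ∷ M) (AllPairs.head E.init-free)

    p-w : All (λ q → Apart Y q w) (p₀ ∷ p₁ ∷ p₂ ∷ [])
    p-w with AllPairs.head P.tail-free | AllPairs.head (AllPairs.tail P.tail-free)
    ... | _ ∷ a | b with AllP.++⁻ʳ U a | AllP.++⁻ʳ U b
    ... | _ ∷ i ∷ [] | _ ∷ j ∷ [] = P.ends ∷ i ∷ j ∷ []

    eM-free : Free X (e₁ ∷ M)
    eM-free = AP-++ˡ (e₁ ∷ M) E.tail-free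

    eMy-free : Free X (e₁ ∷ M ∷ʳ y)
    eMy-free = AllPairs.tail E.init-free

    yz-free : Free X (y ∷ z ∷ [])
    yz-free = AP-++ʳ (e₁ ∷ M) E.tail-free

    p₂Q : Free Y (p₂ ∷ Q)
    p₂Q = AllPairs.tail P.tail-free

    assoc-v : p₁ ∷ p₂ ∷ Q ≡ (p₁ ∷ p₂ ∷ U ∷ʳ v) ∷ʳ w
    assoc-v = cong (λ Q → p₁ ∷ p₂ ∷ Q) (sym (++-assoc U [ v ] [ w ]))

    pUv : Free Y (p₁ ∷ p₂ ∷ U ∷ʳ v)
    pUv = AP-++ˡ _ (subst (Free Y) assoc-v P.tail-free)

    -- In the first coordinate only 0 and n jump, in the second only 0 and M-1. L meets column 0 at
    -- heights up to 2 and column n at height M only, and these heights are apart; it meets height 0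
    -- in column 0 and height M-1 in column n-2 only. V avoids column 0, and its points at heights 0
    -- and M-1 lie in different columns. T avoids column 0 and height M-1. The rectangle avoids
    -- column n and height 0.
    L-free : Free (X ⊗ Y) L
    L-free = APP.++⁺ (col-free e₀ (AP-++ˡ (p₀ ∷ p₁ ∷ p₂ ∷ []) P.init-free))
      (APP.++⁺ (row-free p₂ eM-free)
        (APP.++⁺ (col-free x (AllPairs.tail p₂Q)) (row-free w yz-free) (col-row₁ Q x-yz))
        (split (row-col₂ (e₁ ∷ M) (AllPairs.head p₂Q))
               (row-row₂ (e₁ ∷ M) (y ∷ z ∷ []) (All.head (All.tail (All.tail p-w))))))
      (split (col-row₁ (p₀ ∷ p₁ ∷ p₂ ∷ []) e₀-eM)
        (split (col-col₁ (p₀ ∷ p₁ ∷ p₂ ∷ []) Q (last-All E.walk e₀-eM))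
               (col-row₂ (y ∷ z ∷ []) p-w)))
      where
      split : ∀ {A : Set} {R : A → A → Set} {S S₁ S₂} → All (λ s → All (R s) S₁) S →
              All (λ s → All (R s) S₂) S → All (λ s → All (R s) (S₁ ++ S₂)) S
      split f g = All.zipWith (λ (a , b) → AllP.++⁺ a b) (f , g)

    V-free : Free (X ⊗ Y) V
    V-free =
      (AllP.++⁺ (AllP.map⁺ (All.universal (λ _ → apart₂ (All.head (AllPairs.head P.init-free))) (e₁ ∷ M ∷ʳ y)))
        (AllP.++⁺ {xs = col y (p₂ ∷ U ∷ʳ v)} {ys = row [ z ] v} (AllP.map⁺ (All.universal (λ _ → apart₁ e₁-y) (p₂ ∷ U ∷ʳ v))) (apart₁ e₁-z ∷ [])))
      ∷ APP.++⁺ (row-free p₁ eMy-free)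
          (APP.++⁺ {xs = col y (p₂ ∷ U ∷ʳ v)} {ys = row [ z ] v} (col-free y (AllPairs.tail pUv)) ([] ∷ []) (col-row₁ (p₂ ∷ U ∷ʳ v) (y-z ∷ [])))
          (All.zipWith (λ (a , b) → AllP.++⁺ a b)
            (row-col₂ (e₁ ∷ M ∷ʳ y) (AllPairs.head pUv) , row-row₂ (e₁ ∷ M ∷ʳ y) [ z ] p₁-v))
      where
      e₁-y : Apart X e₁ y
      e₁-y = All.head (AllP.++⁻ʳ M (AllPairs.head eMy-free))
      p₁-v : Apart Y p₁ v
      p₁-v = All.head (AllP.++⁻ʳ (p₂ ∷ U) (AllPairs.head pUv))

    T-free : Free (X ⊗ Y) T
    T-free = APP.++⁺ (row-free p₀ (AllPairs.tail E.tail-free)) (col-free z (AllPairs.tail P.init-free))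
                     (row-col₂ R (AllPairs.head P.init-free))

    L-chain : Chainₙ (X ⊗ Y) N L
    L-chain = chain
      (above P.enter ∷ above P.next ∷ right E.enter ∷ row-walk p₂ E.walk
        ⁀ col-walk x (P.walk ⁀ P.turn ∷ P.leave ∷ []) ⁀ (right E.next ∷ right E.leave ∷ []))
      (+-exch (rank X e₀) (rank Y p₀) (rank X z) (rank Y w))

    V-chain : Chainₙ (X ⊗ Y) N V
    V-chain = chain
      (above P.enter ∷ row-walk p₁ (E.walk ⁀ E.next ∷ [])
        ⁀ (above P.next ∷ col-walk y (P.walk ⁀ P.turn ∷ [])) ⁀ (right E.leave ∷ []))
      (begin
        (rank X e₁ + rank Y p₀) + (rank X z + rank Y v)
          ≡⟨ cong (λ r → (r + rank Y p₀) + (rank X z + rank Y v)) (up E.enter) ⟩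
        (suc (rank X e₀) + rank Y p₀) + (rank X z + rank Y v)
          ≡⟨ solve 4 (λ a b c d → ((con 1 :+ a) :+ b) :+ (c :+ d) := (a :+ c) :+ (b :+ (con 1 :+ d))) refl
               (rank X e₀) (rank Y p₀) (rank X z) (rank Y v) ⟩
        (rank X e₀ + rank X z) + (rank Y p₀ + suc (rank Y v))
          ≡⟨ cong (λ r → E.total + (rank Y p₀ + r)) (sym (up P.leave)) ⟩
        N ∎)
      where open ≡-Reasoning

    T-chain : Chainₙ (X ⊗ Y) N T
    T-chain with h , t , eq , s , ω ← eR =
      subst (λ R → Chainₙ (X ⊗ Y) N (row R p₀ ++ col z (p₁ ∷ p₂ ∷ U))) (sym eq)
        (chain (row-walk p₀ ω ⁀ (above P.enter ∷ above P.next ∷ col-walk z P.walk))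
          (begin
            (rank X h + rank Y p₀) + (rank X z + rank Y u)
              ≡⟨ cong (λ r → (r + rank Y p₀) + (rank X z + rank Y u)) (trans (up s) (cong suc (up E.enter))) ⟩
            ((2 + rank X e₀) + rank Y p₀) + (rank X z + rank Y u)
              ≡⟨ solve 4 (λ a b c d → ((con 2 :+ a) :+ b) :+ (c :+ d) := (a :+ c) :+ (b :+ (con 2 :+ d))) refl
                   (rank X e₀) (rank Y p₀) (rank X z) (rank Y u) ⟩
            (rank X e₀ + rank X z) + (rank Y p₀ + (2 + rank Y u))
              ≡⟨ cong (λ r → E.total + (rank Y p₀ + r)) (sym (trans (up P.leave) (cong suc (up P.turn)))) ⟩
            N ∎))
      where open ≡-Reasoning

    box : Tame (X ⊗ Y) N (rect (e₀ ∷ M′) Q)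
    box with M″ , x′ , eq , ω , s ← eM | h , t , eq′ , s′ , ω′ ← eQ =
      subst (λ Q → Tame (X ⊗ Y) N (rect (e₀ ∷ M″) Q)) (sym eq′)
        (hooks ω ω′
          (AP-++ˡ (e₀ ∷ M″) (subst (λ P → Free X (e₀ ∷ P)) eq (AP-++ˡ (e₀ ∷ e₁ ∷ M) E.init-free)))
          (subst (Free Y) eq′ (AllPairs.tail p₂Q))
          (begin
            (rank X e₀ + rank X x′) + (rank Y h + rank Y w)
              ≡⟨ cong (λ r → (rank X e₀ + rank X x′) + (r + rank Y w))
                   (trans (up s′) (cong suc (trans (up P.next) (cong suc (up P.enter))))) ⟩
            (rank X e₀ + rank X x′) + ((3 + rank Y p₀) + rank Y w)
              ≡⟨ solve 4 (λ a b c d → (a :+ b) :+ ((con 3 :+ c) :+ d) := (a :+ (con 3 :+ b)) :+ (c :+ d)) refl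
                   (rank X e₀) (rank X x′) (rank Y p₀) (rank Y w) ⟩
            (rank X e₀ + (3 + rank X x′)) + P.total
              ≡⟨ cong (λ r → (rank X e₀ + r) + P.total)
                   (sym (trans (up E.leave) (cong suc (trans (up E.next) (cong suc (up s)))))) ⟩
            N ∎))
      where open ≡-Reasoning

    rect-E : ∀ {Z : Set} (Q : List Z) →
             rect E.points Q ≡ (rect (e₀ ∷ M′) Q ++ col x Q) ++ (col y Q ++ col z Q)
    rect-E Q = begin
      rect (e₀ ∷ e₁ ∷ M ++ y ∷ z ∷ []) Q
        ≡⟨ rect-++ˡ (e₀ ∷ e₁ ∷ M) (y ∷ z ∷ []) Q ⟩
      rect (e₀ ∷ e₁ ∷ M) Q ++ (col y Q ++ (col z Q ++ []))
        ≡⟨ cong₂ (λ P S → rect (e₀ ∷ P) Q ++ (col y Q ++ S)) (proj₁ (proj₂ (proj₂ eM))) (++-identityʳ _) ⟩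
      rect ((e₀ ∷ M′) ∷ʳ x) Q ++ (col y Q ++ col z Q)
        ≡⟨ cong (_++ (col y Q ++ col z Q)) (rect-snocˡ (e₀ ∷ M′) x Q) ⟩
      (rect (e₀ ∷ M′) Q ++ col x Q) ++ (col y Q ++ col z Q) ∎
      where open ≡-Reasoning

    covers-E : L ++ (V ++ (T ++ rect (e₀ ∷ M′) Q)) ↭ rect E.points P.points
    covers-E = begin
      L ++ (V ++ (T ++ b))
        ≡⟨⟩
      ([ e₀ , p₀ ] ++ ([ e₀ , p₁ ] ++ ([ e₀ , p₂ ] ++ (r₂ ++ (col x Q ++ ([ y , w ] ++ [ z , w ]))))))
      ++ (([ e₁ , p₀ ] ++ (r₁ ++ (([ y , p₂ ] ++ cy) ++ [ z , v ])))
      ++ ((row R p₀ ++ ([ z , p₁ ] ++ ([ z , p₂ ] ++ col z U))) ++ b))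
        ↭⟨ prove 17
             ((i 0 ⊕ i 1 ⊕ i 2 ⊕ i 3 ⊕ i 4 ⊕ i 5 ⊕ i 6)
              ⊕ (i 7 ⊕ i 8 ⊕ (i 9 ⊕ i 10) ⊕ i 11) ⊕ (i 12 ⊕ i 13 ⊕ i 14 ⊕ i 15) ⊕ i 16)
             ((i 0 ⊕ i 7 ⊕ i 12) ⊕ (i 1 ⊕ i 8 ⊕ i 13) ⊕ (i 2 ⊕ i 3 ⊕ i 9 ⊕ i 14)
              ⊕ (i 16 ⊕ i 4) ⊕ (i 10 ⊕ i 5) ⊕ (i 15 ⊕ i 11 ⊕ i 6))
             ([ e₀ , p₀ ] ∷ [ e₀ , p₁ ] ∷ [ e₀ , p₂ ] ∷ r₂ ∷ col x Q ∷ [ y , w ] ∷ [ z , w ]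
              ∷ [ e₁ , p₀ ] ∷ r₁ ∷ [ y , p₂ ] ∷ cy ∷ [ z , v ] ∷ row R p₀ ∷ [ z , p₁ ] ∷ [ z , p₂ ]
              ∷ col z U ∷ b ∷ []) ⟩
      row E.points p₀ ++ (([ e₀ , p₁ ] ++ (r₁ ++ [ z , p₁ ]))
      ++ (([ e₀ , p₂ ] ++ (r₂ ++ ([ y , p₂ ] ++ [ z , p₂ ])))
      ++ ((b ++ col x Q) ++ ((cy ++ [ y , w ]) ++ (col z U ++ ([ z , v ] ++ [ z , w ]))))))
        ≡⟨ cong₂ (λ S S′ → row E.points p₀ ++ (([ e₀ , p₁ ] ++ S) ++ (([ e₀ , p₂ ] ++ S′)
                   ++ ((b ++ col x Q) ++ ((cy ++ [ y , w ]) ++ (col z U ++ ([ z , v ] ++ [ z , w ])))))))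
             (trans (sym (map-++ (_, p₁) (e₁ ∷ M ∷ʳ y) [ z ]))
                    (cong (λ S → row (e₁ ∷ S) p₁) (++-assoc M [ y ] [ z ])))
             (sym (map-++ (_, p₂) (e₁ ∷ M) (y ∷ z ∷ []))) ⟩
      row E.points p₀ ++ (row E.points p₁ ++ (row E.points p₂
      ++ ((b ++ col x Q) ++ ((cy ++ [ y , w ]) ++ (col z U ++ ([ z , v ] ++ [ z , w ]))))))
        ≡⟨ cong₂ (λ S S′ → row E.points p₀ ++ (row E.points p₁ ++ (row E.points p₂ ++ ((b ++ col x Q) ++ (S ++ S′)))))
             (trans (sym (map-++ (y ,_) (U ∷ʳ v) [ w ])) (cong (col y) (++-assoc U [ v ] [ w ])))
             (sym (map-++ (z ,_) U (v ∷ w ∷ []))) ⟩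
      row E.points p₀ ++ (row E.points p₁ ++ (row E.points p₂ ++ ((b ++ col x Q) ++ (col y Q ++ col z Q))))
        ≡⟨ cong (λ S → row E.points p₀ ++ (row E.points p₁ ++ (row E.points p₂ ++ S))) (sym (rect-E Q)) ⟩
      row E.points p₀ ++ (row E.points p₁ ++ (row E.points p₂ ++ rect E.points Q))
        ↭⟨ ++⁺ˡ (row E.points p₀) (++⁺ˡ (row E.points p₁) (↭-sym (rect-∷ʳ E.points p₂ Q))) ⟩
      row E.points p₀ ++ (row E.points p₁ ++ rect E.points (p₂ ∷ Q))
        ↭⟨ ++⁺ˡ (row E.points p₀) (↭-sym (rect-∷ʳ E.points p₁ (p₂ ∷ Q))) ⟩
      row E.points p₀ ++ rect E.points (p₁ ∷ p₂ ∷ Q)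
        ↭⟨ ↭-sym (rect-∷ʳ E.points p₀ (p₁ ∷ p₂ ∷ Q)) ⟩
      rect E.points P.points ∎
      where
      open PermutationReasoning
      open Bag {Pt X × Pt Y}
      open import Data.Fin using (#_)
      open import Data.Nat using (_<?_)
      open import Relation.Nullary.Decidable using (True)
      i : ∀ m {m<n : True (m <? 17)} → Expr 17
      i m {m<n} = var (#_ m {17} {m<n})
      b = rect (e₀ ∷ M′) Q
      r₁ = row (e₁ ∷ M ∷ʳ y) p₁
      r₂ = row (e₁ ∷ M) p₂
      cy = col y (U ∷ʳ v)

  weave : Tame (X ⊗ Y) (E.total + P.total) (rect E.points P.points)
  weave = recover covers-E (single (L-chain , L-free) ⊎ᵈ single (V-chain , V-free) ⊎ᵈ single (T-chain , T-free) ⊎ᵈ box)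

-- Two full factors

record Full (X : Space) : Set where
  field
    {first second third penult last} : Pt X
    {middle} : List (Pt X)
    enter : Step X first second
    next  : Step X second third
    walk  : Walk X third middle penult
    leave : Step X penult last
    low   : All (Apart X first) (second ∷ third ∷ middle)
    inner : Free X (second ∷ third ∷ middle)
    high  : All (λ x → Apart X x last) (second ∷ third ∷ middle)

  rim : Rim X
  rim = record { enter = enter ; walk = next ∷ walk ; leave = leave ; low = low ; inner = inner ; high = high }

  open Rim rim public using (points; total; init-free; tail-free)

open Full using (rim)

toFull : ∀ {X} (ℓ : Line X) → 4 ≤ length (Line.points ℓ) →
         Σ (Full X) λ F → Full.points F ≡ Line.points ℓ × Full.total F ≡ Line.total ℓ
                        × Apart X (Full.first F) (Full.last F)
toFull ℓ 4≤ with toRim ℓ (≤-trans (n≤1+n 3) 4≤)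
... | R , eq , t , i with Rim.middle R | Rim.walk R | Rim.low R | Rim.inner R | Rim.high R
... | []     | _     | _ | _ | _ = ⊥-elim (1+n≰n (subst (4 ≤_) (sym (cong length eq)) 4≤))
... | h ∷ ms | s ∷ w | l | n | g =
  record { enter = Rim.enter R ; next = s ; walk = w ; leave = Rim.leave R ; low = l ; inner = n ; high = g }
  , eq , t , i

toLong : ∀ {X} (F : Full X) → Σ (LongRim X) λ E → LongRim.points E ≡ Full.points F × LongRim.total E ≡ Full.total F
toLong {X} F with M , x , eq , w , s ← unsnoc (Full.next F ∷ Full.walk F) =
  record
    { enter = enter ; walk = w ; next = s ; leave = leave
    ; init-free = subst (λ M → Free X (first ∷ second ∷ M)) eq init-free
    ; tail-free = subst (λ M → Free X (second ∷ M)) (sym eq′) tail-free }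
  , cong (λ M → first ∷ second ∷ M) eq′ , refl
  where
  open Full F
  eq′ : M ++ penult ∷ last ∷ [] ≡ (third ∷ middle) ∷ʳ last
  eq′ = trans (sym (++-assoc M [ penult ] [ last ])) (cong (_∷ʳ last) (sym eq))

-- Two turns give the zigzag enough points to be woven like a full chain.
zigzagᶠ : ∀ {X Y} (A : Rim X) (B : Rim Y) → Full (X ⊗ Y)
zigzagᶠ A B = record
  { enter = Z.enter ; next = right A.enter
  ; walk = row-walk B.second A.walk ⁀ col-walk A.penult (B.walk ⁀ B.leave ∷ [])
  ; leave = Z.leave ; low = Z.low ; inner = Z.inner ; high = Z.high }
  where
  module A = Rim A
  module B = Rim B
  module Z = Rim (zigzag A B)

weave′ : ∀ {X Y} (F : Full X) (P : Hooked Y) →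
         Tame (X ⊗ Y) (Full.total F + Hooked.total P) (rect (Full.points F) (Hooked.points P))
weave′ {X} {Y} F P with E , eq , t ← toLong F =
  subst (λ S → Tame (X ⊗ Y) (Full.total F + Hooked.total P) (rect S (Hooked.points P))) eq
    (retotal (cong (_+ Hooked.total P) t) (weave E P))

record Pair (X : Space) : Set where
  constructor pair
  field
    {fst snd} : Pt X
    rise      : Step X fst snd
    distinct  : Apart X fst snd

  points : List (Pt X)
  points = fst ∷ snd ∷ []

  total : ℕ
  total = rank X fst + rank X snd

  asLine : Line X
  asLine = line (rise ∷ []) ((distinct ∷ []) ∷ [] ∷ [])

module _ {X Y : Space} (F : Full X) (D : Pair Y) where
  private
    module F = Full F
    module D = Pair D

  -- The lower row keeps its jump from end to end, but the line then climbs: its final point lies at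
  -- the other height, apart from the whole row.
  hooked : Hooked (X ⊗ Y)
  hooked = record
    { enter = right F.enter ; next = right F.next ; walk = row-walk D.fst F.walk
    ; turn = right F.leave ; leave = above D.rise
    ; init-free = row-free D.fst F.init-free
    ; tail-free = subst (Free (X ⊗ Y)) eq
        (APP.++⁺ (row-free D.fst F.tail-free) ([] ∷ [])
          (row-col₂ (F.second ∷ F.third ∷ F.middle ∷ʳ F.last) {Q = [ D.snd ]} (D.distinct ∷ [])))
    ; ends = apart₂ D.distinct }
    where
    eq : row (F.second ∷ F.third ∷ F.middle ∷ʳ F.last) D.fst ++ [ F.last , D.snd ]
         ≡ row (F.second ∷ F.third ∷ F.middle) D.fst ++ (F.last , D.fst) ∷ (F.last , D.snd) ∷ []
    eq = trans (cong (_++ [ F.last , D.snd ]) (map-++ (_, D.fst) (F.second ∷ F.third ∷ F.middle) [ F.last ]))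
               (++-assoc (row (F.second ∷ F.third ∷ F.middle) D.fst) _ _)

  hooked-total : Hooked.total hooked ≡ F.total + D.total
  hooked-total = +-exch (rank X F.first) (rank Y D.fst) (rank X F.last) (rank Y D.snd)

  -- The rest of the product: the upper row has lost its last point to the hooked line, and with it
  -- its jump.
  short : Line (X ⊗ Y)
  short = line (row-walk D.snd (F.enter ∷ F.next ∷ F.walk)) (row-free D.snd F.init-free)

  short-total : Line.total short ≡ F.total + D.total
  short-total rewrite up F.leave | up D.rise =
    solve 3 (λ a b d → (a :+ (con 1 :+ d)) :+ (b :+ (con 1 :+ d)) := (a :+ (con 1 :+ b)) :+ (d :+ (con 1 :+ d))) refl
      (rank X F.first) (rank X F.penult) (rank Y D.fst)

  hooked-covers : Hooked.points hooked ++ Line.points short ↭ rect F.points D.points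
  hooked-covers = begin
    (row I D.fst ++ (F.last , D.fst) ∷ (F.last , D.snd) ∷ []) ++ row I D.snd
      ↭⟨ prove 4 ((var 0F ⊕ var 1F ⊕ var 2F) ⊕ var 3F) ((var 0F ⊕ var 1F) ⊕ (var 3F ⊕ var 2F))
           (row I D.fst ∷ [ F.last , D.fst ] ∷ [ F.last , D.snd ] ∷ row I D.snd ∷ []) ⟩
    (row I D.fst ++ [ F.last , D.fst ]) ++ (row I D.snd ++ [ F.last , D.snd ])
      ≡⟨ sym (cong₂ _++_ (map-++ (_, D.fst) I [ F.last ]) (map-++ (_, D.snd) I [ F.last ])) ⟩
    row F.points D.fst ++ row F.points D.snd
      ≡⟨ cong (row F.points D.fst ++_) (sym (trans (cong (row F.points D.snd ++_) (rect-[] F.points)) (++-identityʳ _))) ⟩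
    row F.points D.fst ++ (row F.points D.snd ++ rect F.points [])
      ↭⟨ ++⁺ˡ (row F.points D.fst) (↭-sym (rect-∷ʳ F.points D.snd [])) ⟩
    row F.points D.fst ++ rect F.points (D.snd ∷ [])
      ↭⟨ ↭-sym (rect-∷ʳ F.points D.fst (D.snd ∷ [])) ⟩
    rect F.points D.points ∎
    where
    open PermutationReasoning
    open Bag {Pt X × Pt Y}
    I = F.first ∷ F.second ∷ F.third ∷ F.middle

module _ {A B : Set} {Ψ : List (A × B) → Set} where

  over₂ : ∀ S T {V} Q → S ++ T ↭ V → Decomp Ψ (rect S Q) → Decomp Ψ (rect T Q) → Decomp Ψ (rect V Q)
  over₂ S T Q p d e = recover (rect-congˡ Q p) (recover (↭-reflexive (sym (rect-++ˡ S T Q))) (d ⊎ᵈ e))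

  over₃ : ∀ S T U {V} Q → S ++ (T ++ U) ↭ V →
          Decomp Ψ (rect S Q) → Decomp Ψ (rect T Q) → Decomp Ψ (rect U Q) → Decomp Ψ (rect V Q)
  over₃ S T U Q p d e f = recover (rect-congˡ Q p)
    (recover (↭-reflexive (sym (trans (rect-++ˡ S (T ++ U) Q) (cong (rect S Q ++_) (rect-++ˡ T U Q)))))
      (d ⊎ᵈ e ⊎ᵈ f))

  overʳ₂ : ∀ P S T {V} → S ++ T ↭ V → Decomp Ψ (rect P S) → Decomp Ψ (rect P T) → Decomp Ψ (rect P V)
  overʳ₂ P S T p d e = recover (rect-congʳ P p) (recover (↭-sym (rect-++ʳ P S T)) (d ⊎ᵈ e))

  overʳ₃ : ∀ P S T U {V} → S ++ (T ++ U) ↭ V →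
           Decomp Ψ (rect P S) → Decomp Ψ (rect P T) → Decomp Ψ (rect P U) → Decomp Ψ (rect P V)
  overʳ₃ P S T U p d e f = recover (rect-congʳ P p)
    (recover (↭-sym (↭-trans (rect-++ʳ P S (T ++ U)) (++⁺ˡ (rect P S) (rect-++ʳ P T U)))) (d ⊎ᵈ e ⊎ᵈ f))

map-rectˡ : ∀ {A A′ B : Set} (f : A → A′) (S : List A) (R : List B) →
            map (λ (x , y) → f x , y) (rect S R) ≡ rect (map f S) R
map-rectˡ f []      R = refl
map-rectˡ f (x ∷ S) R =
  trans (map-++ _ (col x R) (rect S R)) (cong₂ _++_ (sym (map-∘ R)) (map-rectˡ f S R))

mapˡ-tame : ∀ {X X′ Y N S S′ R} (h : Hom X X′) → map (to h) S ↭ S′ →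
            Tame (X ⊗ Y) N (rect S R) → Tame (X′ ⊗ Y) N (rect S′ R)
mapˡ-tame {S = S} {R = R} h p =
  recover (↭-trans (↭-reflexive (map-rectˡ (to h) S R)) (rect-congˡ R p)) ∘ map-tame (mapˡʰ h)

module _ {A B C : Set} where

  rotate : (A × B) × C → (C × A) × B
  rotate ((x , y) , z) = (z , x) , y

  exchange : (A × B) × C → (A × C) × B
  exchange ((x , y) , z) = (x , z) , y

  rect-rotate : ∀ P Q R → map rotate (rect (rect P Q) R) ↭ rect (rect R P) Q
  rect-rotate P Q R = begin
    map rotate (rect (rect P Q) R)          ≡⟨ map-∘ _ ⟩
    map assocˡ (map swap (rect (rect P Q) R)) ↭⟨ map⁺ assocˡ (rect-swap (rect P Q) R) ⟩
    map assocˡ (rect R (rect P Q))          ≡⟨ rect-assocˡ R P Q ⟩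
    rect (rect R P) Q                       ∎
    where open PermutationReasoning

  rect-exchange : ∀ P Q R → map exchange (rect (rect P Q) R) ↭ rect (rect P R) Q
  rect-exchange P Q R = begin
    map exchange (rect (rect P Q) R)                     ≡⟨ map-∘ _ ⟩
    map (λ (x , y) → swap x , y) (map rotate (rect (rect P Q) R)) ↭⟨ map⁺ _ (rect-rotate P Q R) ⟩
    map (λ (x , y) → swap x , y) (rect (rect R P) Q)     ≡⟨ map-rectˡ swap (rect R P) Q ⟩
    rect (map swap (rect R P)) Q                         ↭⟨ rect-congˡ Q (rect-swap R P) ⟩
    rect (rect P R) Q                                    ∎
    where open PermutationReasoning

module _ {X Y Z : Space} where

  exchangeʰ : Hom (X ⊗ Y ⊗ Z) (X ⊗ Z ⊗ Y)
  exchangeʰ .to = exchange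
  exchangeʰ .ranks ((x , y) , z) = solve 3 (λ a b c → a :+ c :+ b := a :+ b :+ c) refl (rank X x) (rank Y y) (rank Z z)
  exchangeʰ .mono = exchange
  exchangeʰ .seps = [ Sum.map₁ inj₁ , inj₁ ∘ inj₂ ]′

  exchange-tame : ∀ {N P Q R} → Tame (X ⊗ Y ⊗ Z) N (rect (rect P Q) R) → Tame (X ⊗ Z ⊗ Y) N (rect (rect P R) Q)
  exchange-tame {P = P} {Q} {R} = recover (rect-exchange P Q R) ∘ map-tame exchangeʰ

border-long : ∀ {X Y} (F : Full X) (G : Rim Y) → 4 ≤ length (Line.points (border (rim F) G))
border-long F G = s≤s (s≤s (go (Full.middle F)))
  where
  go : ∀ M → 2 ≤ length (row (M ∷ʳ Full.last F) (Rim.first G)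
                          ++ (Full.last F , Rim.second G) ∷ col (Full.last F) (Rim.middle G))
  go []      = s≤s (s≤s z≤n)
  go (x ∷ M) = ≤-trans (go M) (n≤1+n _)

module _ {X Y Z : Space} (A : Full X) (B : Full Y) where
  private
    module A = Full A
    module B = Full B
    N = A.total + B.total

  box : Tame (X ⊗ Y) N (rect (Line.points (inits (rim A))) (Line.points (tails (rim B))))
  box = retotal (corner-total (rim A) (rim B)) (inits (rim A) ⊠ tails (rim B))

  -- A pair cannot enter a zigzag, so A absorbs it first. `A × D` consists of a hooked line, which
  -- is woven with B, and of `short`, whose ends are apart and which therefore admits a closed
  -- zigzag with B.
  times-pair : (D : Pair Z) → Tame (X ⊗ Y ⊗ Z) (N + Pair.total D) (rect (rect A.points B.points) (Pair.points D))
  times-pair D = retotal eq (exchange-tame {P = A.points} {Pair.points D} {B.points}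
    (over₂ (Hooked.points (hooked A D)) (Line.points (short A D)) B.points (hooked-covers A D)
      (swap-tame {P = B.points} {Hooked.points (hooked A D)} (retotal eq₁ (weave′ B (hooked A D))))
      (short-part (toRim (short A D) (s≤s (s≤s (s≤s z≤n)))))))
    where
    M = B.total + (A.total + Pair.total D)
    eq : M ≡ N + Pair.total D
    eq = solve 3 (λ a b d → b :+ (a :+ d) := a :+ b :+ d) refl A.total B.total (Pair.total D)
    eq₁ : B.total + Hooked.total (hooked A D) ≡ M
    eq₁ = cong (B.total +_) (hooked-total A D)
    short-part : (Σ (Rim (X ⊗ Z)) λ R → Rim.points R ≡ Line.points (short A D) × Rim.total R ≡ Line.total (short A D)
                   × Apart (X ⊗ Z) (Rim.first R) (Rim.last R)) →
                 Tame (X ⊗ Z ⊗ Y) M (rect (Line.points (short A D)) B.points)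
    short-part (R , e , t , i) = subst (λ S → Tame (X ⊗ Z ⊗ Y) M (rect S B.points)) e
      (retotal (trans (cong (_+ B.total) (trans t (short-total A D))) (+-comm (A.total + Pair.total D) B.total))
        (zigzag-tame R (rim B) (inj₁ i)))

  -- Of the three parts of `A × B` only the zigzag jumps; a second zigzag, with ℓ, closes because
  -- the ends of ℓ are apart. The other parts are multiplied by ℓ in hooks.
  times-line : (ℓ : Line Z) → 3 ≤ length (Line.points ℓ) →
               Tame (X ⊗ Y ⊗ Z) (N + Line.total ℓ) (rect (rect A.points B.points) (Line.points ℓ))
  times-line ℓ 3≤ with R , e , t , i ← toRim ℓ 3≤ =
    over₃ (Rim.points (zigzag (rim A) (rim B))) (Line.points (border (rim A) (rim B)))
      (rect (Line.points (inits (rim A))) (Line.points (tails (rim B)))) (Line.points ℓ) (zigzag-covers (rim A) (rim B))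
      (subst (λ S → Tame (X ⊗ Y ⊗ Z) (N + Line.total ℓ) (rect (Rim.points (zigzag (rim A) (rim B))) S)) e
        (retotal (cong₂ _+_ (zigzag-total (rim A) (rim B)) t) (zigzag-tame (zigzag (rim A) (rim B)) R (inj₂ i))))
      (retotal (cong (_+ Line.total ℓ) (border-total (rim A) (rim B))) (border (rim A) (rim B) ⊠ ℓ))
      (box ⊛ ℓ)

  times : (ℓ : Line Z) → 2 ≤ length (Line.points ℓ) →
          Tame (X ⊗ Y ⊗ Z) (N + Line.total ℓ) (rect (rect A.points B.points) (Line.points ℓ))
  times (line [] _) (s≤s ())
  times (line (s ∷ []) ((i ∷ []) ∷ _)) _ = times-pair (pair s i)
  times ℓ@(line (s ∷ t ∷ w) f) _ = times-line ℓ (s≤s (s≤s (s≤s z≤n)))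

module _ {X Y : Space} (A : Rim X) (B : Rim Y) {C : Set} where

  over-zigzag : ∀ {Ψ : List ((Pt X × Pt Y) × C) → Set} Q →
    Decomp Ψ (rect (Rim.points (zigzag A B)) Q) → Decomp Ψ (rect (Line.points (border A B)) Q) →
    Decomp Ψ (rect (rect (Line.points (inits A)) (Line.points (tails B))) Q) →
    Decomp Ψ (rect (rect (Rim.points A) (Rim.points B)) Q)
  over-zigzag Q = over₃ (Rim.points (zigzag A B)) (Line.points (border A B))
    (rect (Line.points (inits A)) (Line.points (tails B))) Q (zigzag-covers A B)

  overʳ-zigzag : ∀ {Ψ : List (C × (Pt X × Pt Y)) → Set} P →
    Decomp Ψ (rect P (Rim.points (zigzag A B))) → Decomp Ψ (rect P (Line.points (border A B))) →
    Decomp Ψ (rect P (rect (Line.points (inits A)) (Line.points (tails B)))) →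
    Decomp Ψ (rect P (rect (Rim.points A) (Rim.points B)))
  overʳ-zigzag P = overʳ₃ P (Rim.points (zigzag A B)) (Line.points (border A B))
    (rect (Line.points (inits A)) (Line.points (tails B))) (zigzag-covers A B)

inits-long : ∀ {X} (A : Full X) → ∀ n → n ≤ length (Full.middle A) → 2 + n ≤ length (Line.points (inits (rim A)))
inits-long A n n≤ = +-cancelʳ-≤ 1 _ _ (begin
  2 + n + 1                                       ≡⟨ +-comm (2 + n) 1 ⟩
  3 + n                                           ≤⟨ +-monoʳ-≤ 3 n≤ ⟩
  3 + length (Full.middle A)                      ≡⟨ cong length (proj₁ (proj₂ (dropLast² (rim A)))) ⟩
  length (Line.points ℓ ∷ʳ Full.penult A)         ≡⟨ length-++ (Line.points ℓ) ⟩
  length (Line.points ℓ) + 1                      ∎)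
  where
  open ≤-Reasoning
  ℓ = inits (rim A)

-- Three full factors

module _ {X Y Z W : Space} (A : Full X) (B : Full Y) (C : Full Z) where
  private
    module A = Full A
    module B = Full B
    module C = Full C

    N = A.total + B.total

  three-full-box : (D : Rim W) →
    Tame (X ⊗ Y ⊗ (Z ⊗ W)) (N + (C.total + Rim.total D))
         (rect (rect A.points B.points) (rect (Line.points (inits (rim C))) (Line.points (tails D))))
  three-full-box D = assoc-tame {P = rect A.points B.points} {Line.points (inits (rim C))} {Line.points (tails D)}
    (retotal (trans (+-assoc N _ _) (cong (N +_) (corner-total (rim C) D)))
      (times A B (inits (rim C)) (inits-long C 0 z≤n) ⊛ tails D))

  three-full-border : (D : Rim W) →
    Tame (X ⊗ Y ⊗ (Z ⊗ W)) (N + (C.total + Rim.total D))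
         (rect (rect A.points B.points) (Line.points (border (rim C) D)))
  three-full-border D = retotal (cong (N +_) (border-total (rim C) D))
    (times A B (border (rim C) D) (≤-trans (m≤n+m 2 2) (border-long C D)))

  -- The ends of D are apart, so even the zigzag of C and D closes to a line, and every part of
  -- `C × D` reduces to two full factors times lines.
  three-full-long : (D : Line W) → 3 ≤ length (Line.points D) →
    Tame (X ⊗ Y ⊗ (Z ⊗ W)) (N + (C.total + Line.total D))
         (rect (rect A.points B.points) (rect C.points (Line.points D)))
  three-full-long D 3≤ with D′ , eq , t , i ← toRim D 3≤ =
    subst₂ (λ M S → Tame (X ⊗ Y ⊗ (Z ⊗ W)) (N + (C.total + M)) (rect (rect A.points B.points) (rect C.points S)))
      t eq
      (overʳ-zigzag (rim C) D′ (rect A.points B.points)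
        (retotal (cong (N +_) (zigzag-total (rim C) D′))
          (times A B (Rim.close (zigzag (rim C) D′) (apart₂ i)) (s≤s (s≤s z≤n))))
        (three-full-border D′)
        (three-full-box D′))

  -- `C × D` leaves a hooked line, which must be woven with each part of `A × B`. Weaving needs four
  -- points; the bound on `A.middle` gives A six, so that four are left in `inits (rim A)`.
  three-full-pair : (D : Pair W) → 2 ≤ length A.middle →
    Tame (X ⊗ Y ⊗ (Z ⊗ W)) (N + (C.total + Pair.total D))
         (rect (rect A.points B.points) (rect C.points (Pair.points D)))
  three-full-pair D 2≤ = overʳ₂ (rect A.points B.points) P (Line.points (short C D)) (hooked-covers C D)
    (retotal (cong (N +_) (hooked-total C D))
      (over-zigzag (rim A) (rim B) P
        (retotal (cong (_+ Hooked.total H) (zigzag-total (rim A) (rim B))) (weave′ (zigzagᶠ (rim A) (rim B)) H))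
        (weave-line (border (rim A) (rim B)) (border-long A (rim B)) (border-total (rim A) (rim B)))
        (retotal eq (exchange-tame {P = Line.points (inits (rim A))} {P} {Line.points (tails (rim B))}
          (weave-line (inits (rim A)) (inits-long A 2 2≤) refl ⊛ tails (rim B))))))
    (retotal (cong (N +_) (short-total C D)) (times A B (short C D) (s≤s (s≤s z≤n))))
    where
    H = hooked C D
    P = Hooked.points H
    weave-line : ∀ {V M} (ℓ : Line V) → 4 ≤ length (Line.points ℓ) → Line.total ℓ ≡ M →
                 Tame (V ⊗ (Z ⊗ W)) (M + Hooked.total H) (rect (Line.points ℓ) P)
    weave-line {V} ℓ 4≤ refl with F , e , t , _ ← toFull ℓ 4≤ =
      subst₂ (λ M S → Tame (V ⊗ (Z ⊗ W)) (M + Hooked.total H) (rect S P)) t e (weave′ F H)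
    eq : (Line.total (inits (rim A)) + Hooked.total H) + Line.total (tails (rim B)) ≡ N + Hooked.total H
    eq = trans (solve 3 (λ a b c → (a :+ b) :+ c := (a :+ c) :+ b) refl
                  (Line.total (inits (rim A))) (Hooked.total H) (Line.total (tails (rim B))))
               (cong (_+ Hooked.total H) (corner-total (rim A) (rim B)))

-- Tolerated jumps and four full factors

Loosen : (X : Space) → (Pt X → Pt X → Set) → Space
Loosen X E .Pt         = Pt X
Loosen X E .rank       = rank X
Loosen X E .Below      = Below X
Loosen X E .Below-refl = Below-refl X
Loosen X E .Sep x y    = Sep X x y ⊎ E x y

loosenʰ : ∀ {X E} → Hom X (Loosen X E)
loosenʰ .to x    = x
loosenʰ .ranks x = refl
loosenʰ .mono l  = l
loosenʰ .seps    = inj₁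

loosen : ∀ {X E N S} → Tame X N S → Tame (Loosen X E) N S
loosen {S = S} d = recover (↭-reflexive (map-id S)) (map-tame loosenʰ d)

module _ {X : Space} (R : Rim X) where
  private module R = Rim R

  rim-free : ∀ {Y} (f : Pt X → Pt Y) → (∀ {x y} → Apart X x y → Apart Y (f x) (f y)) →
             Apart Y (f R.first) (f R.last) → Free Y (map f R.points)
  rim-free {Y} f a i = AllP.map⁺ (AllP.++⁺ (All.map a R.low) (i ∷ [])) ∷ APP.map⁺ (AllPairs.map a R.tail-free)

-- The rectangle left over by the zigzag of A and B, times the zigzag of C and D, cannot be handled
-- by recursion when all sides have four points; this is where the exception at B.third enters.
module _ {X Y Z W : Space} (A : Full X) (B : Full Y) (C : Full Z) (D : Full W)
         (E : (Pt X × Pt Y) × (Pt Z × Pt W) → (Pt X × Pt Y) × (Pt Z × Pt W) → Set) where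
  private
    module A = Full A
    module B = Full B
    module C = Full C
    module D = Full D

    zAB = zigzag (rim A) (rim B)
    zCD = zigzag (rim C) (rim D)
    N   = A.total + B.total + (C.total + D.total)
    S   = Loosen (X ⊗ Y ⊗ (Z ⊗ W)) E
    A⁻  = inits (rim A)
    B⁻  = tails (rim B)

  corner-corner inner-jump : Set
  corner-corner = E ((A.first , B.first) , (C.first , D.first)) ((A.last , B.last) , (C.last , D.last))
  inner-jump    = ∀ a a′ → E ((a , B.third) , (C.first , D.first)) ((a′ , B.third) , (C.last , D.last))

  private
    -- The factor A is multiplied in last, by `⊛`, which may combine any of its points with a pair;
    -- hence an exception here has to hold for all `a` and `a′`.
    M : Space
    M = Loosen ((Z ⊗ W) ⊗ Y) λ (c , b) (c′ , b′) →
      ∀ a a′ → E ((a , b) , c) ((a′ , b′) , c′)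

    toSʰ : Hom (M ⊗ X) S
    toSʰ .to ((c , b) , a) = (a , b) , c
    toSʰ .ranks ((c , b) , a) =
      solve 3 (λ a b c → a :+ b :+ c := c :+ b :+ a) refl (rank X a) (rank Y b) (rank (Z ⊗ W) c)
    toSʰ .mono ((c , b) , a) = (a , b) , c
    toSʰ .seps (inj₁ (inj₁ (inj₁ s))) = inj₁ (inj₂ s)
    toSʰ .seps (inj₁ (inj₁ (inj₂ s))) = inj₁ (inj₁ (inj₂ s))
    toSʰ .seps (inj₁ (inj₂ e))        = inj₂ (e _ _)
    toSʰ .seps (inj₂ s)               = inj₁ (inj₁ (inj₁ s))

    -- A single hook carries the entire zigzag of C and D, at height `B.third`, so its jump occurs
    -- only there, where `inner-jump` tolerates it. Without its last point the zigzag is jump-free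
    -- and the remaining rectangle splits into hooks.
    inner : inner-jump → Tame M (Rim.total zCD + Line.total B⁻) (rect (Rim.points zCD) (Line.points B⁻))
    inner e with h , t , eq , s , w ← uncons B.middle (B.walk ⁀ B.leave ∷ []) =
      recover (peel-covers {Z ⊗ W} {Y} {R.first} {R.second ∷ R.middle ∷ʳ R.last} {I} {R.last} B.third (B.middle ∷ʳ B.last) refl)
        (single (lifted (Chainₙ M K) (map-chain loosenʰ first-chain) , first-free)
         ⊎ᵈ subst (λ Q → Tame M K (rect I Q)) (sym eq)
              (loosen (hooks (R.enter ∷ R.walk) w R.init-free (subst (Free Y) eq (AllPairs.tail B⁻-free))
                (shrink-total {Z ⊗ W} {Y} R.leave s refl))))
      where
      module R = Rim zCD
      K = R.total + Line.total B⁻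
      I = R.first ∷ R.second ∷ R.middle
      B⁻-free : Free Y (B.third ∷ B.middle ∷ʳ B.last)
      B⁻-free = AllPairs.tail B.tail-free
      lifted : (Ψ : List (Pt M) → Set) → ∀ {P} → Ψ (map (λ x → x) P) → Ψ P
      lifted Ψ {P} = subst Ψ (map-id P)
      first-chain : Chainₙ ((Z ⊗ W) ⊗ Y) K (row R.points B.third ++ col R.last (B.middle ∷ʳ B.last))
      first-chain = chain (row-walk B.third R.full-walk ⁀ col-walk R.last (B.walk ⁀ B.leave ∷ []))
                          (hook-total {Z ⊗ W} {Y} {R.first} {R.last} {B.third} {B.last} refl)
      loose : ∀ {p q} → Apart ((Z ⊗ W) ⊗ Y) p q → Apart M p q
      loose (apart s) = apart (inj₁ s)
      first-free : Free M (row R.points B.third ++ col R.last (B.middle ∷ʳ B.last))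
      first-free = APP.++⁺
        (rim-free zCD {M} (_, B.third) (loose ∘ apart₁) (apart (inj₂ e)))
        (lifted (Free M) (map-free loosenʰ (col-free R.last (AllPairs.tail B⁻-free))))
        (All.map (All.map loose) (row-col₂ R.points {Q = B.middle ∷ʳ B.last} (AllPairs.head B⁻-free)))

    toS : ∀ {K P Q R} → Tame (M ⊗ X) K (rect (rect P Q) R) → Tame S K (rect (rect R Q) P)
    toS {P = P} {Q} {R} = recover
      (↭-trans (↭-reflexive (map-∘ _))
        (↭-trans (map⁺ exchange (rect-rotate P Q R)) (rect-exchange R P Q))) ∘ map-tame toSʰ

    -- The zigzag of the two zigzags has one possible jump, between the extreme corners of the
    -- fourfold product, which is the one tolerated.
    corners : corner-corner → Tame S N (rect (Rim.points zAB) (Rim.points zCD))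
    corners e = recover (zigzag-covers zAB zCD)
      (single (subst (Chainₙ S N) (map-id _) (map-chain loosenʰ
                 (chain (Rim.full-walk ζ) (trans (zigzag-total zAB zCD) (cong₂ _+_ (zigzag-total (rim A) (rim B)) (zigzag-total (rim C) (rim D))))))
               , subst (Free S) (map-id _) (rim-free ζ {S} (λ x → x) (λ { (apart s) → apart (inj₁ s) }) (apart (inj₂ e))))
       ⊎ᵈ loosen (retotal eq (single (line-chain (border zAB zCD) (border-total zAB zCD)) ⊎ᵈ
                  retotal (corner-total zAB zCD) (inits zAB ⊠ tails zCD))))
      where
      ζ  = zigzag zAB zCD
      eq : Rim.total zAB + Rim.total zCD ≡ N
      eq = cong₂ _+_ (zigzag-total (rim A) (rim B)) (zigzag-total (rim C) (rim D))

    sides : Tame S N (rect (Line.points (border (rim A) (rim B))) (Rim.points zCD))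
    sides with R , eq , t , i ← toRim (border (rim A) (rim B)) (≤-trans (n≤1+n 3) (border-long A (rim B))) =
      loosen (subst (λ P → Tame (X ⊗ Y ⊗ (Z ⊗ W)) N (rect P (Rim.points zCD))) eq
        (retotal (cong₂ _+_ (trans t (border-total (rim A) (rim B))) (zigzag-total (rim C) (rim D)))
          (zigzag-tame R zCD (inj₁ i))))

  four-full : corner-corner → inner-jump →
    Tame S N (rect (rect A.points B.points) (rect C.points D.points))
  four-full e e′ = overʳ-zigzag (rim C) (rim D) (rect A.points B.points)
    (over-zigzag (rim A) (rim B) (Rim.points zCD)
      (corners e) sides (toS {P = Rim.points zCD} {Line.points B⁻} (retotal eq (inner e′ ⊛ A⁻))))
    (loosen (three-full-border A B C (rim D)))
    (loosen (three-full-box A B C (rim D)))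
    where
    eq : (Rim.total zCD + Line.total B⁻) + Line.total A⁻ ≡ N
    eq = trans (solve 3 (λ a b c → c :+ b :+ a := a :+ b :+ c) refl (Line.total A⁻) (Line.total B⁻) (Rim.total zCD))
               (cong₂ _+_ (corner-total (rim A) (rim B)) (zigzag-total (rim C) (rim D)))

-- A full factor times a marked pair

module _ {X Y : Space} (A : Full X) (D : Pair Y) where
  private
    module A = Full A
    module D = Pair D
    N = A.total + D.total
    I T : List (Pt X)
    I = A.first ∷ A.second ∷ A.third ∷ A.middle
    T = A.second ∷ (A.third ∷ A.middle) ∷ʳ A.last

  -- Apart x x makes every jump at height x harmless; it is used for tails of good families.
  slack-low : Apart Y D.fst D.fst → Tame (X ⊗ Y) N (rect A.points D.points)
  slack-low i = recover (peel-covers {X} {Y} {A.first} {T} {I} {A.last} D.fst [ D.snd ] refl)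
    (single (hook (Rim.full-walk (rim A)) (D.rise ∷ []) (row-free′ A.points i) (Line.free D.asLine) refl)
     ⊎ᵈ hooks (A.enter ∷ A.next ∷ A.walk) [] A.init-free ([] ∷ []) (shrink-total A.leave D.rise refl))

  -- The tolerated height is now the upper one: its entire row is one chain, extended downwards by
  -- the corner of the lower row. The lower row thereby loses its first point, and with it the jump.
  slack-high : Apart Y D.snd D.snd → Tame (X ⊗ Y) N (rect A.points D.points)
  slack-high i = recover covers
    (single (chain (above D.rise ∷ row-walk D.snd (Rim.full-walk (rim A))) (hook-total {X} {Y} refl) , long-free)
     ⊎ᵈ single (chain (row-walk D.fst (A.next ∷ A.walk ⁀ A.leave ∷ [])) total , row-free D.fst A.tail-free))
    where
    long-free : Free (X ⊗ Y) ((A.first , D.fst) ∷ row A.points D.snd)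
    long-free = AllP.map⁺ (All.universal (λ _ → apart₂ D.distinct) A.points) ∷ row-free′ A.points i
    total : (rank X A.second + rank Y D.fst) + (rank X A.last + rank Y D.fst) ≡ N
    total rewrite up A.enter | up D.rise =
      solve 3 (λ a b d → ((con 1 :+ a) :+ d) :+ (b :+ d) := (a :+ b) :+ (d :+ (con 1 :+ d))) refl
        (rank X A.first) (rank X A.last) (rank Y D.fst)
    covers : ((A.first , D.fst) ∷ row A.points D.snd) ++ row T D.fst ↭ rect A.points D.points
    covers = begin
      ((A.first , D.fst) ∷ row A.points D.snd) ++ row T D.fst
        ↭⟨ prep _ (++-comm (row A.points D.snd) (row T D.fst)) ⟩
      row A.points D.fst ++ row A.points D.snd
        ≡⟨ cong (row A.points D.fst ++_) (sym (trans (cong (row A.points D.snd ++_) (rect-[] A.points)) (++-identityʳ _))) ⟩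
      row A.points D.fst ++ (row A.points D.snd ++ rect A.points [])
        ↭⟨ ++⁺ˡ (row A.points D.fst) (↭-sym (rect-∷ʳ A.points D.snd [])) ⟩
      row A.points D.fst ++ rect A.points (D.snd ∷ [])
        ↭⟨ ↭-sym (rect-∷ʳ A.points D.fst (D.snd ∷ [])) ⟩
      rect A.points D.points ∎
      where open PermutationReasoning

-- The smallest product with three full factors and a pair

-- A decidable model: `Grid 4` is a shortest full chain, with 0 to 3 as its only jump, and `Grid 2`
-- is a pair. `Below` contains just equality and covering, the relations that a single step uses,
-- and `Sep` speaks of increasing pairs, as they occur along a chain.
Grid : ℕ → Space
Grid n .Pt         = Fin n
Grid n .rank       = toℕ
Grid n .Below i j  = Bool.T ((toℕ i ≡ᵇ toℕ j) ∨ (suc (toℕ i) ≡ᵇ toℕ j))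
Grid n .Below-refl {i} = Equivalence.from T-∨ (inj₁ (≡⇒≡ᵇ (toℕ i) _ refl))
Grid n .Sep i j    = Bool.T ((toℕ i <ᵇ toℕ j) ∧ not (3 + toℕ i ≡ᵇ toℕ j))

record Testable (X : Space) : Set where
  field
    same?  : DecidableEquality (Pt X)
    below? : Decidable (Below X)
    sep?   : Decidable (Sep X)

  step? : Decidable (Step X)
  step? x y = Dec.map′ (λ (l , r) → step l r) (λ { (step l r) → l , r })
                       (below? x y ×-dec (rank X y ≟ suc (rank X x)))

  apart? : Decidable (Apart X)
  apart? x y = Dec.map′ apart (λ { (apart s) → s }) (sep? x y)

  walk? : ∀ x P → Dec (∃ λ y → Walk X x P y)
  walk? x []      = yes (x , [])
  walk? x (y ∷ P) = Dec.map′ (λ (s , z , w) → z , s ∷ w) (λ { (z , s ∷ w) → s , z , w })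
                             (step? x y ×-dec walk? y P)

  tame? : ∀ N P → Dec (JumpFree X N P)
  tame? N P = chain? P ×-dec allPairs? apart? P
    where
    chain? : ∀ P → Dec (Chainₙ X N P)
    chain? []      = no λ ()
    chain? (x ∷ P) with walk? x P
    ... | no ¬w       = no λ { (chain w _) → ¬w (_ , w) }
    ... | yes (y , w) = Dec.map′ (chain w) (λ { (chain v e) → trans (cong (λ z → rank X x + rank X z) (ends w v)) e })
                                 (rank X x + rank X y ≟ N)
      where
      ends : ∀ {x P y z} → Walk X x P y → Walk X x P z → y ≡ z
      ends []      []      = refl
      ends (_ ∷ w) (_ ∷ v) = ends w v

  extract : ∀ x P → Maybe (∃ λ Q → x ∷ Q ↭ P)
  extract x []      = nothing
  extract x (y ∷ P) with same? x y
  ... | yes refl = just (P , ↭-refl)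
  ... | no _     with extract x P
  ...   | nothing      = nothing
  ...   | just (Q , p) = just (y ∷ Q , ↭-trans (_↭_.swap x y ↭-refl) (prep y p))

  permute : ∀ P Q → Maybe (P ↭ Q)
  permute []      []      = just ↭-refl
  permute []      (_ ∷ _) = nothing
  permute (x ∷ P) Q with extract x Q
  ... | nothing      = nothing
  ... | just (R , p) with permute P R
  ...   | nothing = nothing
  ...   | just q  = just (↭-trans (prep x q) p)

open Testable

grid-testable : ∀ n → Testable (Grid n)
grid-testable n .same?      = Fin._≟_
grid-testable n .below? i j = T? _
grid-testable n .sep? i j   = T? _

⊗-testable : ∀ {X Y} → Testable X → Testable Y → Testable (X ⊗ Y)
⊗-testable s t .same?                  = ≡-dec (same? s) (same? t)
⊗-testable s t .below? (x , y) (z , w) = below? s x z ×-dec below? t y w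
⊗-testable s t .sep? (x , y) (z , w)   = sep? s x z ⊎-dec sep? t y w

Grid₄₄₄₂ : Space
Grid₄₄₄₂ = Grid 4 ⊗ Grid 4 ⊗ Grid 4 ⊗ Grid 2

-- Found by computer search: a jump-free decomposition of 4 × 4 × 4 × 2, the one product with three
-- full factors that the general construction misses.  The decimal digits of an entry are its four
-- coordinates.
table : List (List ℕ)
table =
    (0000 ∷ 0010 ∷ 0020 ∷ 0120 ∷ 1120 ∷ 2120 ∷ 2220 ∷ 2230 ∷ 2231 ∷ 3231 ∷ 3331 ∷ [])
  ∷ (0001 ∷ 0011 ∷ 0111 ∷ 1111 ∷ 2111 ∷ 2211 ∷ 2311 ∷ 2321 ∷ 3321 ∷ [])
  ∷ (0100 ∷ 0110 ∷ 1110 ∷ 2110 ∷ 2210 ∷ 2310 ∷ 2320 ∷ 2330 ∷ 2331 ∷ [])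
  ∷ (1000 ∷ 2000 ∷ 2010 ∷ 3010 ∷ 3110 ∷ 3120 ∷ 3130 ∷ 3230 ∷ 3330 ∷ [])
  ∷ (0101 ∷ 1101 ∷ 2101 ∷ 2201 ∷ 2301 ∷ 3301 ∷ 3311 ∷ [])
  ∷ (0200 ∷ 0210 ∷ 0211 ∷ 0221 ∷ 0231 ∷ 0331 ∷ 1331 ∷ [])
  ∷ (1001 ∷ 2001 ∷ 3001 ∷ 3101 ∷ 3201 ∷ 3211 ∷ 3221 ∷ [])
  ∷ (1010 ∷ 1020 ∷ 2020 ∷ 3020 ∷ 3030 ∷ 3031 ∷ 3131 ∷ [])
  ∷ (1100 ∷ 2100 ∷ 2200 ∷ 2300 ∷ 3300 ∷ 3310 ∷ 3320 ∷ [])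
  ∷ (0021 ∷ 0121 ∷ 1121 ∷ 2121 ∷ 2131 ∷ [])
  ∷ (0030 ∷ 0031 ∷ 0131 ∷ 1131 ∷ 1231 ∷ [])
  ∷ (0201 ∷ 0301 ∷ 0311 ∷ 0321 ∷ 1321 ∷ [])
  ∷ (0300 ∷ 0310 ∷ 1310 ∷ 1320 ∷ 1330 ∷ [])
  ∷ (1011 ∷ 2011 ∷ 3011 ∷ 3111 ∷ 3121 ∷ [])
  ∷ (1200 ∷ 1201 ∷ 1211 ∷ 1221 ∷ 2221 ∷ [])
  ∷ (3000 ∷ 3100 ∷ 3200 ∷ 3210 ∷ 3220 ∷ [])
  ∷ (0130 ∷ 1130 ∷ 2130 ∷ [])
  ∷ (0220 ∷ 0320 ∷ 0330 ∷ [])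
  ∷ (1021 ∷ 2021 ∷ 3021 ∷ [])
  ∷ (1030 ∷ 2030 ∷ 2031 ∷ [])
  ∷ (1210 ∷ 1220 ∷ 1230 ∷ [])
  ∷ (1300 ∷ 1301 ∷ 1311 ∷ [])
  ∷ (0230 ∷ [])
  ∷ (1031 ∷ [])
  ∷ []

decode : ℕ → Pt Grid₄₄₄₂
decode n = (((n / 1000) mod 4 , (n / 100 % 10) mod 4) , (n / 10 % 10) mod 4) , (n % 10) mod 2

private
  testable : Testable Grid₄₄₄₂
  testable = ⊗-testable (⊗-testable (⊗-testable (grid-testable 4) (grid-testable 4)) (grid-testable 4)) (grid-testable 2)

  rows : List (List (Pt Grid₄₄₄₂))
  rows = map (map decode) table

cells : List (Pt Grid₄₄₄₂)
cells = rect (rect (rect (allFin 4) (allFin 4)) (allFin 4)) (allFin 2)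

-- 10 = 3 + 3 + 3 + 1 is the rank of the top cell. Chains and covering are verified by evaluation.
table-tame : Tame Grid₄₄₄₂ 10 cells
table-tame = decomp rows (from-yes (All.all? (tame? testable 10) rows)) (from-just (permute testable (concat rows) cells))

-- A grid starts at rank 0 but a chain at the rank of its first point: ranks shift by `base`, and
-- rank sums of chains by twice as much.
record Embed (G X : Space) : Set where
  field
    to    : Pt G → Pt X
    base  : ℕ
    ranks : ∀ i → rank X (to i) ≡ base + rank G i
    mono  : ∀ i j → Below G i j → Below X (to i) (to j)
    seps  : ∀ i j → Sep G i j → Sep X (to i) (to j)

_⊗ᵉ_ : ∀ {G H X Y} → Embed G X → Embed H Y → Embed (G ⊗ H) (X ⊗ Y)
_⊗ᵉ_ {G} {H} f g = record
  { to    = λ (i , j) → F.to i , K.to j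
  ; base  = F.base + K.base
  ; ranks = λ (i , j) → trans (cong₂ _+_ (F.ranks i) (K.ranks j)) (+-exch F.base (rank G i) K.base (rank H j))
  ; mono  = λ (i , j) (i′ , j′) (l , m) → F.mono i i′ l , K.mono j j′ m
  ; seps  = λ (i , j) (i′ , j′) → Sum.map (F.seps i i′) (K.seps j j′) }
  where
  module F = Embed f
  module K = Embed g

module _ {G X : Space} (f : Embed G X) where
  private module F = Embed f

  embed-walk : ∀ {x P y} → Walk G x P y → Walk X (F.to x) (map F.to P) (F.to y)
  embed-walk []                          = []
  embed-walk {x} (_∷_ {y} (step l r) w) = step (F.mono x y l) (begin
    rank X (F.to y)              ≡⟨ F.ranks y ⟩
    F.base + rank G y            ≡⟨ cong (F.base +_) r ⟩
    F.base + suc (rank G x)      ≡⟨ +-suc F.base (rank G x) ⟩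
    suc (F.base + rank G x)      ≡⟨ cong suc (sym (F.ranks x)) ⟩
    suc (rank X (F.to x))        ∎) ∷ embed-walk w
    where open ≡-Reasoning

  embed-tame : ∀ {N S} → Tame G N S → Tame X (F.base + F.base + N) (map F.to S)
  embed-tame {N} = map-decomp F.to λ { (chain {x} {P} {y} w e , fr) →
    chain (embed-walk w) (trans (cong₂ _+_ (F.ranks x) (F.ranks y))
                           (trans (+-exch F.base (rank G x) F.base (rank G y)) (cong (F.base + F.base +_) e)))
    , APP.map⁺ (AllPairs.map (λ { (apart s) → apart (F.seps _ _ s) }) fr) }

quad : ∀ {X} (A : Full X) → Full.middle A ≡ [] →
       Σ (Embed (Grid 4) X) λ f → map (Embed.to f) (allFin 4) ≡ Full.points A
                                × Full.total A ≡ Embed.base f + Embed.base f + 3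
quad record { walk = _ ∷ _ } ()
quad {X} record { first = a ; second = b ; third = c ; last = d ; enter = s ; next = t ; walk = [] ; leave = u
                ; low = apart ab ∷ apart ac ∷ [] ; inner = (apart bc ∷ []) ∷ _ ; high = apart bd ∷ apart cd ∷ [] } _ =
  record { to = f ; base = rank X a ; ranks = ranked ; mono = rising ; seps = apartness } , refl
  , trans (cong (rank X a +_) (ranked 3F)) (sym (+-assoc (rank X a) (rank X a) 3))
  where
  f : Fin 4 → Pt X
  f 0F = a
  f 1F = b
  f 2F = c
  f 3F = d
  ranked : ∀ i → rank X (f i) ≡ rank X a + toℕ i
  ranked 0F = sym (+-identityʳ _)
  ranked 1F = trans (up s) (+-comm 1 _)
  ranked 2F = trans (trans (up t) (cong suc (up s))) (+-comm 2 _)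
  ranked 3F = trans (trans (up u) (cong suc (trans (up t) (cong suc (up s))))) (+-comm 3 _)
  rising : ∀ i j → Below (Grid 4) i j → Below X (f i) (f j)
  rising 0F 0F _ = Below-refl X
  rising 0F 1F _ = below s
  rising 0F 2F ()
  rising 0F 3F ()
  rising 1F 0F ()
  rising 1F 1F _ = Below-refl X
  rising 1F 2F _ = below t
  rising 1F 3F ()
  rising 2F 0F ()
  rising 2F 1F ()
  rising 2F 2F _ = Below-refl X
  rising 2F 3F _ = below u
  rising 3F 0F ()
  rising 3F 1F ()
  rising 3F 2F ()
  rising 3F 3F _ = Below-refl X
  apartness : ∀ i j → Sep (Grid 4) i j → Sep X (f i) (f j)
  apartness 0F 0F ()
  apartness 0F 1F _ = ab
  apartness 0F 2F _ = ac
  apartness 0F 3F ()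
  apartness 1F 0F ()
  apartness 1F 1F ()
  apartness 1F 2F _ = bc
  apartness 1F 3F _ = bd
  apartness 2F 0F ()
  apartness 2F 1F ()
  apartness 2F 2F ()
  apartness 2F 3F _ = cd
  apartness 3F 0F ()
  apartness 3F 1F ()
  apartness 3F 2F ()
  apartness 3F 3F ()

duo : ∀ {X} (D : Pair X) →
      Σ (Embed (Grid 2) X) λ f → map (Embed.to f) (allFin 2) ≡ Pair.points D
                               × Pair.total D ≡ Embed.base f + Embed.base f + 1
duo {X} (pair {a} {b} s (apart ab)) =
  record { to = f ; base = rank X a ; ranks = ranked ; mono = rising ; seps = apartness } , refl
  , trans (cong (rank X a +_) (ranked 1F)) (sym (+-assoc (rank X a) (rank X a) 1))
  where
  f : Fin 2 → Pt X
  f 0F = a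
  f 1F = b
  ranked : ∀ i → rank X (f i) ≡ rank X a + toℕ i
  ranked 0F = sym (+-identityʳ _)
  ranked 1F = trans (up s) (+-comm 1 _)
  rising : ∀ i j → Below (Grid 2) i j → Below X (f i) (f j)
  rising 0F 0F _ = Below-refl X
  rising 0F 1F _ = below s
  rising 1F 1F _ = Below-refl X
  rising 1F 0F ()
  apartness : ∀ i j → Sep (Grid 2) i j → Sep X (f i) (f j)
  apartness 0F 1F _ = ab
  apartness 0F 0F ()
  apartness 1F 0F ()
  apartness 1F 1F ()

map-rect : ∀ {A A′ B B′ : Set} (f : A → A′) (g : B → B′) (P : List A) (Q : List B) →
           map (λ (x , y) → f x , g y) (rect P Q) ≡ rect (map f P) (map g Q)
map-rect f g []      Q = refl
map-rect f g (p ∷ P) Q = trans (map-++ _ (col p Q) (rect P Q))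
  (cong₂ _++_ (trans (sym (map-∘ Q)) (map-∘ Q)) (map-rect f g P Q))

module _ {X Y Z W : Space} (A : Full X) (B : Full Y) (C : Full Z) (D : Pair W) where

  three-quads : Full.middle A ≡ [] → Full.middle B ≡ [] → Full.middle C ≡ [] →
    Tame (X ⊗ Y ⊗ Z ⊗ W) (Full.total A + Full.total B + Full.total C + Pair.total D)
         (rect (rect (rect (Full.points A) (Full.points B)) (Full.points C)) (Pair.points D))
  three-quads a b c with f , eqA , tA ← quad A a | g , eqB , tB ← quad B b | h , eqC , tC ← quad C c | k , eqD , tD ← duo D =
    retotal total (recover (↭-reflexive points) (embed-tame (((f ⊗ᵉ g) ⊗ᵉ h) ⊗ᵉ k) table-tame))
    where
    open Embed using (base)
    I = allFin 4
    points : map (Embed.to (((f ⊗ᵉ g) ⊗ᵉ h) ⊗ᵉ k)) cells ≡ _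
    points = trans (map-rect (Embed.to ((f ⊗ᵉ g) ⊗ᵉ h)) (Embed.to k) (rect (rect I I) I) (allFin 2))
      (cong₂ rect (trans (map-rect (Embed.to (f ⊗ᵉ g)) (Embed.to h) (rect I I) I)
        (cong₂ rect (trans (map-rect (Embed.to f) (Embed.to g) I I) (cong₂ rect eqA eqB)) eqC)) eqD)
    total : base f + base g + base h + base k + (base f + base g + base h + base k) + 10
            ≡ Full.total A + Full.total B + Full.total C + Pair.total D
    total rewrite tA | tB | tC | tD =
      solve 4 (λ a b c d → a :+ b :+ c :+ d :+ (a :+ b :+ c :+ d) :+ con 10
                 := a :+ a :+ con 3 :+ (b :+ b :+ con 3) :+ (c :+ c :+ con 3) :+ (d :+ d :+ con 1)) refl
        (base f) (base g) (base h) (base k)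

-- Products of four lines

-- The inequality rules out five points: a full factor has four, the case for the table, or at least
-- six, the case for `three-full-pair`.
data Factor (X : Space) : Set where
  thin : (ℓ : Line X) → 2 ≤ length (Line.points ℓ) → Factor X
  full : (F : Full X) → length (Full.middle F) ≢ 1 → Factor X

module _ {X : Space} where

  points : Factor X → List (Pt X)
  points (thin ℓ _) = Line.points ℓ
  points (full F _) = Full.points F

  size : Factor X → ℕ
  size (thin ℓ _) = Line.total ℓ
  size (full F _) = Full.total F

-- The lines that neutralise the jump of every full factor. Those with three or more points do so by
-- a closed zigzag; a pair does so if one of its heights tolerates jumps.
Robust : ∀ {X} → Line X → Set₁
Robust {X} ℓ = ∀ {V} (A : Full V) → Tame (V ⊗ X) (Full.total A + Line.total ℓ) (rect (Full.points A) (Line.points ℓ))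

robust-long : ∀ {X} (ℓ : Line X) → 3 ≤ length (Line.points ℓ) → Robust ℓ
robust-long {X} ℓ 3≤ {V} A with R , eq , t , i ← toRim ℓ 3≤ =
  subst₂ (λ M S → Tame (V ⊗ X) (Full.total A + M) (rect (Full.points A) S)) t eq (zigzag-tame (rim A) R (inj₂ i))

robust-pair : ∀ {X} (D : Pair X) → Apart X (Pair.fst D) (Pair.fst D) ⊎ Apart X (Pair.snd D) (Pair.snd D) →
              Robust (Pair.asLine D)
robust-pair D (inj₁ i) A = slack-low A D i
robust-pair D (inj₂ i) A = slack-high A D i

Solved : ∀ {X Y Z W} → Factor X → Factor Y → Factor Z → Factor W → Set
Solved {X} {Y} {Z} {W} f g h k =
  Tame (X ⊗ Y ⊗ Z ⊗ W) (size f + size g + size h + size k)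
       (rect (rect (rect (points f) (points g)) (points h)) (points k))

module _ {X Y Z W : Space} (f : Factor X) (g : Factor Y) (h : Factor Z) (k : Factor W) where

  swap₁₂ : Solved g f h k → Solved f g h k
  swap₁₂ = retotal (cong (λ n → n + size h + size k) (+-comm (size g) (size f)))
    ∘ mapˡ-tame {Y = W} (mapˡʰ {Y ⊗ X} {Z} {X ⊗ Y} swapʰ)
        (↭-trans (↭-reflexive (map-rectˡ swap (rect (points g) (points f)) (points h)))
                 (rect-congˡ (points h) (rect-swap (points g) (points f))))

  swap₂₃ : Solved f h g k → Solved f g h k
  swap₂₃ = retotal (cong (_+ size k) (solve 3 (λ a b c → a :+ c :+ b := a :+ b :+ c) refl (size f) (size g) (size h)))
    ∘ mapˡ-tame exchangeʰ (rect-exchange (points f) (points h) (points g))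

  swap₃₄ : Solved f g k h → Solved f g h k
  swap₃₄ = retotal (solve 3 (λ a b c → a :+ c :+ b := a :+ b :+ c) refl (size f + size g) (size h) (size k))
    ∘ exchange-tame {P = rect (points f) (points g)} {points k} {points h}

  -- Excludes the two configurations in which jumps must be tolerated: four full factors, for which
  -- `four-full` has its own exceptions, and a single full factor unless one of the three lines is
  -- robust.
  Admissible : Set₁
  Admissible = admissible f g h k
    where
    admissible : Factor X → Factor Y → Factor Z → Factor W → Set₁
    admissible (full _ _) (full _ _) (full _ _) (full _ _) = Lift _ Empty
    admissible (full _ _) (thin b _) (thin c _) (thin d _) = Robust b ⊎ Robust c ⊎ Robust d
    admissible (thin a _) (full _ _) (thin c _) (thin d _) = Robust a ⊎ Robust c ⊎ Robust d
    admissible (thin a _) (thin b _) (full _ _) (thin d _) = Robust a ⊎ Robust b ⊎ Robust d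
    admissible (thin a _) (thin b _) (thin c _) (full _ _) = Robust a ⊎ Robust b ⊎ Robust c
    admissible _ _ _ _ = Lift _ Unit

module _ {X Y Z W : Space} where

  -- The robust line is multiplied with the full factor first; the result is jump-free, and the
  -- other two lines follow in hooks.
  one-full : (A : Full X) (a : _) (b : Line Y) (β : _) (c : Line Z) (γ : _) (d : Line W) (δ : _) →
             Robust b ⊎ Robust c ⊎ Robust d → Solved (full A a) (thin b β) (thin c γ) (thin d δ)
  one-full A a b β c γ d δ (inj₁ r) = (r A ⊛ c) ⊛ d
  one-full A a b β c γ d δ (inj₂ (inj₁ r)) =
    swap₂₃ (full A a) (thin b β) (thin c γ) (thin d δ) ((r A ⊛ b) ⊛ d)
  one-full A a b β c γ d δ (inj₂ (inj₂ r)) =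
    swap₃₄ (full A a) (thin b β) (thin c γ) (thin d δ)
      (swap₂₃ (full A a) (thin b β) (thin d δ) (thin c γ) ((r A ⊛ b) ⊛ c))

  two-full : (A : Full X) (a : _) (B : Full Y) (b : _) (c : Line Z) (γ : _) (d : Line W) (δ : _) →
             Solved (full A a) (full B b) (thin c γ) (thin d δ)
  two-full A a B b c γ d δ = times A B c γ ⊛ d

wide-middle : ∀ {X} (A : Full X) → length (Full.middle A) ≢ 1 → Full.middle A ≡ [] ⊎ 2 ≤ length (Full.middle A)
wide-middle A odd with Full.middle A
... | []        = inj₁ refl
... | _ ∷ []    = ⊥-elim (odd refl)
... | _ ∷ _ ∷ _ = inj₂ (s≤s (s≤s z≤n))

module _ {X Y Z W : Space} (A : Full X) (B : Full Y) (C : Full Z) where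

  regroup : ∀ {M} S → Tame (X ⊗ Y ⊗ (Z ⊗ W)) (Full.total A + Full.total B + (Full.total C + M))
                       (rect (rect (Full.points A) (Full.points B)) (rect (Full.points C) S)) →
            Tame (X ⊗ Y ⊗ Z ⊗ W) (Full.total A + Full.total B + Full.total C + M)
                 (rect (rect (rect (Full.points A) (Full.points B)) (Full.points C)) S)
  regroup S = retotal (sym (+-assoc (Full.total A + Full.total B) _ _))
            ∘ unassoc-tame {P = rect (Full.points A) (Full.points B)} {Full.points C} {S}

-- Against a pair, a full factor with six points is moved to the front; if there is none, all three
-- have four points and the table applies.
three-full : ∀ {X Y Z W} (A : Full X) (a : _) (B : Full Y) (b : _) (C : Full Z) (c : _)
             (d : Line W) (δ : 2 ≤ length (Line.points d)) →
             Solved (full A a) (full B b) (full C c) (thin d δ)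
three-full A a B b C c (line [] _) (s≤s ())
three-full A a B b C c d@(line (_ ∷ _ ∷ _) _) δ =
  regroup A B C (Line.points d) (three-full-long A B C d (s≤s (s≤s (s≤s z≤n))))
three-full A a B b C c d@(line (s ∷ []) ((i ∷ []) ∷ _)) δ
  with wide-middle A a | wide-middle B b | wide-middle C c
... | inj₂ 2≤ | _ | _ = regroup A B C (Line.points d) (three-full-pair A B C (pair s i) 2≤)
... | inj₁ _ | inj₂ 2≤ | _ = swap₁₂ (full A a) (full B b) (full C c) (thin d δ)
                               (regroup B A C (Line.points d) (three-full-pair B A C (pair s i) 2≤))
... | inj₁ _ | inj₁ _ | inj₂ 2≤ =
  swap₂₃ (full A a) (full B b) (full C c) (thin d δ)
    (swap₁₂ (full A a) (full C c) (full B b) (thin d δ)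
      (regroup C A B (Line.points d) (three-full-pair C A B (pair s i) 2≤)))
... | inj₁ e | inj₁ e′ | inj₁ e″ = three-quads A B C (pair s i) e e′ e″

cuboid : ∀ {X Y Z W} (f : Factor X) (g : Factor Y) (h : Factor Z) (k : Factor W) →
         Admissible f g h k → Solved f g h k
cuboid (full _ _) (full _ _) (full _ _) (full _ _) (lift ())
cuboid (thin a _) (thin b _) (thin c _) (thin d _) _ = ((a ⊠ b) ⊛ c) ⊛ d
cuboid (full A a) (thin b β) (thin c γ) (thin d δ) r = one-full A a b β c γ d δ r
cuboid f@(thin a α) g@(full B b) h@(thin c γ) k@(thin d δ) r = swap₁₂ f g h k (one-full B b a α c γ d δ r)
cuboid f@(thin a α) g@(thin b β) h@(full C c) k@(thin d δ) r =
  swap₂₃ f g h k (swap₁₂ f h g k (one-full C c a α b β d δ r))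
cuboid f@(thin a α) g@(thin b β) h@(thin c γ) k@(full D d) r =
  swap₃₄ f g h k (swap₂₃ f g k h (swap₁₂ f k g h (one-full D d a α b β c γ r)))
cuboid (full A a) (full B b) (thin c γ) (thin d δ) _ = two-full A a B b c γ d δ
cuboid f@(full A a) g@(thin b β) h@(full C c) k@(thin d δ) _ = swap₂₃ f g h k (two-full A a C c b β d δ)
cuboid f@(full A a) g@(thin b β) h@(thin c γ) k@(full D d) _ =
  swap₃₄ f g h k (swap₂₃ f g k h (two-full A a D d b β c γ))
cuboid f@(thin a α) g@(full B b) h@(full C c) k@(thin d δ) _ =
  swap₁₂ f g h k (swap₂₃ g f h k (two-full B b C c a α d δ))
cuboid f@(thin a α) g@(full B b) h@(thin c γ) k@(full D d) _ =
  swap₁₂ f g h k (swap₃₄ g f h k (swap₂₃ g f k h (two-full B b D d a α c γ)))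
cuboid f@(thin a α) g@(thin b β) h@(full C c) k@(full D d) _ =
  swap₂₃ f g h k (swap₁₂ f h g k (swap₃₄ h f g k (swap₂₃ h f k g (two-full C c D d a α b β))))
cuboid (full A a) (full B b) (full C c) (thin d δ) _ = three-full A a B b C c d δ
cuboid f@(full A a) g@(full B b) h@(thin c γ) k@(full D d) _ = swap₃₄ f g h k (three-full A a B b D d c γ)
cuboid f@(full A a) g@(thin b β) h@(full C c) k@(full D d) _ =
  swap₂₃ f g h k (swap₃₄ f h g k (three-full A a C c D d b β))
cuboid f@(thin a α) g@(full B b) h@(full C c) k@(full D d) _ =
  swap₁₂ f g h k (swap₂₃ g f h k (swap₃₄ g h f k (three-full B b C c D d a α)))

-- Ranks along walks

module _ {A : Set} {R : A → A → Set} {Q : A → Set} where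

  AP-with : ∀ {xs} → AllPairs R xs → All Q xs → AllPairs (λ u v → R u v × Q u × Q v) xs
  AP-with []       []       = []
  AP-with (r ∷ rs) (q ∷ qs) = All.zipWith (λ (r , q′) → r , q , q′) (r , qs) ∷ AP-with rs qs

module _ {X : Space} where

  walk-≤ : ∀ {x P y} → Walk X x P y → rank X x ≤ rank X y
  walk-≤ []            = ≤-refl
  walk-≤ {x} (step _ e ∷ w) = ≤-trans (subst (rank X x ≤_) (sym e) (n≤1+n _)) (walk-≤ w)

  walk-≤last : ∀ {x P y} → Walk X x P y → All (λ u → rank X u ≤ rank X y) (x ∷ P)
  walk-≤last w@[]      = walk-≤ w ∷ []
  walk-≤last w@(_ ∷ v) = walk-≤ w ∷ walk-≤last v

  walk-first< : ∀ {x P y} → Walk X x P y → All (λ u → rank X x < rank X u) P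
  walk-first< []              = []
  walk-first< (step _ e ∷ w) =
    ≤-reflexive (sym e) ∷ All.map (<-trans (≤-reflexive (sym e))) (walk-first< w)

  walk-< : ∀ {x P y} → Walk X x P y → AllPairs (λ u v → rank X u < rank X v) (x ∷ P)
  walk-< []          = [] ∷ []
  walk-< w@(_ ∷ v) = walk-first< w ∷ walk-< v

  walk-length : ∀ {x P y} → Walk X x P y → rank X y ≡ rank X x + length P
  walk-length []               = sym (+-identityʳ _)
  walk-length {P = _ ∷ P} (step _ e ∷ w) =
    trans (walk-length w) (trans (cong (_+ length P) e) (sym (+-suc _ _)))

  -- Of two points in ascending order, either the lower one is above the start or the upper one is
  -- below the end, except for the two ends themselves; this exception is the one pair a full line
  -- leaves open.
  full-walk : ∀ {x P z} → Walk X x P z → 3 ≤ length P →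
    (∀ {u v} → rank X u < rank X v → rank X x < rank X u ⊎ rank X v < rank X z → Sep X u v) →
    Σ (Full X) λ F → Full.points F ≡ x ∷ P × Full.first F ≡ x × Full.last F ≡ z
  full-walk (_ ∷ []) (s≤s ()) _
  full-walk (_ ∷ _ ∷ []) (s≤s (s≤s ())) _
  full-walk {x} {z = z} (_∷_ {a} s (_∷_ {b} t w@(_ ∷ _))) _ sep with unsnoc w
  ... | M , y , eq , w′ , u = record
    { enter = s ; next = t ; walk = w′ ; leave = u
    ; low   = All.zipWith (λ (x<v , v<z) → apart (sep x<v (inj₂ v<z))) (AllPairs.head below′ , <z)
    ; inner = AllPairs.map (λ (u<v , _ , v<z) → apart (sep u<v (inj₂ v<z))) (AP-with (AllPairs.tail below′) <z)
    ; high  = All.zipWith (λ (x<v , v<z) → apart (sep v<z (inj₁ x<v))) (AllPairs.head below′ , <z) }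
    , cong (λ P → x ∷ a ∷ b ∷ P) (sym eq) , refl , refl
    where
    v = s ∷ t ∷ w′
    below′ = walk-< v
    <z : All (λ v → rank X v < rank X z) (a ∷ b ∷ M)
    <z = All.map (λ v≤y → ≤-<-trans v≤y (≤-reflexive (sym (up u)))) (All.tail (walk-≤last v))

-- Chains of the cube

-- `Sep` lists exactly the pairs that chains of two almost orthogonal decompositions cannot share,
-- see `inseparable`.
Cube : ℕ → Space
Cube n .Pt         = Subset n
Cube n .rank       = ∣_∣
Cube n .Below      = _⊆_
Cube n .Below-refl = ⊆-refl
Cube n .Sep x y    = x ≢ y × ¬ (x ≡ ⊥ × y ≡ ⊤) × ¬ (x ≡ ⊤ × y ≡ ⊥)

∣p∣≡0⇒p≡⊥ : ∀ {n} (p : Subset n) → ∣ p ∣ ≡ 0 → p ≡ ⊥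
∣p∣≡0⇒p≡⊥ []            _ = refl
∣p∣≡0⇒p≡⊥ (outside ∷ p) e = cong (outside ∷_) (∣p∣≡0⇒p≡⊥ p e)

cube-sep : ∀ {n} {x y : Subset n} → ∣ x ∣ < ∣ y ∣ → 0 < ∣ x ∣ ⊎ ∣ y ∣ < n → Sep (Cube n) x y
cube-sep {n} {x} {y} x<y i = (λ { refl → <-irrefl refl x<y }) , ¬⊥⊤ i , ¬⊤⊥
  where
  ¬⊥⊤ : 0 < ∣ x ∣ ⊎ ∣ y ∣ < n → ¬ (x ≡ ⊥ × y ≡ ⊤)
  ¬⊥⊤ (inj₁ 0<x) (refl , _) = <-irrefl (sym (∣⊥∣≡0 n)) 0<x
  ¬⊥⊤ (inj₂ y<n) (_ , refl) = <-irrefl (∣⊤∣≡n n) y<n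
  ¬⊤⊥ : ¬ (x ≡ ⊤ × y ≡ ⊥)
  ¬⊤⊥ (refl , refl) = contradiction x<y (<⇒≱ (s≤s (subst (_≤ ∣ ⊤ {n} ∣) (sym (∣⊥∣≡0 n)) z≤n)))

data Reading {n : ℕ} : Chain n → Set where
  thin : (ℓ : Line (Cube n)) → 2 ≤ length (Line.points ℓ) → Line.total ℓ ≡ n →
         ¬ (⊥ ∈ Line.points ℓ × ⊤ ∈ Line.points ℓ) → Reading (Line.points ℓ)
  full : (F : Full (Cube n)) → length (Full.middle F) ≢ 1 → Full.total F ≡ n →
         Full.first F ≡ ⊥ → Full.last F ≡ ⊤ → Reading (Full.points F)

module _ {n : ℕ} where

  cube-walk : ∀ (x : Subset n) P r → Linked _⊆_ (x ∷ P) →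
              (∀ (i : Fin (length (x ∷ P))) → ∣ lookup (x ∷ P) i ∣ ≡ r + toℕ i) → ∃ (Walk (Cube n) x P)
  cube-walk x []      r _       ranked = x , []
  cube-walk x (y ∷ P) r (l ∷ L) ranked =
    let z , w = cube-walk y P (suc r) L (λ i → trans (ranked (Fin.suc i)) (+-suc r (toℕ i)))
    in z , step l (trans (ranked 1F) (trans (+-suc r 0) (cong suc (sym (ranked 0F))))) ∷ w

odd≢even : ∀ n j → Odd n → n ≢ j + j
odd≢even n j odd refl with trans (sym (m*n%n≡0 j 2)) (trans (cong (_% 2) eq) odd)
  where
  eq : j * 2 ≡ j + j
  eq = solve 1 (λ j → j Data.Nat.Solver.+-*-Solver.:* con 2 := j :+ j) refl j
... | ()

-- The chain has n + 1 points, four more than `middle`; a middle of length 1 would mean n = 4, which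
-- is even.
read-full : ∀ {n} {x z : Subset n} {P} → 3 ≤ n → Odd n → Walk (Cube n) x P z → ∣ x ∣ ≡ 0 → length P ≡ n →
            Reading (x ∷ P)
read-full {n} {x} {z} {P} 3≤ odd w ∣x∣ len with full-walk w (subst (3 ≤_) (sym len) 3≤) sep
  where
  ∣z∣ : ∣ z ∣ ≡ n
  ∣z∣ = trans (walk-length w) (trans (cong (_+ length P) ∣x∣) len)
  sep : ∀ {u v : Subset n} → ∣ u ∣ < ∣ v ∣ → ∣ x ∣ < ∣ u ∣ ⊎ ∣ v ∣ < ∣ z ∣ → Sep (Cube n) u v
  sep u<v (inj₁ x<u) = cube-sep u<v (inj₁ (≤-<-trans z≤n x<u))
  sep u<v (inj₂ v<z) = cube-sep u<v (inj₂ (subst (_ <_) ∣z∣ v<z))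
... | F , refl , refl , refl =
  full F (λ e → four (trans (sym len) (cong (λ k → suc (suc k)) (trans (length-++ (Full.middle F)) (cong (_+ 1) e)))))
       (cong₂ _+_ ∣x∣ ∣z∣) (∣p∣≡0⇒p≡⊥ _ ∣x∣) (∣p∣≡n⇒p≡⊤ ∣z∣)
  where
  ∣z∣ : ∣ z ∣ ≡ n
  ∣z∣ = trans (walk-length w) (trans (cong (_+ length P) ∣x∣) len)
  even4 : ¬ Odd 4
  even4 ()
  four : n ≢ 4
  four refl = even4 odd

-- The smallest size j decides: for j = 0 the chain runs from the empty to the whole set, for j > 0
-- it misses the empty set and hence has no jump.
read : ∀ {n} {A : Chain n} → 3 ≤ n → Odd n → IsSymChain n A → Reading A
read {n} {[]} _ _ (j , 2j≤n , len , _) = ⊥-elim (1+n≰n (subst (_≤ n) len 2j≤n))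
read {n} {x ∷ P} 3≤ odd (zero , _ , len , ranked , L) with cube-walk x P 0 L ranked
... | z , w = read-full 3≤ odd w (ranked 0F) (suc-injective (trans (sym (trans (+-identityʳ _) (+-identityʳ _))) len))
read {n} {x ∷ P} 3≤ odd (suc j , _ , len , ranked , L) with cube-walk x P (suc j) L ranked
... | z , w = thin (line w jumpless) (two P len) total (λ (⊥∈ , _) → <-irrefl (sym (∣⊥∣≡0 n)) (All.lookup positive ⊥∈))
  where
  positive : All (λ u → 0 < ∣ u ∣) (x ∷ P)
  positive = x>0 ∷ All.map (<-trans x>0) (walk-first< w)
    where
    x>0 : 0 < ∣ x ∣
    x>0 = subst (0 <_) (sym (trans (ranked 0F) (+-identityʳ _))) (s≤s z≤n)
  jumpless : Free (Cube n) (x ∷ P)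
  jumpless = AllPairs.map (λ (u<v , 0<u , _) → apart (cube-sep u<v (inj₁ 0<u))) (AP-with (walk-< w) positive)
  -- A chain with one point would lie in a middle level, whose existence makes n even.
  two : ∀ P → length (x ∷ P) + suc j + suc j ≡ suc n → 2 ≤ length (x ∷ P)
  two []      e = ⊥-elim (odd≢even n (suc j) odd (sym (suc-injective e)))
  two (_ ∷ _) _ = s≤s (s≤s z≤n)
  total : ∣ x ∣ + ∣ z ∣ ≡ n
  total = trans (cong₂ _+_ ∣x∣ (trans (walk-length w) (cong (_+ length P) ∣x∣)))
    (suc-injective (trans (solve 2 (λ j l → con 1 :+ (j :+ (j :+ l)) := (con 1 :+ l) :+ j :+ j) refl (suc j) (length P)) len))
    where
    ∣x∣ : ∣ x ∣ ≡ suc j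
    ∣x∣ = trans (ranked 0F) (+-identityʳ _)

-- Exceptions inside one cuboid

loosen-step : ∀ {X E x y} → Step X x y → Step (Loosen X E) x y
loosen-step (step l r) = step l r

loosen-apart : ∀ {X E x y} → Apart X x y → Apart (Loosen X E) x y
loosen-apart (apart s) = apart (inj₁ s)

loosen-walk : ∀ {X E x P y} → Walk X x P y → Walk (Loosen X E) x P y
loosen-walk []      = []
loosen-walk (s ∷ w) = loosen-step s ∷ loosen-walk w

tighten-walk : ∀ {X E x P y} → Walk (Loosen X E) x P y → Walk X x P y
tighten-walk []               = []
tighten-walk (step l r ∷ w) = step l r ∷ tighten-walk w

loosen-line : ∀ {X E} → Line X → Line (Loosen X E)
loosen-line (line w f) = line (loosen-walk w) (AllPairs.map loosen-apart f)

loosen-full : ∀ {X E} → Full X → Full (Loosen X E)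
loosen-full F = record
  { enter = loosen-step enter ; next = loosen-step next ; walk = loosen-walk walk ; leave = loosen-step leave
  ; low = All.map loosen-apart low ; inner = AllPairs.map loosen-apart inner ; high = All.map loosen-apart high }
  where open Full F

within : ∀ {A : Set} {Ψ : List A → Set} {S} → Decomp Ψ S → Decomp (λ P → Ψ P × All (_∈ S) P) S
within {S = S} (decomp C ψ c) = decomp C (All.zip (ψ , AllP.concat⁻ (All.tabulate (∈-resp-↭ c)))) c

-- All chains stay inside `S`, so a tolerated pair has to be justified again only for points of `S`.
exchange-exceptions : ∀ {X N S} {E E′ : Pt X → Pt X → Set} →
  (∀ {x y} → x ∈ S → y ∈ S → E x y → Sep X x y ⊎ E′ x y) →
  Tame (Loosen X E) N S → Tame (Loosen X E′) N S
exchange-exceptions {X} f = relax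
  (λ { ((chain w e , fr) , ∈S) → chain (loosen-walk (tighten-walk w)) e
     , AllPairs.map (λ { (apart (inj₁ s) , _)     → apart (inj₁ s)
                       ; (apart (inj₂ e) , x , y) → apart (f x y e) }) (AP-with fr ∈S) })
  ∘ within

-- The exceptions are diagonal: a point with `g x` counts as apart from itself, so jumps of the
-- other coordinates are tolerated there.
Guarded : (n : ℕ) → (Subset n → Set) → Space
Guarded n g = Loosen (Cube n) λ x y → x ≡ y × g x

-- The condition bites on two-point chains, the ones that `robust-long` does not reach. For a good
-- family `g` singles out the tail of the edge.
Marked : ∀ {n} → (Subset n → Set) → Chain n → Set
Marked g A = ∀ x y → A ≡ x ∷ y ∷ [] → g x ⊎ g y

robust-marked : ∀ {n g} (ℓ : Line (Cube n)) → 2 ≤ length (Line.points ℓ) → Marked g (Line.points ℓ) →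
                Robust {Guarded n g} (loosen-line ℓ)
robust-marked (line [] _) (s≤s ()) _
robust-marked (line (s ∷ []) ((i ∷ []) ∷ _)) _ mark =
  robust-pair (pair (loosen-step s) (loosen-apart i))
    (Sum.map (λ g → apart (inj₂ (refl , g))) (λ g → apart (inj₂ (refl , g))) (mark _ _ refl))
robust-marked ℓ@(line (_ ∷ _ ∷ _) _) _ _ = robust-long (loosen-line ℓ) (s≤s (s≤s (s≤s z≤n)))

-- Three thin chains next to a full fourth one. `E a b c` will say that the fourth coordinate may
-- jump while the other three rest at `a`, `b`, `c`.
record Guard {m n p} (A : Chain m) (B : Chain n) (C : Chain p)
             (E : Subset m → Subset n → Subset p → Set) : Set₁ where
  field
    gᵃ     : Subset m → Set
    gᵇ     : Subset n → Set
    gᶜ     : Subset p → Set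
    marked : Marked gᵃ A ⊎ Marked gᵇ B ⊎ Marked gᶜ C
    allow  : ∀ {a b c} → gᵃ a ⊎ gᵇ b ⊎ gᶜ c → E a b c

Four : ∀ {A B C D : Set} → List A → List B → List C → List D → List (((A × B) × C) × D)
Four P Q R S = rect (rect (rect P Q) R) S

module _ (m n p q : ℕ) where

  Cube⁴ : Space
  Cube⁴ = Cube m ⊗ Cube n ⊗ Cube p ⊗ Cube q

  Pt⁴ : Set
  Pt⁴ = ((Subset m × Subset n) × Subset p) × Subset q

-- What a relation of tolerated jumps must contain for the cuboid to be solvable: `corner` and
-- `inner` serve four full chains, `alone₁` to `alone₄` a single full one in the respective
-- coordinate.
record Allowance {m n p q} (A : Chain m) (B : Chain n) (C : Chain p) (D : Chain q)
                 (E : Pt⁴ m n p q → Pt⁴ m n p q → Set) : Set₁ where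
  field
    corner : E (((⊥ , ⊥) , ⊥) , ⊥) (((⊤ , ⊤) , ⊤) , ⊤)
    inner  : ∀ {a a′ b} → b ∈ B → b ≢ ⊥ → b ≢ ⊤ → ⊥ ∈ B → ⊤ ∈ B →
             E (((a , b) , ⊥) , ⊥) (((a′ , b) , ⊤) , ⊤)
    alone₁ : Guard B C D λ b c d → ∀ {a a′} → E (((a , b) , c) , d) (((a′ , b) , c) , d)
    alone₂ : Guard A C D λ a c d → ∀ {b b′} → E (((a , b) , c) , d) (((a , b′) , c) , d)
    alone₃ : Guard A B D λ a b d → ∀ {c c′} → E (((a , b) , c) , d) (((a , b) , c′) , d)
    alone₄ : Guard A B C λ a b c → ∀ {d d′} → E (((a , b) , c) , d) (((a , b) , c) , d′)

thin-sep : ∀ {n} {A : Chain n} {x y} → ¬ (⊥ ∈ A × ⊤ ∈ A) → x ∈ A → y ∈ A → Sep (Cube n) x y ⊎ x ≡ y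
thin-sep {x = x} {y} ¬both x∈ y∈ with x ≟S y
... | yes x≡y = inj₂ x≡y
... | no x≢y  = inj₁ (x≢y , (λ { (refl , refl) → ¬both (x∈ , y∈) }) , (λ { (refl , refl) → ¬both (y∈ , x∈) }))

module _ {m n p q : ℕ} where

  Guards : (Subset m → Set) → (Subset n → Set) → (Subset p → Set) → (Subset q → Set) →
           Pt⁴ m n p q → Pt⁴ m n p q → Set
  Guards gᵃ gᵇ gᶜ gᵈ (((a , b) , c) , d) (((a′ , b′) , c′) , d′) =
    ((a ≡ a′ × gᵃ a) ⊎ (b ≡ b′ × gᵇ b)) ⊎ (c ≡ c′ × gᶜ c) ⊎ (d ≡ d′ × gᵈ d)

  guardʰ : ∀ {gᵃ gᵇ gᶜ gᵈ} → Hom (Guarded m gᵃ ⊗ Guarded n gᵇ ⊗ Guarded p gᶜ ⊗ Guarded q gᵈ)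
                                  (Loosen (Cube⁴ m n p q) (Guards gᵃ gᵇ gᶜ gᵈ))
  guardʰ .to x    = x
  guardʰ .ranks x = refl
  guardʰ .mono l  = l
  guardʰ .seps (inj₁ (inj₁ (inj₁ (inj₁ s)))) = inj₁ (inj₁ (inj₁ (inj₁ s)))
  guardʰ .seps (inj₁ (inj₁ (inj₁ (inj₂ e)))) = inj₂ (inj₁ (inj₁ e))
  guardʰ .seps (inj₁ (inj₁ (inj₂ (inj₁ s)))) = inj₁ (inj₁ (inj₁ (inj₂ s)))
  guardʰ .seps (inj₁ (inj₁ (inj₂ (inj₂ e)))) = inj₂ (inj₁ (inj₂ e))
  guardʰ .seps (inj₁ (inj₂ (inj₁ s)))        = inj₁ (inj₁ (inj₂ s))
  guardʰ .seps (inj₁ (inj₂ (inj₂ e)))        = inj₂ (inj₂ (inj₁ e))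
  guardʰ .seps (inj₂ (inj₁ s))               = inj₁ (inj₂ s)
  guardʰ .seps (inj₂ (inj₂ e))               = inj₂ (inj₂ (inj₂ e))

  guard-tame : ∀ {gᵃ gᵇ gᶜ gᵈ N S} → Tame (Guarded m gᵃ ⊗ Guarded n gᵇ ⊗ Guarded p gᶜ ⊗ Guarded q gᵈ) N S →
               Tame (Loosen (Cube⁴ m n p q) (Guards gᵃ gᵇ gᶜ gᵈ)) N S
  guard-tame {S = S} = recover (↭-reflexive (map-id S)) ∘ map-tame guardʰ

  Four-∈ : ∀ {A B C D} {a b c d} → (((a , b) , c) , d) ∈ Four {Subset m} {Subset n} {Subset p} {Subset q} A B C D →
           a ∈ A × b ∈ B × c ∈ C × d ∈ D
  Four-∈ {A} {B} {C} {D} x∈ with ∈-cartesianProduct⁻ (rect (rect A B) C) D x∈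
  ... | x∈ , d∈ with ∈-cartesianProduct⁻ (rect A B) C x∈
  ... | x∈ , c∈ with ∈-cartesianProduct⁻ A B x∈
  ... | a∈ , b∈ = a∈ , b∈ , c∈ , d∈

  module _ {E : Pt⁴ m n p q → Pt⁴ m n p q → Set} where

    flattenʰ : Hom (Loosen (Cube m ⊗ Cube n ⊗ (Cube p ⊗ Cube q)) (λ x y → E (assocˡ x) (assocˡ y)))
                   (Loosen (Cube⁴ m n p q) E)
    flattenʰ .to               = assocˡ
    flattenʰ .ranks (x , c , d) = +-assoc (rank (Cube m ⊗ Cube n) x) ∣ c ∣ ∣ d ∣
    flattenʰ .mono             = assocˡ
    flattenʰ .seps             = Sum.map₁ Sum.assocˡ

    no-guard : ∀ {n} → Subset n → Set
    no-guard _ = Empty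

    private
      total : ∀ {a b c d} → a ≡ m → b ≡ n → c ≡ p → d ≡ q → a + b + c + d ≡ m + n + p + q
      total refl refl refl refl = refl

    resolve : ∀ {A B C D} → Reading A → Reading B → Reading C → Reading D → Allowance A B C D E →
              Tame (Loosen (Cube⁴ m n p q) E) (m + n + p + q) (Four A B C D)
    resolve (thin a α ta _) (thin b β tb _) (thin c γ tc _) (thin d δ td _) _ =
      loosen (retotal (total ta tb tc td) (cuboid (thin a α) (thin b β) (thin c γ) (thin d δ) (lift unit)))
    resolve (thin a α ta ¬a) (thin b β tb ¬b) (thin c γ tc ¬c) (full F odd t _ _) S =
      exchange-exceptions {S = T} allowed
        (retotal (total ta tb tc t) (guard-tame (cuboid (thin (loosen-line a) α) (thin (loosen-line b) β)
          (thin (loosen-line c) γ) (full (loosen-full F) odd) robust)))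
      where
      T = Four (Line.points a) (Line.points b) (Line.points c) (Full.points F)
      open Guard (Allowance.alone₄ S)
      robust = Sum.map (robust-marked a α) (Sum.map (robust-marked b β) (robust-marked c γ)) marked
      mark : ∀ {E0 E1 E2 E3 P Q R : Set} → ((E0 × P) ⊎ (E1 × Q)) ⊎ ((E2 × R) ⊎ (E3 × Empty)) → P ⊎ Q ⊎ R
      mark (inj₁ (inj₁ (_ , g))) = inj₁ g
      mark (inj₁ (inj₂ (_ , g))) = inj₂ (inj₁ g)
      mark (inj₂ (inj₁ (_ , g))) = inj₂ (inj₂ g)
      -- A guard tolerates a pair as soon as one marked coordinate rests. If another thin coordinate
      -- moves, the pair is separated there anyway; so only pairs with all three at rest draw on
      -- `E`.
      allowed : ∀ {x y} → x ∈ T → y ∈ T → Guards gᵃ gᵇ gᶜ no-guard x y → Sep (Cube⁴ m n p q) x y ⊎ E x y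
      allowed x∈ y∈ g with Four-∈ {Line.points a} {Line.points b} {Line.points c} {Full.points F} x∈ | Four-∈ {Line.points a} {Line.points b} {Line.points c} {Full.points F} y∈
      ... | a∈ , b∈ , c∈ , _ | a′∈ , b′∈ , c′∈ , _ with thin-sep ¬a a∈ a′∈ | thin-sep ¬b b∈ b′∈ | thin-sep ¬c c∈ c′∈
      ... | inj₁ s | _ | _ = inj₁ (inj₁ (inj₁ (inj₁ s)))
      ... | _ | inj₁ s | _ = inj₁ (inj₁ (inj₁ (inj₂ s)))
      ... | _ | _ | inj₁ s = inj₁ (inj₁ (inj₂ s))
      ... | inj₂ refl | inj₂ refl | inj₂ refl = inj₂ (allow (mark g))
    resolve (thin a α ta ¬a) (thin b β tb ¬b) (full F odd t _ _) (thin d δ td ¬d) S =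
      exchange-exceptions {S = T} allowed
        (retotal (total ta tb t td) (guard-tame (cuboid (thin (loosen-line a) α) (thin (loosen-line b) β)
          (full (loosen-full F) odd) (thin (loosen-line d) δ) robust)))
      where
      T = Four (Line.points a) (Line.points b) (Full.points F) (Line.points d)
      open Guard (Allowance.alone₃ S)
      robust = Sum.map (robust-marked a α) (Sum.map (robust-marked b β) (robust-marked d δ)) marked
      mark : ∀ {E0 E1 E2 E3 P Q R : Set} → ((E0 × P) ⊎ (E1 × Q)) ⊎ ((E2 × Empty) ⊎ (E3 × R)) → P ⊎ Q ⊎ R
      mark (inj₁ (inj₁ (_ , g))) = inj₁ g
      mark (inj₁ (inj₂ (_ , g))) = inj₂ (inj₁ g)
      mark (inj₂ (inj₂ (_ , g))) = inj₂ (inj₂ g)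
      allowed : ∀ {x y} → x ∈ T → y ∈ T → Guards gᵃ gᵇ no-guard gᶜ x y → Sep (Cube⁴ m n p q) x y ⊎ E x y
      allowed x∈ y∈ g with Four-∈ {Line.points a} {Line.points b} {Full.points F} {Line.points d} x∈ | Four-∈ {Line.points a} {Line.points b} {Full.points F} {Line.points d} y∈
      ... | a∈ , b∈ , _ , d∈ | a′∈ , b′∈ , _ , d′∈ with thin-sep ¬a a∈ a′∈ | thin-sep ¬b b∈ b′∈ | thin-sep ¬d d∈ d′∈
      ... | inj₁ s | _ | _ = inj₁ (inj₁ (inj₁ (inj₁ s)))
      ... | _ | inj₁ s | _ = inj₁ (inj₁ (inj₁ (inj₂ s)))
      ... | _ | _ | inj₁ s = inj₁ (inj₂ s)
      ... | inj₂ refl | inj₂ refl | inj₂ refl = inj₂ (allow (mark g))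
    resolve (thin a α ta _) (thin b β tb _) (full C γ tc _ _) (full D δ td _ _) _ =
      loosen (retotal (total ta tb tc td) (cuboid (thin a α) (thin b β) (full C γ) (full D δ) (lift unit)))
    resolve (thin a α ta ¬a) (full F odd t _ _) (thin c γ tc ¬c) (thin d δ td ¬d) S =
      exchange-exceptions {S = T} allowed
        (retotal (total ta t tc td) (guard-tame (cuboid (thin (loosen-line a) α) (full (loosen-full F) odd)
          (thin (loosen-line c) γ) (thin (loosen-line d) δ) robust)))
      where
      T = Four (Line.points a) (Full.points F) (Line.points c) (Line.points d)
      open Guard (Allowance.alone₂ S)
      robust = Sum.map (robust-marked a α) (Sum.map (robust-marked c γ) (robust-marked d δ)) marked
      mark : ∀ {E0 E1 E2 E3 P Q R : Set} → ((E0 × P) ⊎ (E1 × Empty)) ⊎ ((E2 × Q) ⊎ (E3 × R)) → P ⊎ Q ⊎ R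
      mark (inj₁ (inj₁ (_ , g))) = inj₁ g
      mark (inj₂ (inj₁ (_ , g))) = inj₂ (inj₁ g)
      mark (inj₂ (inj₂ (_ , g))) = inj₂ (inj₂ g)
      allowed : ∀ {x y} → x ∈ T → y ∈ T → Guards gᵃ no-guard gᵇ gᶜ x y → Sep (Cube⁴ m n p q) x y ⊎ E x y
      allowed x∈ y∈ g with Four-∈ {Line.points a} {Full.points F} {Line.points c} {Line.points d} x∈ | Four-∈ {Line.points a} {Full.points F} {Line.points c} {Line.points d} y∈
      ... | a∈ , _ , c∈ , d∈ | a′∈ , _ , c′∈ , d′∈ with thin-sep ¬a a∈ a′∈ | thin-sep ¬c c∈ c′∈ | thin-sep ¬d d∈ d′∈
      ... | inj₁ s | _ | _ = inj₁ (inj₁ (inj₁ (inj₁ s)))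
      ... | _ | inj₁ s | _ = inj₁ (inj₁ (inj₂ s))
      ... | _ | _ | inj₁ s = inj₁ (inj₂ s)
      ... | inj₂ refl | inj₂ refl | inj₂ refl = inj₂ (allow (mark g))
    resolve (thin a α ta _) (full B β tb _ _) (thin c γ tc _) (full D δ td _ _) _ =
      loosen (retotal (total ta tb tc td) (cuboid (thin a α) (full B β) (thin c γ) (full D δ) (lift unit)))
    resolve (thin a α ta _) (full B β tb _ _) (full C γ tc _ _) (thin d δ td _) _ =
      loosen (retotal (total ta tb tc td) (cuboid (thin a α) (full B β) (full C γ) (thin d δ) (lift unit)))
    resolve (thin a α ta _) (full B β tb _ _) (full C γ tc _ _) (full D δ td _ _) _ =
      loosen (retotal (total ta tb tc td) (cuboid (thin a α) (full B β) (full C γ) (full D δ) (lift unit)))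
    resolve (full F odd t _ _) (thin b β tb ¬b) (thin c γ tc ¬c) (thin d δ td ¬d) S =
      exchange-exceptions {S = T} allowed
        (retotal (total t tb tc td) (guard-tame (cuboid (full (loosen-full F) odd) (thin (loosen-line b) β)
          (thin (loosen-line c) γ) (thin (loosen-line d) δ) robust)))
      where
      T = Four (Full.points F) (Line.points b) (Line.points c) (Line.points d)
      open Guard (Allowance.alone₁ S)
      robust = Sum.map (robust-marked b β) (Sum.map (robust-marked c γ) (robust-marked d δ)) marked
      mark : ∀ {E0 E1 E2 E3 P Q R : Set} → ((E0 × Empty) ⊎ (E1 × P)) ⊎ ((E2 × Q) ⊎ (E3 × R)) → P ⊎ Q ⊎ R
      mark (inj₁ (inj₂ (_ , g))) = inj₁ g
      mark (inj₂ (inj₁ (_ , g))) = inj₂ (inj₁ g)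
      mark (inj₂ (inj₂ (_ , g))) = inj₂ (inj₂ g)
      allowed : ∀ {x y} → x ∈ T → y ∈ T → Guards no-guard gᵃ gᵇ gᶜ x y → Sep (Cube⁴ m n p q) x y ⊎ E x y
      allowed x∈ y∈ g with Four-∈ {Full.points F} {Line.points b} {Line.points c} {Line.points d} x∈ | Four-∈ {Full.points F} {Line.points b} {Line.points c} {Line.points d} y∈
      ... | _ , b∈ , c∈ , d∈ | _ , b′∈ , c′∈ , d′∈ with thin-sep ¬b b∈ b′∈ | thin-sep ¬c c∈ c′∈ | thin-sep ¬d d∈ d′∈
      ... | inj₁ s | _ | _ = inj₁ (inj₁ (inj₁ (inj₂ s)))
      ... | _ | inj₁ s | _ = inj₁ (inj₁ (inj₂ s))
      ... | _ | _ | inj₁ s = inj₁ (inj₂ s)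
      ... | inj₂ refl | inj₂ refl | inj₂ refl = inj₂ (allow (mark g))
    resolve (full A α ta _ _) (thin b β tb _) (thin c γ tc _) (full D δ td _ _) _ =
      loosen (retotal (total ta tb tc td) (cuboid (full A α) (thin b β) (thin c γ) (full D δ) (lift unit)))
    resolve (full A α ta _ _) (thin b β tb _) (full C γ tc _ _) (thin d δ td _) _ =
      loosen (retotal (total ta tb tc td) (cuboid (full A α) (thin b β) (full C γ) (thin d δ) (lift unit)))
    resolve (full A α ta _ _) (thin b β tb _) (full C γ tc _ _) (full D δ td _ _) _ =
      loosen (retotal (total ta tb tc td) (cuboid (full A α) (thin b β) (full C γ) (full D δ) (lift unit)))
    resolve (full A α ta _ _) (full B β tb _ _) (thin c γ tc _) (thin d δ td _) _ =
      loosen (retotal (total ta tb tc td) (cuboid (full A α) (full B β) (thin c γ) (thin d δ) (lift unit)))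
    resolve (full A α ta _ _) (full B β tb _ _) (thin c γ tc _) (full D δ td _ _) _ =
      loosen (retotal (total ta tb tc td) (cuboid (full A α) (full B β) (thin c γ) (full D δ) (lift unit)))
    resolve (full A α ta _ _) (full B β tb _ _) (full C γ tc _ _) (thin d δ td _) _ =
      loosen (retotal (total ta tb tc td) (cuboid (full A α) (full B β) (full C γ) (thin d δ) (lift unit)))
    resolve (full A _ ta refl refl) (full B _ tb b⊥ b⊤) (full C _ tc refl refl) (full D _ td refl refl) S =
      recover (↭-reflexive (rect-assocˡ (rect (Full.points A) (Full.points B)) (Full.points C) (Full.points D)))
        (map-tame flattenʰ (retotal (trans (sym (+-assoc (Full.total A + Full.total B) _ _)) (total ta tb tc td))
          (four-full A B C D (λ x y → E (assocˡ x) (assocˡ y))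
            (subst₂ (λ b b′ → E (((⊥ , b) , ⊥) , ⊥) (((⊤ , b′) , ⊤) , ⊤)) (sym b⊥) (sym b⊤) (Allowance.corner S))
            (λ a a′ → Allowance.inner S (there (there (here refl))) third≢⊥ third≢⊤
                        (here (sym b⊥)) (subst (_∈ Full.points B) b⊤ last∈)))))
      where
      module B = Full B
      third≢⊥ : B.third ≢ ⊥
      third≢⊥ e = 1+n≢0 (trans (sym (up B.next)) (trans (cong ∣_∣ e) (∣⊥∣≡0 n)))
      third≢⊤ : B.third ≢ ⊤
      third≢⊤ e = <-irrefl (cong ∣_∣ (trans e (sym b⊤))) (≤-<-trans (walk-≤ B.walk) (≤-reflexive (sym (up B.leave))))
      last∈ : B.last ∈ Full.points B
      last∈ = there (there (there (∈-++⁺ʳ B.middle (here refl))))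

-- Counting common points of two chains

module _ {A : Set} where

  take-out : ∀ {x : A} {L} → x ∈ L → ∃ λ L′ → length L ≡ suc (length L′) × (∀ {y} → y ∈ L → y ≢ x → y ∈ L′)
  take-out {L = x ∷ L} (here refl) = L , refl , λ { (here refl) y≢x → contradiction refl y≢x ; (there y∈) _ → y∈ }
  take-out {L = z ∷ L} (there x∈) with take-out x∈
  ... | L′ , len , rest = z ∷ L′ , cong suc len , λ { (here refl) _ → here refl ; (there y∈) y≢x → there (rest y∈ y≢x) }

  two-in : ∀ {x y : A} {L} → x ∈ L → y ∈ L → y ≢ x → 2 ≤ length L
  two-in x∈ y∈ y≢x with take-out x∈
  ... | L′ , len , rest with take-out (rest y∈ y≢x)
  ... | _ , len′ , _ = subst (2 ≤_) (sym (trans len (cong suc len′))) (s≤s (s≤s z≤n))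

  three-in : ∀ {x y z : A} {L} → x ∈ L → y ∈ L → z ∈ L → y ≢ x → z ≢ x → z ≢ y → 3 ≤ length L
  three-in x∈ y∈ z∈ y≢x z≢x z≢y with take-out x∈
  ... | L′ , len , rest = subst (3 ≤_) (sym len) (s≤s (two-in (rest y∈ y≢x) (rest z∈ z≢x) z≢y))

  AP-∈ : ∀ {R : A → A → Set} {x y : A} {L} → AllPairs R L → x ∈ L → y ∈ L → x ≢ y → R x y ⊎ R y x
  AP-∈ (r ∷ rs) (here refl) (here refl) x≢y = contradiction refl x≢y
  AP-∈ (r ∷ rs) (here refl) (there y∈)  x≢y = inj₁ (All.lookup r y∈)
  AP-∈ (r ∷ rs) (there x∈)  (here refl) x≢y = inj₂ (All.lookup r x∈)
  AP-∈ (r ∷ rs) (there x∈)  (there y∈)  x≢y = AP-∈ rs x∈ y∈ x≢y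

  AP-lookup : ∀ {R : A → A → Set} L → (∀ i j → i Fin.< j → R (lookup L i) (lookup L j)) → AllPairs R L
  AP-lookup []      r = []
  AP-lookup {R} (x ∷ L) r =
    All.tabulate (λ y∈ → subst (R x) (sym (lookup-index y∈)) (r 0F (Fin.suc (index y∈)) (s≤s z≤n)))
    ∷ AP-lookup L (λ i j i<j → r (Fin.suc i) (Fin.suc j) (s≤s i<j))

module _ {n : ℕ} where

  _∈?_ : ∀ (x : Subset n) L → Dec (x ∈ L)
  x ∈? L = any? (x ≟S_) L

  common-∈ : ∀ {A B : Chain n} {x} → x ∈ A → x ∈ B → x ∈ filter (λ x → x ∈? B) A
  common-∈ {A} {B} = ∈-filter⁺ (λ x → x ∈? B)

  ⊥≢⊤ : 0 < n → ⊥ {n} ≢ ⊤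
  ⊥≢⊤ 0<n e = <-irrefl (trans (sym (∣⊥∣≡0 n)) (trans (cong ∣_∣ e) (∣⊤∣≡n n))) 0<n

  -- The two extremes and `x` would be three common points of chains that share exactly two.
  full-common : ∀ {F G A B} {x : Subset n} → AlmostOrthogonal n F G → 0 < n → A ∈ F → B ∈ G →
                ⊥ ∈ A → ⊤ ∈ A → ⊥ ∈ B → ⊤ ∈ B → x ∈ A → x ∈ B → x ≢ ⊥ → x ≢ ⊤ → Empty
  full-common {A = A} {B} ao 0<n A∈ B∈ ⊥A ⊤A ⊥B ⊤B xA xB x≢⊥ x≢⊤ =
    1+n≰n (subst (3 ≤_) (proj₁ (ao A B A∈ B∈) (⊥A , ⊤A , ⊥B , ⊤B))
      (three-in (common-∈ ⊥A ⊥B) (common-∈ ⊤A ⊤B) (common-∈ xA xB) (⊥≢⊤ 0<n ∘ sym) x≢⊥ x≢⊤))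

  -- Unless both chains are full, two common points are already too many. If both are full, one of
  -- `x` and `y` is neither extreme, and it would be a third common point.
  inseparable : ∀ {F G A B} {x y : Subset n} → AlmostOrthogonal n F G → 0 < n → A ∈ F → B ∈ G →
                x ∈ A → x ∈ B → y ∈ A → y ∈ B → Sep (Cube n) x y → Empty
  inseparable {A = A} {B} {x} {y} ao 0<n A∈ B∈ xA xB yA yB (x≢y , ¬⊥⊤ , ¬⊤⊥)
    with ⊥ ∈? A ×-dec ⊤ ∈? A ×-dec ⊥ ∈? B ×-dec ⊤ ∈? B
  ... | no ¬f = 1+n≰n (≤-trans (two-in (common-∈ xA xB) (common-∈ yA yB) (x≢y ∘ sym)) (proj₂ (ao A B A∈ B∈) ¬f))
  ... | yes (⊥A , ⊤A , ⊥B , ⊤B) with x ≟S ⊥ | x ≟S ⊤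
  ...   | yes x⊥ | _      = full-common ao 0<n A∈ B∈ ⊥A ⊤A ⊥B ⊤B yA yB (λ y⊥ → x≢y (trans x⊥ (sym y⊥))) (λ y⊤ → ¬⊥⊤ (x⊥ , y⊤))
  ...   | no _   | yes x⊤ = full-common ao 0<n A∈ B∈ ⊥A ⊤A ⊥B ⊤B yA yB (λ y⊥ → ¬⊤⊥ (x⊤ , y⊥)) (λ y⊤ → x≢y (trans x⊤ (sym y⊤)))
  ...   | no x≢⊥ | no x≢⊤ = full-common ao 0<n A∈ B∈ ⊥A ⊤A ⊥B ⊤B xA xB x≢⊥ x≢⊤

  Extremes : Subset n → Subset n → Set
  Extremes x y = (x ≡ ⊥ × y ≡ ⊤) ⊎ (x ≡ ⊤ × y ≡ ⊥)

  -- Two distinct common points are the two extremes, so both chains are full; a third point would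
  -- have to form such a pair with each of them.
  meet-in-extremes : 0 < n → ∀ {A B : Chain n} → Unique A →
    (∀ {x y} → x ∈ A → x ∈ B → y ∈ A → y ∈ B → x ≢ y → Extremes x y) →
    ((⊥ ∈ A × ⊤ ∈ A × ⊥ ∈ B × ⊤ ∈ B) → common A B ≡ 2)
    × (¬ (⊥ ∈ A × ⊤ ∈ A × ⊥ ∈ B × ⊤ ∈ B) → common A B ≤ 1)
  meet-in-extremes 0<n {A} {B} uA meet = count (filter (λ x → x ∈? B) A)
    (UniqueP.filter⁺ (λ x → x ∈? B) uA) (∈-filter⁻ (λ x → x ∈? B)) (λ (⊥A , ⊤A , ⊥B , ⊤B) → common-∈ ⊥A ⊥B , common-∈ ⊤A ⊤B)
    where
    Fullness = ⊥ ∈ A × ⊤ ∈ A × ⊥ ∈ B × ⊤ ∈ B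
    count : ∀ L → Unique L → (∀ {x} → x ∈ L → x ∈ A × x ∈ B) → (Fullness → ⊥ ∈ L × ⊤ ∈ L) →
            (Fullness → length L ≡ 2) × (¬ Fullness → length L ≤ 1)
    count [] _ _ f = (λ φ → contradiction (proj₁ (f φ)) λ ()) , λ _ → z≤n
    count (u ∷ []) _ _ f = (λ φ → contradiction (same (f φ)) (⊥≢⊤ 0<n)) , λ _ → s≤s z≤n
      where
      same : ⊥ ∈ u ∷ [] × ⊤ ∈ u ∷ [] → ⊥ ≡ ⊤
      same (here p , here q) = trans p (sym q)
    count (u ∷ v ∷ []) ((u≢v ∷ []) ∷ _) m f with m (here refl) | m (there (here refl))
    ... | uA , uB | vA , vB with meet uA uB vA vB u≢v
    ...   | inj₁ (refl , refl) = (λ _ → refl) , λ ¬f → contradiction (uA , vA , uB , vB) ¬f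
    ...   | inj₂ (refl , refl) = (λ _ → refl) , λ ¬f → contradiction (vA , uA , vB , uB) ¬f
    count (u ∷ v ∷ w ∷ _) ((u≢v ∷ u≢w ∷ _) ∷ (v≢w ∷ _) ∷ _) m f
      with m (here refl) | m (there (here refl)) | m (there (there (here refl)))
    ... | uA , uB | vA , vB | wA , wB = ⊥-elim (clash (meet uA uB vA vB u≢v) (meet uA uB wA wB u≢w) )
      where
      clash : Extremes u v → Extremes u w → Empty
      clash (inj₁ (_ , p)) (inj₁ (_ , q)) = v≢w (trans p (sym q))
      clash (inj₂ (_ , p)) (inj₂ (_ , q)) = v≢w (trans p (sym q))
      clash (inj₁ (p , _)) (inj₂ (q , _)) = ⊥≢⊤ 0<n (trans (sym p) q)
      clash (inj₂ (p , _)) (inj₁ (q , _)) = ⊥≢⊤ 0<n (trans (sym q) p)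

-- Symmetric chain decompositions as lists

sym-unique : ∀ {n A} → IsSymChain n A → Unique A
sym-unique {A = A} (j , _ , _ , ranked , _) = AP-lookup A λ i i′ i<i′ e →
  <-irrefl (+-cancelˡ-≡ j _ _ (trans (sym (ranked i)) (trans (cong ∣_∣ e) (ranked i′)))) i<i′

scd-unique : ∀ {n} F → IsSCD n F → Unique (concat F)
scd-unique F (sym-chain , _ , once) = UniqueP.concat⁺
  (All.tabulate (λ A∈ → subst Unique (sym (lookup-index A∈)) (sym-unique (sym-chain (index A∈)))))
  (AP-lookup F λ i j i<j (x∈ , x∈′) → FinP.<-irrefl (once _ i j x∈ x∈′) i<j)

scd-complete : ∀ {n} F → IsSCD n F → ∀ x → x ∈ concat F
scd-complete F (_ , every , _) x with every x
... | i , x∈ = ∈-concat⁺′ x∈ (∈-lookup {xs = F} i)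

once : ∀ {A : Set} {x : A} F → Unique (concat F) → ∀ i j → x ∈ lookup F i → x ∈ lookup F j → i ≡ j
once (A ∷ F) u 0F          0F          _  _   = refl
once (A ∷ F) u 0F          (Fin.suc j) x∈ x∈′ =
  contradiction refl (All.lookup (All.lookup (AP-cross A u) x∈) (∈-concat⁺′ x∈′ (∈-lookup {xs = F} j)))
once (A ∷ F) u (Fin.suc i) 0F          x∈ x∈′ =
  contradiction refl (All.lookup (All.lookup (AP-cross A u) x∈′) (∈-concat⁺′ x∈ (∈-lookup {xs = F} i)))
once (A ∷ F) u (Fin.suc i) (Fin.suc j) x∈ x∈′ = cong Fin.suc (once F (AP-++ʳ A u) i j x∈ x∈′)

to-scd : ∀ {n F} → All (IsSymChain n) F → Unique (concat F) → (∀ x → x ∈ concat F) → IsSCD n F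
to-scd {F = F} sym-chain u complete =
  (λ i → All.lookup sym-chain (∈-lookup i))
  , (λ x → let A , x∈ , A∈ = ∈-concat⁻′ F (complete x) in index A∈ , subst (x ∈_) (lookup-index A∈) x∈)
  , λ x i j → once F u i j

chain-sym : ∀ {n E P} → Chainₙ (Loosen (Cube n) E) n P → IsSymChain n P
chain-sym {n} (chain {x} {P} {z} w e) =
  ∣ x ∣
  , subst (∣ x ∣ + ∣ x ∣ ≤_) e (+-monoʳ-≤ ∣ x ∣ (walk-≤ w))
  , trans (solve 2 (λ x l → (con 1 :+ l) :+ x :+ x := con 1 :+ (x :+ (x :+ l))) refl ∣ x ∣ (length P))
          (cong suc (trans (cong (∣ x ∣ +_) (sym (walk-length w))) e))
  , ranked w , linked w
  where
  ranked : ∀ {x P z E} → Walk (Loosen (Cube n) E) x P z → ∀ i → ∣ lookup (x ∷ P) i ∣ ≡ ∣ x ∣ + toℕ i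
  ranked w                0F          = sym (+-identityʳ _)
  ranked {x} (step _ r ∷ w) (Fin.suc i) = trans (ranked w i) (trans (cong (_+ toℕ i) r) (sym (+-suc ∣ x ∣ (toℕ i))))
  linked : ∀ {x P z E} → Walk (Loosen (Cube n) E) x P z → Linked _⊆_ (x ∷ P)
  linked []      = [-]
  linked (s ∷ w) = below s ∷ linked w

-- Compatibility of the exceptions for different indices

-- `unique` is the out-degree condition of goodness: a set is the tail of at most one edge, and that
-- edge belongs to one index.
record Tails {n k : ℕ} (F : Fin k → List (Chain n)) : Set₁ where
  field
    mark   : Fin k → Subset n → Set
    unique : ∀ {i j x} → mark i x → mark j x → i ≡ j

no-tails : ∀ {n k} {F : Fin k → List (Chain n)} → Tails F
no-tails = record { mark = λ _ _ → Empty ; unique = λ () }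

module _ {n k : ℕ} {F : Fin k → List (Chain n)} (good : Good n k F) where
  private
    orient   = proj₁ good
    distinct = proj₂ good

  tails-of : Tails F
  tails-of = record
    { mark   = λ i x → ∃ λ c → tail2 (orient (i , c)) (edge F (i , c)) ≡ just x
    ; unique = λ (c , e) (c′ , e′) → cong proj₁ (distinct (_ , c) (_ , c′) _ e e′) }

  tails-marked : ∀ {i A} → A ∈ F i → Marked (Tails.mark tails-of i) A
  tails-marked {i} A∈ x y refl with lookup-index A∈ | orient (i , index A∈) in o
  ... | eq | true  = inj₁ (index A∈ , trans (cong₂ tail2 o (sym eq)) refl)
  ... | eq | false = inj₂ (index A∈ , trans (cong₂ tail2 o (sym eq)) refl)

-- A good family among three, which accounts for the jumps of the fourth coordinate.
record Watch {m n p k : ℕ} (F : Fin k → List (Chain m)) (G : Fin k → List (Chain n)) (H : Fin k → List (Chain p)) : Set₁ where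
  field
    tᵃ     : Tails F
    tᵇ     : Tails G
    tᶜ     : Tails H

  Seen : Fin k → Subset m → Subset n → Subset p → Set
  Seen i a b c = Tails.mark tᵃ i a ⊎ Tails.mark tᵇ i b ⊎ Tails.mark tᶜ i c

  field
    once′  : ∀ {i j a b c} → Seen i a b c → Seen j a b c → i ≡ j
    marked : ∀ {i A B C} → A ∈ F i → B ∈ G i → C ∈ H i →
             Marked (Tails.mark tᵃ i) A ⊎ Marked (Tails.mark tᵇ i) B ⊎ Marked (Tails.mark tᶜ i) C

  guard : ∀ {i A B C E} → A ∈ F i → B ∈ G i → C ∈ H i → (∀ {a b c} → Seen i a b c → E a b c) → Guard A B C E
  guard A∈ B∈ C∈ allow = record { marked = marked A∈ B∈ C∈ ; allow = allow }

module _ {m n p k : ℕ} {F : Fin k → List (Chain m)} {G : Fin k → List (Chain n)} {H : Fin k → List (Chain p)} where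

  private
    pick₁ : ∀ {P : Set} → P ⊎ Empty ⊎ Empty → P
    pick₁ (inj₁ p) = p
    pick₁ (inj₂ (inj₁ ()))
    pick₁ (inj₂ (inj₂ ()))

    pick₂ : ∀ {P : Set} → Empty ⊎ P ⊎ Empty → P
    pick₂ (inj₂ (inj₁ p)) = p

    pick₃ : ∀ {P : Set} → Empty ⊎ Empty ⊎ P → P
    pick₃ (inj₂ (inj₂ p)) = p

  watch : Good m k F ⊎ Good n k G ⊎ Good p k H → Watch F G H
  watch (inj₁ good) = record
    { tᵃ = tails-of {F = F} good ; tᵇ = no-tails ; tᶜ = no-tails
    ; once′  = λ s t → Tails.unique (tails-of {F = F} good) (pick₁ s) (pick₁ t)
    ; marked = λ A∈ _ _ → inj₁ (tails-marked {F = F} good A∈) }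
  watch (inj₂ (inj₁ good)) = record
    { tᵃ = no-tails ; tᵇ = tails-of {F = G} good ; tᶜ = no-tails
    ; once′  = λ s t → Tails.unique (tails-of {F = G} good) (pick₂ s) (pick₂ t)
    ; marked = λ _ B∈ _ → inj₂ (inj₁ (tails-marked {F = G} good B∈)) }
  watch (inj₂ (inj₂ good)) = record
    { tᵃ = no-tails ; tᵇ = no-tails ; tᶜ = tails-of {F = H} good
    ; once′  = λ s t → Tails.unique (tails-of {F = H} good) (pick₃ s) (pick₃ t)
    ; marked = λ _ _ C∈ → inj₂ (inj₂ (tails-marked {F = H} good C∈)) }

module Exceptions {m n p q k : ℕ}
  {F : Fin k → List (Chain m)} {G : Fin k → List (Chain n)} {H : Fin k → List (Chain p)} {K : Fin k → List (Chain q)}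
  (w₁ : Watch G H K) (w₂ : Watch F H K) (w₃ : Watch F G K) (w₄ : Watch F G H)
  (0<n : 0 < n) (0<p : 0 < p) (0<q : 0 < q)
  (aoG : ∀ i j → i ≢ j → AlmostOrthogonal n (G i) (G j)) where

  private
    Pt⁴′ = Pt⁴ m n p q

  Poles : Pt⁴′ → Pt⁴′ → Set
  Poles x y = x ≡ (((⊥ , ⊥) , ⊥) , ⊥) × y ≡ (((⊤ , ⊤) , ⊤) , ⊤)

  -- Only one coordinate may jump, and it does so where the factor watching it is at a tail.
  OneJump : Fin k → Pt⁴′ → Pt⁴′ → Set
  OneJump i (((a , b) , c) , d) (((a′ , b′) , c′) , d′) =
    (a ≡ a′ ⊎ Watch.Seen w₁ i b c d) × (b ≡ b′ ⊎ Watch.Seen w₂ i a c d)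
    × (c ≡ c′ ⊎ Watch.Seen w₃ i a b d) × (d ≡ d′ ⊎ Watch.Seen w₄ i a b c)
    × (c ≡ c′ ⊎ d ≡ d′)

  -- The movement of both `c` and `d` tells these jumps from `OneJump`, whose last clause keeps one
  -- of them fixed. The full chain through `b` is recorded so that two such jumps can be played off
  -- against each other.
  InnerJump : Fin k → Pt⁴′ → Pt⁴′ → Set
  InnerJump i (((a , b) , c) , d) (((a′ , b′) , c′) , d′) =
    c ≢ c′ × d ≢ d′ × b ≢ ⊥ × b ≢ ⊤ × ∃ λ B → B ∈ G i × b ∈ B × ⊥ ∈ B × ⊤ ∈ B

  Exception : Fin k → Pt⁴′ → Pt⁴′ → Set
  Exception i x y = Poles x y ⊎ OneJump i x y ⊎ InnerJump i x y

  allowance : ∀ {i A B C D} → A ∈ F i → B ∈ G i → C ∈ H i → D ∈ K i → Allowance A B C D (Exception i)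
  allowance A∈ B∈ C∈ D∈ = record
    { corner = inj₁ (refl , refl)
    ; inner  = λ b∈ b≢⊥ b≢⊤ ⊥∈ ⊤∈ → inj₂ (inj₂ (⊥≢⊤ 0<p , ⊥≢⊤ 0<q , b≢⊥ , b≢⊤ , _ , B∈ , b∈ , ⊥∈ , ⊤∈))
    ; alone₁ = Watch.guard w₁ B∈ C∈ D∈ λ s → inj₂ (inj₁ (inj₂ s , inj₁ refl , inj₁ refl , inj₁ refl , inj₁ refl))
    ; alone₂ = Watch.guard w₂ A∈ C∈ D∈ λ s → inj₂ (inj₁ (inj₁ refl , inj₂ s , inj₁ refl , inj₁ refl , inj₁ refl))
    ; alone₃ = Watch.guard w₃ A∈ B∈ D∈ λ s → inj₂ (inj₁ (inj₁ refl , inj₁ refl , inj₂ s , inj₁ refl , inj₂ refl))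
    ; alone₄ = Watch.guard w₄ A∈ B∈ C∈ λ s → inj₂ (inj₁ (inj₁ refl , inj₁ refl , inj₁ refl , inj₂ s , inj₁ refl)) }

  -- Among two `OneJump`s, a coordinate moving in both would be seen at the same point by both
  -- indices, against uniqueness of tails; so nothing moves. A `OneJump` and an `InnerJump` disagree
  -- on the last two coordinates. Two `InnerJump`s put `b` on full chains of both `G i` and `G j`.
  clash : ∀ {i j x y} → i ≢ j → x ≢ y → Exception i x y → Exception j x y → Poles x y
  clash i≢j x≢y (inj₁ e) _        = e
  clash i≢j x≢y (inj₂ _) (inj₁ e) = e
  clash {x = ((a , b) , c) , d} {((a′ , b′) , c′) , d′} i≢j x≢y
    (inj₂ (inj₁ (ea , eb , ec , ed , _))) (inj₂ (inj₁ (fa , fb , fc , fd , _))) =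
    contradiction (cong₂ _,_ (cong₂ _,_ (cong₂ _,_ (settle (Watch.once′ w₁) ea fa) (settle (Watch.once′ w₂) eb fb))
                                        (settle (Watch.once′ w₃) ec fc)) (settle (Watch.once′ w₄) ed fd)) x≢y
    where
    settle : ∀ {P Q E : Set} → (P → Q → _ ≡ _) → E ⊎ P → E ⊎ Q → E
    settle u (inj₁ e) _        = e
    settle u _        (inj₁ e) = e
    settle u (inj₂ s) (inj₂ t) = contradiction (u s t) i≢j
  clash i≢j x≢y (inj₂ (inj₁ (_ , _ , _ , _ , inj₁ e))) (inj₂ (inj₂ (c≢ , _))) = contradiction e c≢
  clash i≢j x≢y (inj₂ (inj₁ (_ , _ , _ , _ , inj₂ e))) (inj₂ (inj₂ (_ , d≢ , _))) = contradiction e d≢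
  clash i≢j x≢y (inj₂ (inj₂ (c≢ , _))) (inj₂ (inj₁ (_ , _ , _ , _ , inj₁ e))) = contradiction e c≢
  clash i≢j x≢y (inj₂ (inj₂ (_ , d≢ , _))) (inj₂ (inj₁ (_ , _ , _ , _ , inj₂ e))) = contradiction e d≢
  clash i≢j x≢y (inj₂ (inj₂ (_ , _ , b≢⊥ , b≢⊤ , B , B∈ , b∈ , ⊥∈ , ⊤∈))) (inj₂ (inj₂ (_ , _ , _ , _ , B′ , B′∈ , b∈′ , ⊥∈′ , ⊤∈′))) =
    ⊥-elim (full-common (aoG _ _ i≢j) 0<n B∈ B′∈ ⊥∈ ⊤∈ ⊥∈′ ⊤∈′ b∈ b∈′ b≢⊥ b≢⊤)

-- Assembling the cuboids and flattening the product

module _ {A B : Set} {Ψ : List B → Set} (g : List A → List B)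
         (g-[] : g [] ≡ []) (g-++ : ∀ P Q → g P ++ g Q ↭ g (P ++ Q)) where

  over-concat : ∀ F → (∀ {P} → P ∈ F → Decomp Ψ (g P)) → Decomp Ψ (g (concat F))
  over-concat []      f = recover (↭-reflexive (sym g-[])) none
  over-concat (P ∷ F) f = recover (g-++ P (concat F)) (f (here refl) ⊎ᵈ over-concat F (f ∘ there))

module _ {A B C D : Set} {Ψ : List (((A × B) × C) × D) → Set} where

  over-Four : ∀ F G H K → (∀ {P Q R S} → P ∈ F → Q ∈ G → R ∈ H → S ∈ K → Decomp Ψ (Four P Q R S)) →
              Decomp Ψ (Four (concat F) (concat G) (concat H) (concat K))
  over-Four F G H K f =
    over-concat (λ P → Four P (concat G) (concat H) (concat K)) refl
      (λ P Q → split (rect (rect P (concat G)) (concat H)) (rect (rect Q (concat G)) (concat H)) (concat K)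
        (split (rect P (concat G)) (rect Q (concat G)) (concat H)
          (↭-reflexive (sym (rect-++ˡ P Q (concat G)))))) F λ {P} P∈ →
    over-concat (λ Q → Four P Q (concat H) (concat K)) (cong (λ S → rect (rect S (concat H)) (concat K)) (rect-[] P))
      (λ Q R → split (rect (rect P Q) (concat H)) (rect (rect P R) (concat H)) (concat K)
        (split (rect P Q) (rect P R) (concat H) (↭-sym (rect-++ʳ P Q R)))) G λ {Q} Q∈ →
    over-concat (λ R → Four P Q R (concat K)) (cong (λ S → rect S (concat K)) (rect-[] (rect P Q)))
      (λ R S → split (rect (rect P Q) R) (rect (rect P Q) S) (concat K) (↭-sym (rect-++ʳ (rect P Q) R S))) H λ {R} R∈ →
    over-concat (λ S → Four P Q R S) (rect-[] (rect (rect P Q) R))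
      (λ S T → ↭-sym (rect-++ʳ (rect (rect P Q) R) S T)) K λ S∈ → f P∈ Q∈ R∈ S∈
    where
    split : ∀ {E Z : Set} (S T : List E) {U} (V : List Z) → S ++ T ↭ U → rect S V ++ rect T V ↭ rect U V
    split S T V p = ↭-trans (↭-reflexive (sym (rect-++ˡ S T V))) (rect-congˡ V p)

module _ {n : ℕ} where

  ∣++∣ : ∀ {m} (a : Subset m) (b : Subset n) → ∣ a Vec.++ b ∣ ≡ ∣ a ∣ + ∣ b ∣
  ∣++∣ []            b = refl
  ∣++∣ (inside  ∷ a) b = cong suc (∣++∣ a b)
  ∣++∣ (outside ∷ a) b = ∣++∣ a b

  ++-⊆ : ∀ {m} {a a′ : Subset m} {b b′ : Subset n} → a ⊆ a′ → b ⊆ b′ → a Vec.++ b ⊆ a′ Vec.++ b′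
  ++-⊆ {a = []}    {[]}     l r i = r i
  ++-⊆ {a = x ∷ a} {y ∷ a′} l r Vec.here with l Vec.here
  ... | Vec.here = Vec.here
  ++-⊆ {a = x ∷ a} {y ∷ a′} l r (Vec.there i) = Vec.there (++-⊆ (drop-∷-⊆ l) r i)

  replicate-++ : ∀ {m} (s : Bool.Bool) → Vec.replicate m s Vec.++ Vec.replicate n s ≡ Vec.replicate (m + n) s
  replicate-++ {zero}  s = refl
  replicate-++ {suc m} s = cong (s ∷_) (replicate-++ {m} s)

module Flatten (m n p q : ℕ) where

  N : ℕ
  N = m + n + p + q

  flat : Pt⁴ m n p q → Subset N
  flat (((a , b) , c) , d) = ((a Vec.++ b) Vec.++ c) Vec.++ d

  -- In the target every pair counts as separated: jumps are accounted for before flattening, and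
  -- only the chains themselves are carried over.
  flatʰ : ∀ {E} → Hom (Loosen (Cube⁴ m n p q) E) (Loosen (Cube N) (λ _ _ → Unit))
  flatʰ .to = flat
  flatʰ .ranks (((a , b) , c) , d) =
    trans (∣++∣ ((a Vec.++ b) Vec.++ c) d) (cong (_+ ∣ d ∣)
      (trans (∣++∣ (a Vec.++ b) c) (cong (_+ ∣ c ∣) (∣++∣ a b))))
  flatʰ .mono {((a , b) , c) , d} {((a′ , b′) , c′) , d′} (((la , lb) , lc) , ld) =
    ++-⊆ {a = (a Vec.++ b) Vec.++ c} {(a′ Vec.++ b′) Vec.++ c′} (++-⊆ {a = a Vec.++ b} {a′ Vec.++ b′} (++-⊆ {a = a} {a′} la lb) lc) ld
  flatʰ .seps _ = inj₂ unit

  flat-injective : ∀ {x y} → flat x ≡ flat y → x ≡ y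
  flat-injective {((a , b) , c) , d} {((a′ , b′) , c′) , d′} e
    with ++-injective ((a Vec.++ b) Vec.++ c) ((a′ Vec.++ b′) Vec.++ c′) e
  ... | e , refl with ++-injective (a Vec.++ b) (a′ Vec.++ b′) e
  ... | e , refl with ++-injective a a′ e
  ... | refl , refl = refl

  flat-surjective : ∀ x → ∃ λ y → x ≡ flat y
  flat-surjective x with Vec.splitAt (m + n + p) x
  ... | y , d , refl with Vec.splitAt (m + n) y
  ... | z , c , refl with Vec.splitAt m z
  ... | a , b , refl = (((a , b) , c) , d) , refl

  flat-replicate : ∀ (s : Bool.Bool) → flat (((Vec.replicate m s , Vec.replicate n s) , Vec.replicate p s) , Vec.replicate q s)
                         ≡ Vec.replicate N s
  flat-replicate s = trans (cong (λ x → (x Vec.++ _) Vec.++ _) (replicate-++ {n = n} {m} s))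
    (trans (cong (Vec._++ _) (replicate-++ {n = p} {m + n} s)) (replicate-++ {n = q} {m + n + p} s))

-- The decompositions and their almost orthogonality

module Family {m n p q k : ℕ} (3≤m : 3 ≤ m) (3≤n : 3 ≤ n) (3≤p : 3 ≤ p) (3≤q : 3 ≤ q)
  (oddm : Odd m) (oddn : Odd n) (oddp : Odd p) (oddq : Odd q)
  {F : Fin k → List (Chain m)} {G : Fin k → List (Chain n)} {H : Fin k → List (Chain p)} {K : Fin k → List (Chain q)}
  (paoF : IsPAOFamily m k F) (paoG : IsPAOFamily n k G)
  (paoH : IsPAOFamily p k H) (paoK : IsPAOFamily q k K)
  (w₁ : Watch G H K) (w₂ : Watch F H K) (w₃ : Watch F G K) (w₄ : Watch F G H) where

  open Flatten m n p q

  private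
    scdF = proj₁ paoF
    aoF  = proj₂ paoF
    scdG = proj₁ paoG
    aoG  = proj₂ paoG
    scdH = proj₁ paoH
    aoH  = proj₂ paoH
    scdK = proj₁ paoK
    aoK  = proj₂ paoK

    positive : ∀ {n} → 3 ≤ n → 0 < n
    positive = ≤-trans (s≤s z≤n)

  open Exceptions w₁ w₂ w₃ w₄ (positive 3≤n) (positive 3≤p) (positive 3≤q) aoG

  Q : Fin k → Space
  Q i = Loosen (Cube⁴ m n p q) (Exception i)

  InCuboid : Fin k → List (Pt⁴ m n p q) → Set
  InCuboid i P = ∃ λ A → ∃ λ B → ∃ λ C → ∃ λ E →
    A ∈ F i × B ∈ G i × C ∈ H i × E ∈ K i × All (_∈ Four A B C E) P

  all-points : Fin k → List (Pt⁴ m n p q)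
  all-points i = Four (concat (F i)) (concat (G i)) (concat (H i)) (concat (K i))

  private
    reading : ∀ {n A} {S : List (Chain n)} → 3 ≤ n → Odd n → IsSCD n S → A ∈ S → Reading A
    reading 3≤ odd (sym-chain , _) A∈ =
      subst Reading (sym (lookup-index A∈)) (read 3≤ odd (sym-chain (index A∈)))

  abstract
    -- Each chain remembers its cuboid. This gives the containment claimed in the theorem, and it
    -- lets almost orthogonality be tested one coordinate at a time.
    decomposition : ∀ i → Decomp (λ P → JumpFree (Q i) N P × InCuboid i P) (all-points i)
    decomposition i = over-Four (F i) (G i) (H i) (K i) λ A∈ B∈ C∈ E∈ →
      relax (λ (free , enclosed) → free , _ , _ , _ , _ , A∈ , B∈ , C∈ , E∈ , enclosed)
        (within (resolve (reading 3≤m oddm (scdF i) A∈) (reading 3≤n oddn (scdG i) B∈)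
                         (reading 3≤p oddp (scdH i) C∈) (reading 3≤q oddq (scdK i) E∈)
                         (allowance A∈ B∈ C∈ E∈)))

  chains : Fin k → List (List (Pt⁴ m n p q))
  chains i = Decomp.chains (decomposition i)

  D : Fin k → List (Chain N)
  D i = map (map flat) (chains i)

  concat-D : ∀ i → concat (D i) ≡ map flat (concat (chains i))
  concat-D i = concat-map (chains i)

  unique-D : ∀ i → Unique (concat (D i))
  unique-D i = subst Unique (sym (concat-D i)) (UniqueP.map⁺ flat-injective
    (Unique-resp-↭ (setoid _) (↭⇒↭ₛ (↭-sym (Decomp.covers (decomposition i))))
      (UniqueP.cartesianProduct⁺ (UniqueP.cartesianProduct⁺ (UniqueP.cartesianProduct⁺
        (scd-unique (F i) (scdF i)) (scd-unique (G i) (scdG i))) (scd-unique (H i) (scdH i))) (scd-unique (K i) (scdK i)))))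

  complete-D : ∀ i x → x ∈ concat (D i)
  complete-D i x with flat-surjective x
  ... | (((a , b) , c) , d) , refl = subst (_ ∈_) (sym (concat-D i)) (∈-map⁺ flat
    (∈-resp-↭ (↭-sym (Decomp.covers (decomposition i)))
      (∈-cartesianProduct⁺ (∈-cartesianProduct⁺ (∈-cartesianProduct⁺
        (scd-complete (F i) (scdF i) a) (scd-complete (G i) (scdG i) b)) (scd-complete (H i) (scdH i) c)) (scd-complete (K i) (scdK i) d))))

  scd-D : ∀ i → IsSCD N (D i)
  scd-D i = to-scd (AllP.map⁺ (All.map (λ ((c , _) , _) → chain-sym (map-chain flatʰ c)) (Decomp.good (decomposition i))))
                   (unique-D i) (complete-D i)

  private
    -- In the coordinate that separates `x` and `y`, both values lie on a chain of the i-th and on a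
    -- chain of the j-th family, which `inseparable` forbids.
    separate : ∀ {i j P R x y} → i ≢ j → InCuboid i P → InCuboid j R →
               x ∈ P → x ∈ R → y ∈ P → y ∈ R → Sep (Cube⁴ m n p q) x y → Empty
    separate {i} {j} i≢j (A , B , C , E , A∈ , B∈ , C∈ , E∈ , inP) (A′ , B′ , C′ , E′ , A′∈ , B′∈ , C′∈ , E′∈ , inR) xP xR yP yR s
      with Four-∈ {A = A} {B} {C} {E} (All.lookup inP xP) | Four-∈ {A = A′} {B′} {C′} {E′} (All.lookup inR xR)
         | Four-∈ {A = A} {B} {C} {E} (All.lookup inP yP) | Four-∈ {A = A′} {B′} {C′} {E′} (All.lookup inR yR)
    ... | a₁ , b₁ , c₁ , d₁ | a₂ , b₂ , c₂ , d₂ | a₃ , b₃ , c₃ , d₃ | a₄ , b₄ , c₄ , d₄ with s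
    ... | inj₁ (inj₁ (inj₁ s)) = inseparable (aoF i j i≢j) (positive 3≤m) A∈ A′∈ a₁ a₂ a₃ a₄ s
    ... | inj₁ (inj₁ (inj₂ s)) = inseparable (aoG i j i≢j) (positive 3≤n) B∈ B′∈ b₁ b₂ b₃ b₄ s
    ... | inj₁ (inj₂ s)        = inseparable (aoH i j i≢j) (positive 3≤p) C∈ C′∈ c₁ c₂ c₃ c₄ s
    ... | inj₂ s               = inseparable (aoK i j i≢j) (positive 3≤q) E∈ E′∈ d₁ d₂ d₃ d₄ s

    ordered : ∀ {i P} → JumpFree (Q i) N P →
              AllPairs (λ x y → Apart (Q i) x y × rank (Q i) x < rank (Q i) y) P
    ordered (chain w _ , free) = AllPairs.zip (free , walk-< w)

    -- Each chain gives information on `x` and `y` in its own order only; since ranks increase along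
    -- both, the orders agree. As no coordinate separates the pair, it is an exception for both
    -- indices, and `clash` leaves only the extreme corners.
    poles : ∀ {i j P R x y} → i ≢ j → JumpFree (Q i) N P → JumpFree (Q j) N R → InCuboid i P → InCuboid j R →
            x ∈ P → x ∈ R → y ∈ P → y ∈ R → x ≢ y → Poles x y ⊎ Poles y x
    poles i≢j jP jR cP cR xP xR yP yR x≢y with AP-∈ (ordered jP) xP yP x≢y | AP-∈ (ordered jR) xR yR x≢y
    ... | inj₁ (s , _)   | inj₁ (t , _)   = inj₁ (both s t)
      where
      both : Apart (Q _) _ _ → Apart (Q _) _ _ → Poles _ _
      both (apart (inj₁ s)) _                = ⊥-elim (separate i≢j cP cR xP xR yP yR s)
      both _                (apart (inj₁ s)) = ⊥-elim (separate i≢j cP cR xP xR yP yR s)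
      both (apart (inj₂ e)) (apart (inj₂ f)) = clash i≢j x≢y e f
    ... | inj₂ (s , _)   | inj₂ (t , _)   = inj₂ (both s t)
      where
      both : Apart (Q _) _ _ → Apart (Q _) _ _ → Poles _ _
      both (apart (inj₁ s)) _                = ⊥-elim (separate i≢j cP cR yP yR xP xR s)
      both _                (apart (inj₁ s)) = ⊥-elim (separate i≢j cP cR yP yR xP xR s)
      both (apart (inj₂ e)) (apart (inj₂ f)) = clash i≢j (x≢y ∘ sym) e f
    ... | inj₁ (_ , x<y) | inj₂ (_ , y<x) = ⊥-elim (<-irrefl refl (<-trans x<y y<x))
    ... | inj₂ (_ , y<x) | inj₁ (_ , x<y) = ⊥-elim (<-irrefl refl (<-trans x<y y<x))

  ao-D : ∀ i j → i ≢ j → AlmostOrthogonal N (D i) (D j)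
  ao-D i j i≢j X Y X∈ Y∈ with ∈-map⁻ (map flat) X∈ | ∈-map⁻ (map flat) Y∈
  ... | P , P∈ , refl | R , R∈ , refl
    with All.lookup (Decomp.good (decomposition i)) P∈ | All.lookup (Decomp.good (decomposition j)) R∈
  ... | jP , cP | jR , cR = meet-in-extremes (≤-trans (positive 3≤q) (m≤n+m q (m + n + p)))
    (UniqueP.map⁺ flat-injective (AllPairs.map (λ (_ , x<y) e → <-irrefl (cong (rank (Cube⁴ m n p q)) e) x<y) (ordered jP)))
    meet
    where
    meet : ∀ {x y} → x ∈ map flat P → x ∈ map flat R → y ∈ map flat P → y ∈ map flat R → x ≢ y → Extremes x y
    meet xP xR yP yR x≢y with ∈-map⁻ flat xP | ∈-map⁻ flat yP | ∈-map⁻ flat xR | ∈-map⁻ flat yR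
    ... | x , xP , refl | y , yP , refl | x′ , xR , ex | y′ , yR , ey
      with flat-injective {x} {x′} ex | flat-injective {y} {y′} ey
    ... | refl | refl with poles i≢j jP jR cP cR xP xR yP yR (x≢y ∘ cong flat)
    ...   | inj₁ (refl , refl) = inj₁ (flat-replicate outside , flat-replicate inside)
    ...   | inj₂ (refl , refl) = inj₂ (flat-replicate inside , flat-replicate outside)

  private
    located : ∀ {A B C E P} → All (_∈ Four A B C E) P → ∀ x → x ∈ map flat P →
      Σ (Subset m) λ a → Σ (Subset n) λ b → Σ (Subset p) λ c → Σ (Subset q) λ d →
        a ∈ A × b ∈ B × c ∈ C × d ∈ E × x ≡ ((a Vec.++ b) Vec.++ c) Vec.++ d
    located {A} {B} {C} {E} inP x x∈ =
      let (((a , b) , c) , d) , y∈ , eq = ∈-map⁻ flat x∈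
          a∈ , b∈ , c∈ , d∈ = Four-∈ {A = A} {B} {C} {E} (All.lookup inP y∈)
      in a , b , c , d , a∈ , b∈ , c∈ , d∈ , eq

  contained : ∀ i X → X ∈ D i →
    Σ (Chain m) λ A → Σ (Chain n) λ B → Σ (Chain p) λ C → Σ (Chain q) λ E →
      A ∈ F i × B ∈ G i × C ∈ H i × E ∈ K i
      × (∀ x → x ∈ X →
          Σ (Subset m) λ a → Σ (Subset n) λ b → Σ (Subset p) λ c → Σ (Subset q) λ d →
            a ∈ A × b ∈ B × c ∈ C × d ∈ E × x ≡ ((a Vec.++ b) Vec.++ c) Vec.++ d)
  contained i X X∈ =
    let P , P∈ , X≡ = ∈-map⁻ (map flat) X∈
        _ , A , B , C , E , A∈ , B∈ , C∈ , E∈ , inP = All.lookup (Decomp.good (decomposition i)) P∈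
    in A , B , C , E , A∈ , B∈ , C∈ , E∈ ,
       λ x x∈ → located {A} {B} {C} {E} {P} inP x (subst (x ∈_) X≡ x∈)

theorem7p1 : (m n p q k : ℕ) →
    3 ≤ m → 3 ≤ n → 3 ≤ p → 3 ≤ q → Odd m → Odd n → Odd p → Odd q → 3 ≤ k →
    (F : Fin k → List (Chain m)) (G : Fin k → List (Chain n))
    (H : Fin k → List (Chain p)) (K : Fin k → List (Chain q)) →
    IsPAOFamily m k F → IsPAOFamily n k G → IsPAOFamily p k H → IsPAOFamily q k K →
    ((Good m k F × Good n k G) ⊎ (Good m k F × Good p k H) ⊎ (Good m k F × Good q k K)
      ⊎ (Good n k G × Good p k H) ⊎ (Good n k G × Good q k K) ⊎ (Good p k H × Good q k K)) →
    Σ (Fin k → List (Chain (m + n + p + q))) λ D →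
      IsPAOFamily (m + n + p + q) k D
      × (∀ (i : Fin k) (X : Chain (m + n + p + q)) → X ∈ D i →
          Σ (Chain m) λ A → Σ (Chain n) λ B → Σ (Chain p) λ C → Σ (Chain q) λ E →
            A ∈ F i × B ∈ G i × C ∈ H i × E ∈ K i
            × (∀ x → x ∈ X →
                Σ (Subset m) λ a → Σ (Subset n) λ b → Σ (Subset p) λ c → Σ (Subset q) λ d →
                  a ∈ A × b ∈ B × c ∈ C × d ∈ E × x ≡ ((a Vec.++ b) Vec.++ c) Vec.++ d))
theorem7p1 m n p q k 3≤m 3≤n 3≤p 3≤q oddm oddn oddp oddq _ F G H K paoF paoG paoH paoK goods =
  Solution.D , (Solution.scd-D , Solution.ao-D) , Solution.contained
  where
  Goods : Set
  Goods = (Good n k G ⊎ Good p k H ⊎ Good q k K) × (Good m k F ⊎ Good p k H ⊎ Good q k K)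
        × (Good m k F ⊎ Good n k G ⊎ Good q k K) × (Good m k F ⊎ Good n k G ⊎ Good p k H)

  -- Whichever coordinate is omitted, one of the two good families remains.
  remaining : _ → Goods
  remaining (inj₁ (f , g))                             = inj₁ g , inj₁ f , inj₁ f , inj₁ f
  remaining (inj₂ (inj₁ (f , h)))                      = inj₂ (inj₁ h) , inj₁ f , inj₁ f , inj₁ f
  remaining (inj₂ (inj₂ (inj₁ (f , l))))               = inj₂ (inj₂ l) , inj₁ f , inj₁ f , inj₁ f
  remaining (inj₂ (inj₂ (inj₂ (inj₁ (g , h)))))        = inj₁ g , inj₂ (inj₁ h) , inj₂ (inj₁ g) , inj₂ (inj₁ g)
  remaining (inj₂ (inj₂ (inj₂ (inj₂ (inj₁ (g , l)))))) = inj₁ g , inj₂ (inj₂ l) , inj₂ (inj₁ g) , inj₂ (inj₁ g)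
  remaining (inj₂ (inj₂ (inj₂ (inj₂ (inj₂ (h , l)))))) = inj₂ (inj₁ h) , inj₂ (inj₁ h) , inj₂ (inj₂ l) , inj₂ (inj₂ h)

  good₁ = proj₁ (remaining goods)
  good₂ = proj₁ (proj₂ (remaining goods))
  good₃ = proj₁ (proj₂ (proj₂ (remaining goods)))
  good₄ = proj₂ (proj₂ (proj₂ (remaining goods)))

  module Solution = Family 3≤m 3≤n 3≤p 3≤q oddm oddn oddp oddq {F} {G} {H} {K} paoF paoG paoH paoK
    (watch good₁) (watch good₂) (watch good₃) (watch good₄)
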